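{- Let $\epsilon > 0$ and let $\mathcal{A}_1$, $\mathcal{A}_2$, $\mathcal{A}_3$ be three "almost dense" sequences of positive integers. Then there exist constants $0 < c < C$ (independent of $x$) such that for all sufficiently large $x$, the interval $[x, x + x^{34/55 + \epsilon}]$ contains an integer $n = m \cdot a_1 \cdot a_2 \cdot a_3$ for some $a_i \in \mathcal{A}_i$ ($i = 1,2,3$) and a positive integer $m$, with $c x^{1/4} \le a_1, a_2, a_3, m \le C x^{1/4}$.
   Context: An infinite sequence (set) $\mathcal{A}$ of positive integers is called "almost dense" if for every $\epsilon > 0$ there exists a constant $c_{\epsilon,\mathcal{A}} > 0$ such that $\#\{X \le n \le 2X : n \in \mathcal{A}\} \ge c_{\epsilon,\mathcal{A}} X^{1 - \epsilon/4}$ for all sufficiently large $X$. The paper's notation $a_1,a_2,a_3,m \asymp x^{1/4}$ means each lies between two positive constant multiples of $x^{1/4}$, constants independent of $x$.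
   Formalization: The quantities x, X, ε and the constants c, C, c_ε range over rational numbers instead of real numbers; inequalities with fractional exponents are stated after raising both sides to integer powers. -}

module Defs where

open import Data.Nat as ℕ using (ℕ; zero; suc)
open import Data.Integer using (+_)
open import Data.Rational using (ℚ; 0ℚ; 1ℚ; _/_; _*_; _-_; _≤_; _<_)
open import Data.List using (List; length)
open import Data.List.Relation.Unary.All using (All)
open import Data.List.Relation.Unary.Unique.Propositional using (Unique)
open import Data.Product using (Σ; ∃; _×_; _,_)

⟦_⟧ : ℕ → ℚ
⟦ n ⟧ = + n / 1

_^ℚ_ : ℚ → ℕ → ℚ
x ^ℚ zero  = 1ℚ
x ^ℚ suc k = x * (x ^ℚ k)

Seq : Set₁
Seq = ℕ → Set

InfinitePos : Seq → Set
InfinitePos A = (∀ n → A n → 0 ℕ.< n) × (∀ N → ∃ λ n → N ℕ.≤ n × A n)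

AtLeastInWindow : Seq → ℚ → ℕ → Set
AtLeastInWindow A X k =
  Σ (List ℕ) λ L → Unique L × All (λ n → A n × X ≤ ⟦ n ⟧ × ⟦ n ⟧ ≤ ⟦ 2 ⟧ * X) L
    × k ℕ.≤ length L

-- Almost dense, with ε = p / q (p, q ≥ 1).
-- #{…} ≥ c · X^{1 - p/(4q)}  ⇔  #^{4q} · X^p ≥ c^{4q} · X^{4q}   (for X > 0, c > 0)
AlmostDense : Seq → Set
AlmostDense A =
  InfinitePos A ×
  (∀ (p q : ℕ) → 0 ℕ.< p → 0 ℕ.< q →
    Σ ℚ λ c → 0ℚ < c × Σ ℚ λ X₀ → ∀ (X : ℚ) → X₀ ≤ X → 0ℚ < X →
      Σ ℕ λ k → AtLeastInWindow A X k ×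
        (c ^ℚ (4 ℕ.* q)) * (X ^ℚ (4 ℕ.* q)) ≤ (⟦ k ⟧ ^ℚ (4 ℕ.* q)) * (X ^ℚ p))

{-# OPTIONS --safe #-}

-- Put x ≈ τ²⁰⁰, R = τ⁵⁰ and take all aᵢ in [R , 2R].  For b ∈ A₂ and c ∈ A₃ let y = ⌊N / bc⌋ + 1, where
-- N = ⌊x⌋ + 1; if some a ∈ A₁ has a multiple in [y , y + w), then the corresponding multiple of abc lies in
-- [N , N + 4R²w].  With w = τ²¹ this is short enough, so it suffices that not every such y is exceptional,
-- i.e. has no multiple of any a ∈ A₁ in [y , y + w).
--
-- There are many y: distinct products bc give distinct y, and there are few solutions of bc = b′c′.
-- There are few exceptional y: the number of multiples in a window, weighted so that each a contributes mean w,
-- has small variance.  The covariance of a and a′ is controlled by a coprime fraction t / s with s ≤ S and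
-- ∣ s a − t a′ ∣ ≤ 2R / S (Dirichlet): among s consecutive multiples of a, those close to a multiple of a′ are
-- almost evenly spaced.  The resulting error is of order R³ / s, and only O(R² / S) pairs (a , a′) share a
-- given s, so the errors add up to a harmonic sum.  Choosing R = S τ¹⁰ makes the two estimates contradictory
-- if all y are exceptional.
module Submission where

open import Defs
open import Data.Nat as ℕ using (ℕ; zero; suc; NonZero)
open import Data.Rational as ℚ using (ℚ; mkℚ; 0ℚ; 1ℚ; toℚᵘ; fromℚᵘ)
open import Data.Product using (Σ; ∃; _×_; _,_; proj₁; proj₂)
open import Relation.Binary.PropositionalEquality using (_≡_; _≢_; refl; sym; trans; cong; cong₂; subst; subst₂; module ≡-Reasoning)
import Data.Integer as ℤ
open import Data.Rational.Unnormalised as ℚᵘ using (mkℚᵘ; *≤*; *≡*)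
open import Data.List using (List; length)
open import Data.List.Relation.Unary.All as All using (All)
open import Data.List.Relation.Unary.Unique.Propositional using (Unique)
import Data.Nat.DivMod as ℕ
import Data.Nat.Properties as ℕ
import Data.Integer.Properties as ℤ
import Data.Integer.Tactic.RingSolver as ℤ-Solver
import Data.Rational.Properties as ℚ
import Data.Rational.Unnormalised.Properties as ℚᵘ

-- The obstacle: pairs (a , a′) whose ratio is close to a fraction of small denominator, the
-- diagonal among them, are strongly correlated, so no useful bound holds pair by pair; only the sum
-- over all pairs is small. Losses are paid in powers of the integer `τ`, which replaces logarithms
-- and real exponents: each sequence fills a proportion of at least 1 / τ of [R , 2R], and a
-- harmonic sum up to τᵏ costs about k τ. If all y were exceptional, their number would be at least
-- R² / τ⁶ by the energy bound, while Chebyshev allows at most about τ² R² / D. So D must exceed a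
-- constant times τ⁸, and D = τ¹⁰ is ample. The window w = D² τ pays for the saving D in the
-- variance, for the order of D possible values of s a - t a′, and for the harmonic sum. The length
-- 4 R² w + 1 is then at most τ¹²², and R = τ⁵⁰ is large enough to give 122 / 200 < 34 / 55.
-- Chebyshev and Cauchy-Schwarz are used in the linear form 2 u v ≤ u² + v², with all terms of one
-- sign on each side.

module Arithmetic where

  open import Data.Nat
  open import Data.Nat.Properties
  open import Data.Nat.Divisibility
  open import Data.Nat.DivMod
  open import Data.Nat.GCD using (gcd; gcd[m,n]∣m; gcd[m,n]∣n; gcd[m,n]≡0⇒m≡0)
  open import Data.Nat.Coprimality using (Coprime; coprime-/gcd; coprime-divisor; coprime⇒gcd≡1; gcd≡1⇒coprime)
  open import Data.Nat.Tactic.RingSolver using (solve-∀)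
  open import Data.Fin using (toℕ; fromℕ<)
  open import Data.Fin.Properties using (pigeonhole; toℕ<n; toℕ-fromℕ<)
  open import Data.List using ([]; _∷_)
  open import Data.List.Relation.Unary.All using ([]; _∷_)
  open import Data.List.Relation.Unary.AllPairs using ([]; _∷_)
  open import Data.Sum using (_⊎_; inj₁; inj₂)
  open import Data.Empty using (⊥; ⊥-elim)
  open import Relation.Nullary using (Dec; yes; no)
  open import Relation.Nullary.Decidable using (_×-dec_)
  open import Relation.Binary.Definitions using (tri<; tri≈; tri>)

  -- Finite sums

  ∑ : ℕ → (ℕ → ℕ) → ℕ
  ∑ zero    f = 0
  ∑ (suc n) f = ∑ n f + f n

  infix 5 ∑
  syntax ∑ n (λ i → e) = ∑[ i < n ] e

  ∑-mono : ∀ n {f g : ℕ → ℕ} → (∀ i → i < n → f i ≤ g i) → ∑ n f ≤ ∑ n g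
  ∑-mono zero    h = z≤n
  ∑-mono (suc n) h = +-mono-≤ (∑-mono n (λ i i<n → h i (m<n⇒m<1+n i<n))) (h n ≤-refl)

  ∑-cong : ∀ n {f g : ℕ → ℕ} → (∀ i → i < n → f i ≡ g i) → ∑ n f ≡ ∑ n g
  ∑-cong zero    h = refl
  ∑-cong (suc n) h = cong₂ _+_ (∑-cong n (λ i i<n → h i (m<n⇒m<1+n i<n))) (h n ≤-refl)

  +-interchange : ∀ a b c d → (a + b) + (c + d) ≡ (a + c) + (b + d)
  +-interchange = solve-∀

  ∑-+ : ∀ n f g → (∑[ i < n ] f i + g i) ≡ ∑ n f + ∑ n g
  ∑-+ zero    f g = refl
  ∑-+ (suc n) f g = trans (cong (_+ (f n + g n)) (∑-+ n f g)) (+-interchange (∑ n f) (∑ n g) (f n) (g n))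

  ∑-*ˡ : ∀ n c f → (∑[ i < n ] c * f i) ≡ c * ∑ n f
  ∑-*ˡ zero    c f = sym (*-zeroʳ c)
  ∑-*ˡ (suc n) c f = trans (cong (_+ c * f n) (∑-*ˡ n c f)) (sym (*-distribˡ-+ c (∑ n f) (f n)))

  ∑-*ʳ : ∀ n c f → (∑[ i < n ] f i * c) ≡ ∑ n f * c
  ∑-*ʳ n c f = trans (∑-cong n (λ i _ → *-comm (f i) c)) (trans (∑-*ˡ n c f) (*-comm c (∑ n f)))

  ∑-const : ∀ n c → (∑[ _ < n ] c) ≡ n * c
  ∑-const zero    c = refl
  ∑-const (suc n) c = trans (cong (_+ c) (∑-const n c)) (+-comm (n * c) c)

  ∑-bound : ∀ n {f : ℕ → ℕ} c → (∀ i → i < n → f i ≤ c) → ∑ n f ≤ n * c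
  ∑-bound n c h = ≤-trans (∑-mono n h) (≤-reflexive (∑-const n c))

  ∑-swap : ∀ m n (f : ℕ → ℕ → ℕ) → (∑[ i < m ] ∑[ j < n ] f i j) ≡ (∑[ j < n ] ∑[ i < m ] f i j)
  ∑-swap zero    n f = sym (trans (∑-const n 0) (*-zeroʳ n))
  ∑-swap (suc m) n f = trans (cong (_+ ∑ n (f m)) (∑-swap m n f)) (sym (∑-+ n (λ j → ∑[ i < m ] f i j) (f m)))

  ∑-*-∑ : ∀ m n f g → ∑ m f * ∑ n g ≡ (∑[ i < m ] ∑[ j < n ] f i * g j)
  ∑-*-∑ m n f g = trans (sym (∑-*ʳ m (∑ n g) f)) (∑-cong m (λ i _ → sym (∑-*ˡ n (f i) g)))

  term≤∑ : ∀ n f {i} → i < n → f i ≤ ∑ n f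
  term≤∑ (suc n) f {i} i<1+n with i ≟ n
  ... | yes refl = m≤n+m (f n) (∑ n f)
  ... | no  i≢n  = ≤-trans (term≤∑ n f (≤∧≢⇒< (≤-pred i<1+n) i≢n)) (m≤m+n (∑ n f) (f n))

  ∑-positive : ∀ n f → 0 < ∑ n f → ∃ λ i → i < n × 0 < f i
  ∑-positive (suc n) f pos with f n in eq
  ... | suc k = n , ≤-refl , subst (0 <_) (sym eq) z<s
  ... | zero  with i , i<n , fi>0 ← ∑-positive n f (subst (0 <_) (+-identityʳ _) pos)
      = i , m<n⇒m<1+n i<n , fi>0

  ∑-at-most-one : ∀ n f → (∀ i → i < n → f i ≤ 1) →
    (∀ i j → i < n → j < n → 0 < f i → 0 < f j → i ≡ j) → ∑ n f ≤ 1
  ∑-at-most-one zero    f f≤1 unique = z≤n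
  ∑-at-most-one (suc n) f f≤1 unique with f n in eq
  ... | zero  = subst (_≤ 1) (sym (+-identityʳ _))
    (∑-at-most-one n f (λ i i<n → f≤1 i (m<n⇒m<1+n i<n))
      (λ i j i<n j<n → unique i j (m<n⇒m<1+n i<n) (m<n⇒m<1+n j<n)))
  ... | suc k = subst (λ s → s + suc k ≤ 1) (sym rest) (subst (_≤ 1) eq (f≤1 n ≤-refl))
    where
    vanish : ∀ i → i < n → f i ≡ 0
    vanish i i<n with f i in eqᵢ
    ... | zero  = refl
    ... | suc _ = ⊥-elim (<⇒≢ i<n (unique i n (m<n⇒m<1+n i<n) ≤-refl
                    (subst (0 <_) (sym eqᵢ) z<s) (subst (0 <_) (sym eq) z<s)))
    rest : ∑ n f ≡ 0
    rest = trans (∑-cong n vanish) (trans (∑-const n 0) (*-zeroʳ n))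

  -- Indicators and counting by injection

  𝟙 : ∀ {P : Set} → Dec P → ℕ
  𝟙 (yes _) = 1
  𝟙 (no  _) = 0

  𝟙≤1 : ∀ {P : Set} (P? : Dec P) → 𝟙 P? ≤ 1
  𝟙≤1 (yes _) = ≤-refl
  𝟙≤1 (no  _) = z≤n

  𝟙-true : ∀ {P : Set} (P? : Dec P) → P → 𝟙 P? ≡ 1
  𝟙-true (yes _) p = refl
  𝟙-true (no ¬p) p = ⊥-elim (¬p p)

  𝟙-positive : ∀ {P : Set} (P? : Dec P) → 0 < 𝟙 P? → P
  𝟙-positive (yes p) _ = p

  𝟙-mono : ∀ {P Q : Set} (P? : Dec P) (Q? : Dec Q) → (P → Q) → 𝟙 P? ≤ 𝟙 Q?
  𝟙-mono (yes p) Q? h = ≤-reflexive (sym (𝟙-true Q? (h p)))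
  𝟙-mono (no _)  Q? h = z≤n

  𝟙-× : ∀ {P Q : Set} (P? : Dec P) (Q? : Dec Q) → 𝟙 P? * 𝟙 Q? ≡ 𝟙 (P? ×-dec Q?)
  𝟙-× (yes _) (yes _) = refl
  𝟙-× (yes _) (no _)  = refl
  𝟙-× (no _)  Q?      = refl

  -- Split by the value of `φ`: each fibre holds at most one pair. The lattice counts below go
  -- through this lemma, so that each reduces to exhibiting a code `φ`.
  ∑₂-injection : ∀ m n k {P : ℕ → ℕ → Set} (P? : ∀ i j → Dec (P i j)) (φ : ℕ → ℕ → ℕ) →
    (∀ i j → i < m → j < n → P i j → φ i j < k) →
    (∀ i j i′ j′ → i < m → j < n → i′ < m → j′ < n → P i j → P i′ j′ →
       φ i j ≡ φ i′ j′ → i ≡ i′ × j ≡ j′) →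
    (∑[ i < m ] ∑[ j < n ] 𝟙 (P? i j)) ≤ k
  ∑₂-injection m n k {P} P? φ φ<k φ-inj = begin
    (∑[ i < m ] ∑[ j < n ] 𝟙 (P? i j))
      ≤⟨ ∑-mono m (λ i i<m → ∑-mono n (λ j j<n → split i j i<m j<n)) ⟩
    (∑[ i < m ] ∑[ j < n ] ∑[ v < k ] 𝟙 (Q? v i j))
      ≡⟨ ∑-cong m (λ i _ → ∑-swap n k (λ j v → 𝟙 (Q? v i j))) ⟩
    (∑[ i < m ] ∑[ v < k ] ∑[ j < n ] 𝟙 (Q? v i j))
      ≡⟨ ∑-swap m k (λ i v → ∑[ j < n ] 𝟙 (Q? v i j)) ⟩
    (∑[ v < k ] ∑[ i < m ] ∑[ j < n ] 𝟙 (Q? v i j))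
      ≤⟨ ∑-bound k 1 (λ v _ → fibre v) ⟩
    k * 1
      ≡⟨ *-identityʳ k ⟩
    k ∎
    where
    open ≤-Reasoning
    Q? : ∀ v i j → Dec (P i j × φ i j ≡ v)
    Q? v i j = P? i j ×-dec (φ i j ≟ v)
    split : ∀ i j → i < m → j < n → 𝟙 (P? i j) ≤ (∑[ v < k ] 𝟙 (Q? v i j))
    split i j i<m j<n with P? i j
    ... | no  _ = z≤n
    ... | yes p = ≤-trans (≤-reflexive (sym (𝟙-true (yes p ×-dec (φ i j ≟ φ i j)) (p , refl))))
                    (term≤∑ k (λ v → 𝟙 (yes p ×-dec (φ i j ≟ v))) (φ<k i j i<m j<n p))
    fibre : ∀ v → (∑[ i < m ] ∑[ j < n ] 𝟙 (Q? v i j)) ≤ 1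
    fibre v = ∑-at-most-one m _
      (λ i i<m → ∑-at-most-one n _ (λ j _ → 𝟙≤1 (Q? v i j))
        (λ j j′ j<n j′<n p p′ → proj₂ (same i j i j′ i<m j<n i<m j′<n (𝟙-positive (Q? v i j) p) (𝟙-positive (Q? v i j′) p′))))
      λ i i′ i<m i′<m s s′ →
        let j  , j<n  , p  = ∑-positive n _ s
            j′ , j′<n , p′ = ∑-positive n _ s′
        in proj₁ (same i j i′ j′ i<m j<n i′<m j′<n (𝟙-positive (Q? v i j) p) (𝟙-positive (Q? v i′ j′) p′))
      where
      same : ∀ i j i′ j′ → i < m → j < n → i′ < m → j′ < n →
        P i j × φ i j ≡ v → P i′ j′ × φ i′ j′ ≡ v → i ≡ i′ × j ≡ j′
      same i j i′ j′ a b c d (p , e) (p′ , e′) = φ-inj i j i′ j′ a b c d p p′ (trans e (sym e′))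

  -- Rational approximation

  -- The fraction t / s approximates n-multiples of a: `σ` is the distance between `s * a` and
  -- `t * n`, and `error` records its sign.
  record Approximation (a n S : ℕ) : Set where
    field
      s t σ   : ℕ
      s>0     : 0 < s
      s≤S     : s ≤ S
      coprime : Coprime s t
      Sσ≤n    : S * σ ≤ n
      error   : s * a ≡ t * n + σ ⊎ s * a + σ ≡ t * n

  -- `g` divides the two other terms, hence `σ`. The lemma serves both signs of the error: for the
  -- negative one, the pairs `s , a` and `t , n` change places.
  reduce-error : ∀ g s t σ a n .{{_ : NonZero g}} → (g * s) * a ≡ (g * t) * n + σ →
    ∃ λ σ′ → σ ≡ g * σ′ × s * a ≡ t * n + σ′
  reduce-error g s t σ a n eq = σ′ , sym gσ′ , *-cancelˡ-≡ (s * a) (t * n + σ′) g (begin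
    g * (s * a)            ≡⟨ *-assoc g s a ⟨
    (g * s) * a            ≡⟨ eq ⟩
    (g * t) * n + σ        ≡⟨ cong ((g * t) * n +_) gσ′ ⟨
    (g * t) * n + g * σ′   ≡⟨ rearrange g t n σ′ ⟩
    g * (t * n + σ′)       ∎)
    where
    open ≡-Reasoning
    rearrange : ∀ g t n σ → (g * t) * n + g * σ ≡ g * (t * n + σ)
    rearrange = solve-∀
    σ′ : ℕ
    σ′ = σ / g
    gσ′ : g * σ′ ≡ σ
    gσ′ = m*[n/m]≡n (∣m+n∣m⇒∣n
      (subst (g ∣_) eq (subst (g ∣_) (sym (*-assoc g s a)) (m∣m*n (s * a))))
      (subst (g ∣_) (sym (*-assoc g t n)) (m∣m*n (t * n))))

  -- Cancelling the gcd only shrinks `s` and `σ`, so both bounds survive.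
  approximation-reduce : ∀ {a n S} s t σ → 0 < s → s ≤ S → S * σ ≤ n →
    (s * a ≡ t * n + σ ⊎ s * a + σ ≡ t * n) → Approximation a n S
  approximation-reduce {a} {n} {S} s t σ s>0 s≤S Sσ≤n err = go err
    where
    instance
      g≢0 : NonZero (gcd s t)
      g≢0 = ≢-nonZero λ g≡0 → <⇒≢ s>0 (sym (gcd[m,n]≡0⇒m≡0 g≡0))
    g s′ t′ : ℕ
    g  = gcd s t
    s′ = s / g
    t′ = t / g
    gs′ : g * s′ ≡ s
    gs′ = m*[n/m]≡n (gcd[m,n]∣m s t)
    gt′ : g * t′ ≡ t
    gt′ = m*[n/m]≡n (gcd[m,n]∣n s t)
    s′>0 : 0 < s′
    s′>0 = n≢0⇒n>0 λ s′≡0 → <⇒≢ s>0 (sym (trans (sym gs′) (trans (cong (g *_) s′≡0) (*-zeroʳ g))))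
    bound : ∀ σ′ → σ ≡ g * σ′ → S * σ′ ≤ n
    bound σ′ refl = ≤-trans (*-monoʳ-≤ S (m≤n*m σ′ g)) Sσ≤n
    go : (s * a ≡ t * n + σ ⊎ s * a + σ ≡ t * n) → Approximation a n S
    go (inj₁ e) with σ′ , σ≡ , e′ ← reduce-error g s′ t′ σ a n
                     (trans (cong (_* a) gs′) (trans e (cong (λ z → z * n + σ) (sym gt′))))
      = record { s = s′ ; t = t′ ; σ = σ′ ; s>0 = s′>0 ; s≤S = ≤-trans (m/n≤m s g) s≤S
               ; coprime = coprime-/gcd s t ; Sσ≤n = bound σ′ σ≡ ; error = inj₁ e′ }
    go (inj₂ e) with σ′ , σ≡ , e′ ← reduce-error g t′ s′ σ n a
                     (trans (cong (_* n) gt′) (trans (sym e) (cong (λ z → z * a + σ) (sym gs′))))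
      = record { s = s′ ; t = t′ ; σ = σ′ ; s>0 = s′>0 ; s≤S = ≤-trans (m/n≤m s g) s≤S
               ; coprime = coprime-/gcd s t ; Sσ≤n = bound σ′ σ≡ ; error = inj₂ (sym e′) }

  same-unpack⇒close : ∀ m m′ n .{{_ : NonZero n}} → m / n ≡ m′ / n → m < m′ + n
  same-unpack⇒close m m′ n q≡ = begin-strict
    m                    ≡⟨ m≡m%n+[m/n]*n m n ⟩
    m % n + m / n * n    <⟨ +-monoˡ-< (m / n * n) (m%n<n m n) ⟩
    n + m / n * n        ≡⟨ cong (λ q → n + q * n) q≡ ⟩
    n + m′ / n * n       ≤⟨ +-monoʳ-≤ n (m/n*n≤m m′ n) ⟩
    n + m′               ≡⟨ +-comm n m′ ⟩
    m′ + n               ∎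
    where open ≤-Reasoning

  -- Pigeonhole: among the `S + 1` multiples `I * a` with `I ≤ S`, two have residues modulo `n` in
  -- the same of `S` buckets. Their difference gives `s`, the difference of their quotients gives
  -- `t`, and the order of the residues decides the sign.
  dirichlet : ∀ a n S .{{_ : NonZero n}} .{{_ : NonZero S}} → Approximation a n S
  dirichlet a n S with pigeonhole (n<1+n S) (λ i → fromℕ< (bucket<S (toℕ i)))
    where
    -- For a residue r, `S * r / n` is the number of the bucket of length n / S that contains r.
    bucket<S : ∀ i → S * ((i * a) % n) / n < S
    bucket<S i = m<n*o⇒m/o<n (*-monoʳ-< S (m%n<n (i * a) n))
  ... | i , j , i<j , same = conclude (≤-total u v)
    where
    I J s u v qᵢ qⱼ t : ℕ
    I  = toℕ i
    J  = toℕ j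
    s  = J ∸ I
    u  = (I * a) % n
    v  = (J * a) % n
    qᵢ = (I * a) / n
    qⱼ = (J * a) / n
    t  = qⱼ ∸ qᵢ
    same′ : S * u / n ≡ S * v / n
    same′ = trans (sym (toℕ-fromℕ< _)) (trans (cong toℕ same) (toℕ-fromℕ< _))
    I+s≡J : I + s ≡ J
    I+s≡J = m+[n∸m]≡n (<⇒≤ i<j)
    q+t≡q : qᵢ + t ≡ qⱼ
    q+t≡q = m+[n∸m]≡n (/-monoˡ-≤ n (*-monoˡ-≤ a (<⇒≤ i<j)))
    s>0 : 0 < s
    s>0 = m<n⇒0<n∸m i<j
    s≤S : s ≤ S
    s≤S = ≤-trans (m∸n≤m J I) (≤-pred (toℕ<n j))
    assemble : ∀ u v I s qᵢ t a n →
      (I + s) * a ≡ v + (qᵢ + t) * n → I * a ≡ u + qᵢ * n → s * a + u ≡ t * n + v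
    assemble u v I s qᵢ t a n e₁ e₂ = +-cancelˡ-≡ (qᵢ * n) _ _ (begin
      qᵢ * n + (s * a + u)   ≡⟨ lhs (qᵢ * n) (s * a) u ⟩
      (u + qᵢ * n) + s * a   ≡⟨ cong (_+ s * a) e₂ ⟨
      I * a + s * a          ≡⟨ *-distribʳ-+ a I s ⟨
      (I + s) * a            ≡⟨ e₁ ⟩
      v + (qᵢ + t) * n       ≡⟨ rhs v qᵢ t n ⟩
      qᵢ * n + (t * n + v)   ∎)
      where
      open ≡-Reasoning
      lhs : ∀ q x u → q + (x + u) ≡ (u + q) + x
      lhs = solve-∀
      rhs : ∀ v q t n → v + (q + t) * n ≡ q * n + (t * n + v)
      rhs = solve-∀
    balance : s * a + u ≡ t * n + v
    balance = assemble u v I s qᵢ t a n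
      (trans (cong (_* a) I+s≡J) (trans (m≡m%n+[m/n]*n (J * a) n) (cong (λ q → v + q * n) (sym q+t≡q))))
      (m≡m%n+[m/n]*n (I * a) n)
    gap : ∀ x y → S * (x + y) / n ≡ S * x / n → S * y ≤ n
    gap x y e = <⇒≤ (+-cancelˡ-< (S * x) (S * y) n
      (subst (_< S * x + n) (*-distribˡ-+ S x y) (same-unpack⇒close (S * (x + y)) (S * x) n e)))
    conclude : u ≤ v ⊎ v ≤ u → Approximation a n S
    conclude (inj₁ u≤v) = approximation-reduce s t (v ∸ u) s>0 s≤S
      (gap u (v ∸ u) (subst (λ z → S * z / n ≡ S * u / n) (sym (m+[n∸m]≡n u≤v)) (sym same′)))
      (inj₁ (+-cancelʳ-≡ u _ _ (trans balance (trans (cong (t * n +_) (sym (m∸n+n≡m u≤v)))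
        (sym (+-assoc (t * n) (v ∸ u) u))))))
    conclude (inj₂ v≤u) = approximation-reduce s t (u ∸ v) s>0 s≤S
      (gap v (u ∸ v) (subst (λ z → S * z / n ≡ S * v / n) (sym (m+[n∸m]≡n v≤u)) same′))
      (inj₂ (+-cancelʳ-≡ v _ _ (trans (+-assoc (s * a) (u ∸ v) v)
        (trans (cong (s * a +_) (m∸n+n≡m v≤u)) balance))))

  -- The equation makes `s` divide t (m′ - m), hence m′ - m by coprimality; but `m` and `m′` lie in
  -- one block of length `s`.
  block-unique-≤ : ∀ s t {m m′} k k′ .{{_ : NonZero s}} → Coprime s t → m ≤ m′ → m / s ≡ m′ / s →
    t * m + s * k ≡ t * m′ + s * k′ → m ≡ m′
  block-unique-≤ s t {m} {m′} k k′ cop m≤m′ q≡ eq with m′ ∸ m | m+[n∸m]≡n m≤m′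
  ... | zero  | e = trans (sym (+-identityʳ m)) e
  ... | suc d | e = ⊥-elim (<⇒≱ d<s (∣⇒≤ s∣d))
    where
    d<s : suc d < s
    d<s = +-cancelˡ-< m _ _ (subst (_< m + s) (sym e) (same-unpack⇒close m′ m s (sym q≡)))
    sk≡ : s * k ≡ t * suc d + s * k′
    sk≡ = +-cancelˡ-≡ (t * m) _ _ (trans eq (trans (cong (λ z → t * z + s * k′) (sym e))
            (trans (cong (_+ s * k′) (*-distribˡ-+ t m (suc d))) (+-assoc (t * m) (t * suc d) (s * k′)))))
    s∣d : s ∣ suc d
    s∣d = coprime-divisor cop (∣m+n∣m⇒∣n (subst (s ∣_) (trans sk≡ (+-comm (t * suc d) (s * k′))) (m∣m*n k)) (m∣m*n k′))

  block-unique : ∀ s t {m m′} k k′ .{{_ : NonZero s}} → Coprime s t → m / s ≡ m′ / s →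
    t * m + s * k ≡ t * m′ + s * k′ → m ≡ m′
  block-unique s t {m} {m′} k k′ cop q≡ eq with ≤-total m m′
  ... | inj₁ m≤m′ = block-unique-≤ s t k k′ cop m≤m′ q≡ eq
  ... | inj₂ m′≤m = sym (block-unique-≤ s t k′ k cop m′≤m (sym q≡) (sym eq))

  -- The solutions lie on a line along which `j` advances in steps of `s`, so each block of `s`
  -- consecutive `j` contains at most one, and `j` determines `i`.
  lattice-count : ∀ R s t c r .{{_ : NonZero s}} → Coprime s t →
    (∑[ i < suc R ] ∑[ j < suc R ] 𝟙 (s * (R + i) + c ≟ t * (R + j) + r)) ≤ suc (R / s)
  lattice-count R s t c r cop = ∑₂-injection (suc R) (suc R) (suc (R / s))
    (λ i j → s * (R + i) + c ≟ t * (R + j) + r) (λ i j → j / s)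
    (λ i j _ j≤R _ → s≤s (/-monoˡ-≤ s (≤-pred j≤R)))
    λ i j i′ j′ _ _ _ _ e e′ q≡ →
      let j≡j′ = block-unique s t i′ i cop q≡ (cross i j i′ j′ e e′)
      in +-cancelˡ-≡ R i i′ (*-cancelˡ-≡ _ _ s (+-cancelʳ-≡ c _ _
           (trans e (trans (cong (λ z → t * (R + z) + r) j≡j′) (sym e′))))) , j≡j′
    where
    shape : ∀ s t R i i′ j c r → (t * j + s * i′) + ((s * R + c) + (t * R + r)) ≡
      (t * (R + j) + r) + (s * (R + i′) + c)
    shape = solve-∀
    cross : ∀ i j i′ j′ → s * (R + i) + c ≡ t * (R + j) + r → s * (R + i′) + c ≡ t * (R + j′) + r →
      t * j + s * i′ ≡ t * j′ + s * i
    cross i j i′ j′ e e′ = +-cancelʳ-≡ ((s * R + c) + (t * R + r)) _ _ (begin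
      (t * j + s * i′) + ((s * R + c) + (t * R + r))  ≡⟨ shape s t R i i′ j c r ⟩
      (t * (R + j) + r) + (s * (R + i′) + c)          ≡⟨ cong₂ _+_ (sym e) e′ ⟩
      (s * (R + i) + c) + (t * (R + j′) + r)          ≡⟨ +-comm (s * (R + i) + c) _ ⟩
      (t * (R + j′) + r) + (s * (R + i) + c)          ≡⟨ shape s t R i′ i j′ c r ⟨
      (t * j′ + s * i) + ((s * R + c) + (t * R + r))  ∎)
      where open ≡-Reasoning

  pack-injective : ∀ L {b b′ i i′} .{{_ : NonZero L}} → i < L → i′ < L →
    b * L + i ≡ b′ * L + i′ → b ≡ b′ × i ≡ i′
  pack-injective L {b} {b′} {i} {i′} i<L i′<L eq = b≡b′ , +-cancelˡ-≡ (b * L) i i′ (trans eq (cong (λ z → z * L + i′) (sym b≡b′)))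
    where
    unpack : ∀ b {i} → i < L → (b * L + i) / L ≡ b
    unpack b {i} i<L = trans (+-distrib-/-∣ˡ i (n∣m*n b))
      (trans (cong₂ _+_ (m*n/n≡m b L) (m<n⇒m/n≡0 i<L)) (+-identityʳ b))
    b≡b′ : b ≡ b′
    b≡b′ = trans (sym (unpack b i<L)) (trans (cong (_/ L) eq) (unpack b′ i′<L))

  pack-< : ∀ L {b i k} → b < k → i < L → b * L + i < k * L
  pack-< L {b} {i} {k} b<k i<L = begin-strict
    b * L + i   <⟨ +-monoʳ-< (b * L) i<L ⟩
    b * L + L   ≡⟨ +-comm (b * L) L ⟩
    suc b * L   ≤⟨ *-monoˡ-≤ L b<k ⟩
    k * L       ∎
    where open ≤-Reasoning

  -- Makes `V ∸ base / n` a code for `V` with few values. The 2 pays for rounding down `base / n`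
  -- and `ℓ / n`.
  offset-bounds : ∀ V n base g ℓ .{{_ : NonZero n}} → V * n ≡ base + g → g ≤ ℓ →
    base / n ≤ V × V ∸ base / n < 2 + ℓ / n
  offset-bounds V n base g ℓ eq g≤ℓ = low , *-cancelʳ-< n _ _ (+-cancelʳ-< (base / n * n) _ _ (begin-strict
    d * n + base / n * n                 ≡⟨ *-distribʳ-+ n d (base / n) ⟨
    (d + base / n) * n                   ≡⟨ cong (_* n) (m∸n+n≡m low) ⟩
    V * n                                ≡⟨ eq ⟩
    base + g                             ≡⟨ cong₂ _+_ (m≡m%n+[m/n]*n base n) refl ⟩
    (base % n + base / n * n) + g        ≤⟨ +-mono-≤ (+-monoˡ-≤ (base / n * n) (m%n≤n base n)) g≤ℓ ⟩
    (n + base / n * n) + ℓ               ≡⟨ cong ((n + base / n * n) +_) (m≡m%n+[m/n]*n ℓ n) ⟩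
    (n + base / n * n) + (ℓ % n + ℓ / n * n) <⟨ +-monoʳ-< (n + base / n * n) (+-monoˡ-< (ℓ / n * n) (m%n<n ℓ n)) ⟩
    (n + base / n * n) + (n + ℓ / n * n) ≡⟨ regroup n (base / n * n) (ℓ / n * n) ⟩
    (n + (n + ℓ / n * n)) + base / n * n ∎))
    where
    open ≤-Reasoning
    d : ℕ
    d = V ∸ base / n
    low : base / n ≤ V
    low = subst (base / n ≤_) (m*n/n≡m V n) (/-monoˡ-≤ n (subst (base ≤_) (sym eq) (m≤m+n base g)))
    regroup : ∀ n x y → (n + x) + (n + y) ≡ (n + (n + y)) + x
    regroup = solve-∀

  -- Pairs of nearby multiples

  -- What remains of `m * a ≡ y + j` and `m′ * n ≡ y + j′` once `y` is eliminated.
  Aligned : (a n j w m m′ j′ : ℕ) → Set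
  Aligned a n j w m m′ j′ = j′ < w × m′ * n + j ≡ m * a + j′

  -- V is a coordinate on the lattice of pairs (m , m′), constant exactly along the direction (s , t);
  -- its value on aligned pairs with m in a given block of length s is confined to a short interval.
  pair-count-via : ∀ a n s t P w j ℓ .{{_ : NonZero a}} .{{_ : NonZero n}} .{{_ : NonZero s}} →
    Coprime s t → j < w → (V : ℕ → ℕ → ℕ) (base : ℕ → ℕ) →
    (∀ m m′ j′ → Aligned a n j w m m′ j′ → ∃ λ g → g ≤ ℓ × V m m′ * n ≡ base (m / s) + g) →
    (∀ m₁ m₁′ j₁ m₂ m₂′ j₂ → Aligned a n j w m₁ m₁′ j₁ → Aligned a n j w m₂ m₂′ j₂ →
       V m₁ m₁′ ≡ V m₂ m₂′ → t * m₁ + s * m₂′ ≡ t * m₂ + s * m₁′) →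
    (∑[ y < P ] ∑[ j′ < w ] 𝟙 ((a ∣? y + j) ×-dec (n ∣? y + j′))) ≤ suc ((P + w) / a / s) * (2 + ℓ / n)
  pair-count-via a n s t P w j ℓ cop j<w V base located level =
    ∑₂-injection P w (suc ((P + w) / a / s) * (2 + ℓ / n))
      (λ y j′ → (a ∣? y + j) ×-dec (n ∣? y + j′)) φ φ-bound φ-injective
    where
    m m′ b : ℕ → ℕ
    m  y = (y + j) / a
    m′ z = z / n
    b  y = m y / s
    offset : ℕ → ℕ → ℕ
    offset y j′ = V (m y) (m′ (y + j′)) ∸ base (b y) / n
    -- The code consists of the block of `m` and the offset of `V`. Equal codes mean equal `V`
    -- inside one block, so coprimality forces equal `m`; then `y`, `m′` and `j′` follow in turn.
    φ : ℕ → ℕ → ℕ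
    φ y j′ = b y * (2 + ℓ / n) + offset y j′
    aligned : ∀ y j′ → j′ < w → a ∣ y + j × n ∣ y + j′ → Aligned a n j w (m y) (m′ (y + j′)) j′
    aligned y j′ j′<w (a∣ , n∣) = j′<w , (begin
      (y + j′) / n * n + j   ≡⟨ cong (_+ j) (m/n*n≡m n∣) ⟩
      (y + j′) + j           ≡⟨ exchange y j j′ ⟩
      (y + j) + j′           ≡⟨ cong (_+ j′) (m/n*n≡m a∣) ⟨
      (y + j) / a * a + j′   ∎)
      where
      open ≡-Reasoning
      exchange : ∀ y j j′ → (y + j′) + j ≡ (y + j) + j′
      exchange = solve-∀
    bounds : ∀ y j′ → j′ < w → a ∣ y + j × n ∣ y + j′ →
      base (b y) / n ≤ V (m y) (m′ (y + j′)) × offset y j′ < 2 + ℓ / n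
    bounds y j′ j′<w p with g , g≤ℓ , eq ← located _ _ _ (aligned y j′ j′<w p) =
      offset-bounds (V (m y) (m′ (y + j′))) n (base (b y)) g ℓ eq g≤ℓ
    φ-bound : ∀ y j′ → y < P → j′ < w → a ∣ y + j × n ∣ y + j′ → φ y j′ < suc ((P + w) / a / s) * (2 + ℓ / n)
    φ-bound y j′ y<P j′<w p = pack-< (2 + ℓ / n)
      (s≤s (/-monoˡ-≤ s (/-monoˡ-≤ a (+-mono-≤ (<⇒≤ y<P) (<⇒≤ j<w))))) (proj₂ (bounds y j′ j′<w p))
    φ-injective : ∀ y j₁ z j₂ → y < P → j₁ < w → z < P → j₂ < w →
      a ∣ y + j × n ∣ y + j₁ → a ∣ z + j × n ∣ z + j₂ → φ y j₁ ≡ φ z j₂ → y ≡ z × j₁ ≡ j₂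
    φ-injective y j₁ z j₂ _ j₁<w _ j₂<w p q eq = y≡z , j₁≡j₂
      where
      bp = bounds y j₁ j₁<w p
      bq = bounds z j₂ j₂<w q
      parts = pack-injective (2 + ℓ / n) (proj₂ bp) (proj₂ bq) eq
      V≡ : V (m y) (m′ (y + j₁)) ≡ V (m z) (m′ (z + j₂))
      V≡ = trans (sym (m∸n+n≡m (proj₁ bp))) (trans
        (cong₂ (λ o β → o + base β / n) (proj₂ parts) (proj₁ parts)) (m∸n+n≡m (proj₁ bq)))
      same-level : t * m y + s * m′ (z + j₂) ≡ t * m z + s * m′ (y + j₁)
      same-level = level _ _ _ _ _ _ (aligned y j₁ j₁<w p) (aligned z j₂ j₂<w q) V≡
      m≡ : m y ≡ m z
      m≡ = block-unique s t (m′ (z + j₂)) (m′ (y + j₁)) cop (proj₁ parts) same-level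
      y≡z : y ≡ z
      y≡z = +-cancelʳ-≡ j y z (trans (sym (m/n*n≡m (proj₁ p))) (trans (cong (_* a) m≡) (m/n*n≡m (proj₁ q))))
      m′≡ : m′ (y + j₁) ≡ m′ (z + j₂)
      m′≡ = *-cancelˡ-≡ _ _ s (+-cancelˡ-≡ (t * m y) _ _
        (trans (cong (λ u → t * u + s * m′ (y + j₁)) m≡) (sym same-level)))
      j₁≡j₂ : j₁ ≡ j₂
      j₁≡j₂ = +-cancelˡ-≡ y j₁ j₂ (trans (sym (m/n*n≡m (proj₂ p))) (trans (cong (_* n) m′≡)
        (trans (m/n*n≡m (proj₂ q)) (cong (_+ j₂) (sym y≡z)))))

  pair-count-above : ∀ a n s t σ P w j .{{_ : NonZero a}} .{{_ : NonZero n}} .{{_ : NonZero s}} →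
    Coprime s t → j < w → s * a ≡ t * n + σ →
    (∑[ y < P ] ∑[ j′ < w ] 𝟙 ((a ∣? y + j) ×-dec (n ∣? y + j′))) ≤
      suc ((P + w) / a / s) * (2 + (s * w + s * σ) / n)
  pair-count-above a n@(suc n₁) s t σ P w j cop j<w sa≡ =
    pair-count-via a n s t P w j (s * w + s * σ) cop j<w V base located level
    where
    -- The coordinate is s m′ - t m. The shift by `s * j` makes the truncated subtraction exact,
    -- since (t m - s m′) n ≤ s j on aligned pairs.
    V : ℕ → ℕ → ℕ
    V m m′ = (s * m′ + s * j) ∸ t * m
    base : ℕ → ℕ
    base b = b * s * σ + s * j * n₁
    expand : ∀ {m m′ j′} → m′ * n + j ≡ m * a + j′ → s * m′ * n + s * j ≡ t * m * n + (m * σ + s * j′)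
    expand {m} {m′} {j′} e = begin
      s * m′ * n + s * j              ≡⟨ e₁ s m′ n j ⟩
      s * (m′ * n + j)                ≡⟨ cong (s *_) e ⟩
      s * (m * a + j′)                ≡⟨ e₂ s m a j′ ⟩
      m * (s * a) + s * j′            ≡⟨ cong (λ z → m * z + s * j′) sa≡ ⟩
      m * (t * n + σ) + s * j′        ≡⟨ e₃ m t n σ (s * j′) ⟩
      t * m * n + (m * σ + s * j′)    ∎
      where
      open ≡-Reasoning
      e₁ : ∀ s m n j → s * m * n + s * j ≡ s * (m * n + j)
      e₁ = solve-∀
      e₂ : ∀ s m a j → s * (m * a + j) ≡ m * (s * a) + s * j
      e₂ = solve-∀
      e₃ : ∀ m t n σ x → m * (t * n + σ) + x ≡ t * m * n + (m * σ + x)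
      e₃ = solve-∀
    V-defined : ∀ m m′ j′ → Aligned a n j w m m′ j′ → V m m′ + t * m ≡ s * m′ + s * j
    V-defined m m′ j′ (_ , e) = m∸n+n≡m (*-cancelʳ-≤ (t * m) (s * m′ + s * j) n (begin
      t * m * n                      ≤⟨ m≤m+n _ _ ⟩
      t * m * n + (m * σ + s * j′)   ≡⟨ expand e ⟨
      s * m′ * n + s * j             ≤⟨ +-monoʳ-≤ (s * m′ * n) (m≤m*n (s * j) n) ⟩
      s * m′ * n + s * j * n         ≡⟨ *-distribʳ-+ n (s * m′) (s * j) ⟨
      (s * m′ + s * j) * n           ∎))
      where open ≤-Reasoning
    located : ∀ m m′ j′ → Aligned a n j w m m′ j′ → ∃ λ g → g ≤ s * w + s * σ × V m m′ * n ≡ base (m / s) + g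
    located m m′ j′ al@(j′<w , e) = s * j′ + m % s * σ ,
      +-mono-≤ (*-monoʳ-≤ s (<⇒≤ j′<w)) (*-monoˡ-≤ σ (m%n≤n m s)) ,
      +-cancelʳ-≡ (t * m * n + s * j) _ _ (begin
        V m m′ * n + (t * m * n + s * j)                             ≡⟨ e₁ (V m m′) n (t * m) (s * j) ⟩
        (V m m′ + t * m) * n + s * j                                 ≡⟨ cong (λ z → z * n + s * j) (V-defined m m′ j′ al) ⟩
        (s * m′ + s * j) * n + s * j                                 ≡⟨ e₂ (s * m′) (s * j) n ⟩
        (s * m′ * n + s * j) + s * j * n                             ≡⟨ cong (_+ s * j * n) (expand e) ⟩
        (t * m * n + (m * σ + s * j′)) + s * j * n                   ≡⟨ cong (λ z → (t * m * n + (z * σ + s * j′)) + s * j * n) (m≡m%n+[m/n]*n m s) ⟩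
        (t * m * n + ((m % s + m / s * s) * σ + s * j′)) + s * j * n ≡⟨ e₃ (t * m * n) (m % s) (m / s * s) σ (s * j′) (s * j) n₁ ⟩
        (base (m / s) + (s * j′ + m % s * σ)) + (t * m * n + s * j)  ∎)
      where
      open ≡-Reasoning
      e₁ : ∀ v n x y → v * n + (x * n + y) ≡ (v + x) * n + y
      e₁ = solve-∀
      e₂ : ∀ x y n → (x + y) * n + y ≡ (x * n + y) + y * n
      e₂ = solve-∀
      e₃ : ∀ x u v σ y z n₁ → (x + ((u + v) * σ + y)) + z * (1 + n₁) ≡ ((v * σ + z * n₁) + (y + u * σ)) + (x + z)
      e₃ = solve-∀
    level : ∀ m₁ m₁′ j₁ m₂ m₂′ j₂ → Aligned a n j w m₁ m₁′ j₁ → Aligned a n j w m₂ m₂′ j₂ →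
       V m₁ m₁′ ≡ V m₂ m₂′ → t * m₁ + s * m₂′ ≡ t * m₂ + s * m₁′
    level m₁ m₁′ j₁ m₂ m₂′ j₂ al₁ al₂ V≡ = +-cancelʳ-≡ (s * j) _ _ (begin
      t * m₁ + s * m₂′ + s * j        ≡⟨ +-assoc (t * m₁) _ _ ⟩
      t * m₁ + (s * m₂′ + s * j)      ≡⟨ cong (t * m₁ +_) (V-defined m₂ m₂′ j₂ al₂) ⟨
      t * m₁ + (V m₂ m₂′ + t * m₂)    ≡⟨ e₁ (t * m₁) (V m₂ m₂′) (t * m₂) ⟩
      t * m₂ + (V m₂ m₂′ + t * m₁)    ≡⟨ cong (λ z → t * m₂ + (z + t * m₁)) V≡ ⟨
      t * m₂ + (V m₁ m₁′ + t * m₁)    ≡⟨ cong (t * m₂ +_) (V-defined m₁ m₁′ j₁ al₁) ⟩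
      t * m₂ + (s * m₁′ + s * j)      ≡⟨ +-assoc (t * m₂) _ _ ⟨
      t * m₂ + s * m₁′ + s * j        ∎)
      where
      open ≡-Reasoning
      e₁ : ∀ x y z → x + (y + z) ≡ z + (y + x)
      e₁ = solve-∀

  pair-count-below : ∀ a n s t σ P w j .{{_ : NonZero a}} .{{_ : NonZero n}} .{{_ : NonZero s}} →
    Coprime s t → j < w → s * a + σ ≡ t * n →
    (∑[ y < P ] ∑[ j′ < w ] 𝟙 ((a ∣? y + j) ×-dec (n ∣? y + j′))) ≤
      suc ((P + w) / a / s) * (2 + (s * w + s * σ) / n)
  pair-count-below a n@(suc n₁) s t σ P w j cop j<w sa≡ =
    pair-count-via a n s t P w j (s * w + s * σ) cop j<w V base located level
    where
    -- With the opposite sign of the error the coordinate is t m - s m′. Exactness of the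
    -- subtraction needs a shift by about s j′; it is taken to be `s * w` because `V` must not
    -- depend on `j′`.
    V : ℕ → ℕ → ℕ
    V m m′ = (t * m + s * w) ∸ s * m′
    base : ℕ → ℕ
    base b = b * s * σ + (s * j + s * w * n₁)
    expand : ∀ {m m′ j′} → m′ * n + j ≡ m * a + j′ → s * m′ * n + (s * j + m * σ) ≡ t * m * n + s * j′
    expand {m} {m′} {j′} e = begin
      s * m′ * n + (s * j + m * σ)     ≡⟨ e₁ s m′ n j (m * σ) ⟩
      s * (m′ * n + j) + m * σ         ≡⟨ cong (λ z → s * z + m * σ) e ⟩
      s * (m * a + j′) + m * σ         ≡⟨ e₂ s m a j′ σ ⟩
      m * (s * a + σ) + s * j′         ≡⟨ cong (λ z → m * z + s * j′) sa≡ ⟩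
      m * (t * n) + s * j′             ≡⟨ e₃ m t n (s * j′) ⟩
      t * m * n + s * j′               ∎
      where
      open ≡-Reasoning
      e₁ : ∀ s m n j x → s * m * n + (s * j + x) ≡ s * (m * n + j) + x
      e₁ = solve-∀
      e₂ : ∀ s m a j σ → s * (m * a + j) + m * σ ≡ m * (s * a + σ) + s * j
      e₂ = solve-∀
      e₃ : ∀ m t n x → m * (t * n) + x ≡ t * m * n + x
      e₃ = solve-∀
    V-defined : ∀ m m′ j′ → Aligned a n j w m m′ j′ → V m m′ + s * m′ ≡ t * m + s * w
    V-defined m m′ j′ (j′<w , e) = m∸n+n≡m (*-cancelʳ-≤ (s * m′) (t * m + s * w) n (begin
      s * m′ * n                       ≤⟨ m≤m+n _ _ ⟩
      s * m′ * n + (s * j + m * σ)     ≡⟨ expand e ⟩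
      t * m * n + s * j′               ≤⟨ +-monoʳ-≤ (t * m * n) (*-monoʳ-≤ s (<⇒≤ j′<w)) ⟩
      t * m * n + s * w                ≤⟨ +-monoʳ-≤ (t * m * n) (m≤m*n (s * w) n) ⟩
      t * m * n + s * w * n            ≡⟨ *-distribʳ-+ n (t * m) (s * w) ⟨
      (t * m + s * w) * n              ∎))
      where open ≤-Reasoning
    located : ∀ m m′ j′ → Aligned a n j w m m′ j′ → ∃ λ g → g ≤ s * w + s * σ × V m m′ * n ≡ base (m / s) + g
    located m m′ j′ al@(j′<w , e) = s * (w ∸ j′) + m % s * σ ,
      +-mono-≤ (*-monoʳ-≤ s (m∸n≤m w j′)) (*-monoˡ-≤ σ (m%n≤n m s)) ,
      +-cancelʳ-≡ (s * m′ * n + s * j′) _ _ (begin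
        V m m′ * n + (s * m′ * n + s * j′)                           ≡⟨ e₁ (V m m′) n (s * m′) (s * j′) ⟩
        (V m m′ + s * m′) * n + s * j′                               ≡⟨ cong (λ z → z * n + s * j′) (V-defined m m′ j′ al) ⟩
        (t * m + s * w) * n + s * j′                                 ≡⟨ e₂ (t * m) (s * w) n (s * j′) ⟩
        (t * m * n + s * j′) + s * w * n                             ≡⟨ cong (_+ s * w * n) (expand e) ⟨
        (s * m′ * n + (s * j + m * σ)) + s * w * n                   ≡⟨ cong ((s * m′ * n + (s * j + m * σ)) +_) (e₀ (s * w) n₁) ⟩
        (s * m′ * n + (s * j + m * σ)) + (s * w * n₁ + s * w)        ≡⟨ cong₂ (λ z ω → (s * m′ * n + (s * j + z * σ)) + (s * w * n₁ + s * ω)) (m≡m%n+[m/n]*n m s) (sym (m∸n+n≡m (<⇒≤ j′<w))) ⟩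
        (s * m′ * n + (s * j + (m % s + m / s * s) * σ)) + (s * w * n₁ + s * ((w ∸ j′) + j′)) ≡⟨ e₃ (s * m′ * n) (s * j) (m % s) (m / s * s) σ (s * w * n₁) s (w ∸ j′) j′ ⟩
        (base (m / s) + (s * (w ∸ j′) + m % s * σ)) + (s * m′ * n + s * j′)  ∎)
      where
      open ≡-Reasoning
      e₁ : ∀ v n x y → v * n + (x * n + y) ≡ (v + x) * n + y
      e₁ = solve-∀
      e₀ : ∀ x n₁ → x * (1 + n₁) ≡ x * n₁ + x
      e₀ = solve-∀
      e₂ : ∀ x z n y → (x + z) * n + y ≡ (x * n + y) + z * n
      e₂ = solve-∀
      e₃ : ∀ x z u v σ y s p q → (x + (z + (u + v) * σ)) + (y + s * (p + q)) ≡ ((v * σ + (z + y)) + (s * p + u * σ)) + (x + s * q)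
      e₃ = solve-∀
    level : ∀ m₁ m₁′ j₁ m₂ m₂′ j₂ → Aligned a n j w m₁ m₁′ j₁ → Aligned a n j w m₂ m₂′ j₂ →
       V m₁ m₁′ ≡ V m₂ m₂′ → t * m₁ + s * m₂′ ≡ t * m₂ + s * m₁′
    level m₁ m₁′ j₁ m₂ m₂′ j₂ al₁ al₂ V≡ = +-cancelˡ-≡ (V m₁ m₁′ + s * w) _ _ (begin
      (V m₁ m₁′ + s * w) + (t * m₁ + s * m₂′)   ≡⟨ e₁ (V m₁ m₁′) (s * w) (t * m₁) (s * m₂′) ⟩
      (V m₁ m₁′ + s * m₂′) + (t * m₁ + s * w)   ≡⟨ cong₂ (λ v z → (v + s * m₂′) + z) V≡ (sym (V-defined m₁ m₁′ j₁ al₁)) ⟩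
      (V m₂ m₂′ + s * m₂′) + (V m₁ m₁′ + s * m₁′) ≡⟨ cong (_+ (V m₁ m₁′ + s * m₁′)) (V-defined m₂ m₂′ j₂ al₂) ⟩
      (t * m₂ + s * w) + (V m₁ m₁′ + s * m₁′)   ≡⟨ e₂ (t * m₂) (s * w) (V m₁ m₁′) (s * m₁′) ⟩
      (V m₁ m₁′ + s * w) + (t * m₂ + s * m₁′)   ∎)
      where
      open ≡-Reasoning
      e₁ : ∀ x y z u → (x + y) + (z + u) ≡ (x + u) + (z + y)
      e₁ = solve-∀
      e₂ : ∀ x y z u → (x + y) + (z + u) ≡ (z + y) + (x + u)
      e₂ = solve-∀

  pair-count : ∀ {a n S} (A : Approximation a n S) P w j .{{_ : NonZero a}} .{{_ : NonZero n}} →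
    let open Approximation A; instance s≢0 = >-nonZero s>0 in j < w →
    (∑[ y < P ] ∑[ j′ < w ] 𝟙 ((a ∣? y + j) ×-dec (n ∣? y + j′))) ≤
      suc ((P + w) / a / s) * (2 + (s * w + s * σ) / n)
  pair-count {a} {n} A P w j j<w = go error
    where
    open Approximation A
    instance
      s≢0 : NonZero s
      s≢0 = >-nonZero s>0
    go : s * a ≡ t * n + σ ⊎ s * a + σ ≡ t * n →
      (∑[ y < P ] ∑[ j′ < w ] 𝟙 ((a ∣? y + j) ×-dec (n ∣? y + j′))) ≤
        suc ((P + w) / a / s) * (2 + (s * w + s * σ) / n)
    go (inj₁ e) = pair-count-above a n s t σ P w j coprime j<w e
    go (inj₂ e) = pair-count-below a n s t σ P w j coprime j<w e

  -- Sums over approximations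

  ∑-split : ∀ m d f → ∑ (d + m) f ≡ ∑ m f + (∑[ i < d ] f (i + m))
  ∑-split m zero    f = sym (+-identityʳ _)
  ∑-split m (suc d) f = trans (cong (_+ f (d + m)) (∑-split m d f)) (+-assoc (∑ m f) _ _)

  -- A crude logarithm: the fewer than `τ * b` indices between b = τᵏ and τᵏ⁺¹ contribute at most
  -- `Z / b` each, hence `τ * Z` together.
  harmonic-sum : ∀ τ k Z .{{_ : NonZero τ}} → (∑[ i < τ ^ k ] Z / suc i) ≤ suc (k * τ) * Z
  harmonic-sum τ zero    Z = ≤-reflexive (trans (n/1≡n Z) (sym (*-identityˡ Z)))
  harmonic-sum τ (suc k) Z = begin
    ∑ (τ * b) f                        ≡⟨ cong (λ n → ∑ n f) (m∸n+n≡m (m≤n*m b τ)) ⟨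
    ∑ ((τ * b ∸ b) + b) f              ≤⟨ ≤-reflexive (∑-split b (τ * b ∸ b) f) ⟩
    ∑ b f + (∑[ i < τ * b ∸ b ] f (i + b)) ≤⟨ +-monoʳ-≤ (∑ b f) (∑-bound (τ * b ∸ b) (Z / b) (λ i _ → /-monoʳ-≤ Z (m≤n⇒m≤1+n (m≤n+m b i)))) ⟩
    ∑ b f + (τ * b ∸ b) * (Z / b)      ≤⟨ +-mono-≤ (harmonic-sum τ k Z) (*-monoˡ-≤ (Z / b) (m∸n≤m (τ * b) b)) ⟩
    suc (k * τ) * Z + (τ * b) * (Z / b) ≡⟨ rearrange k τ Z b (Z / b) ⟩
    suc (k * τ) * Z + τ * ((Z / b) * b) ≤⟨ +-monoʳ-≤ (suc (k * τ) * Z) (*-monoʳ-≤ τ (m/n*n≤m Z b)) ⟩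
    suc (k * τ) * Z + τ * Z            ≡⟨ collect k τ Z ⟩
    suc (suc k * τ) * Z                ∎
    where
    open ≤-Reasoning
    b : ℕ
    b = τ ^ k
    instance
      b≢0 : NonZero b
      b≢0 = m^n≢0 τ k
    f : ℕ → ℕ
    f i = Z / suc i
    rearrange : ∀ k τ Z b q → suc (k * τ) * Z + (τ * b) * q ≡ suc (k * τ) * Z + τ * (q * b)
    rearrange = solve-∀
    collect : ∀ k τ Z → (1 + k * τ) * Z + τ * Z ≡ (1 + (1 + k) * τ) * Z
    collect = solve-∀

  ∑₂-slice : ∀ m n k (G : ℕ → ℕ → ℕ → ℕ) (B : ℕ → ℕ) →
    (∀ e → e < k → (∑[ i < m ] ∑[ j < n ] G e i j) ≤ B e) →
    (∑[ i < m ] ∑[ j < n ] ∑[ e < k ] G e i j) ≤ ∑ k B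
  ∑₂-slice m n k G B h = begin
    (∑[ i < m ] ∑[ j < n ] ∑[ e < k ] G e i j)  ≡⟨ ∑-cong m (λ i _ → ∑-swap n k (λ j e → G e i j)) ⟩
    (∑[ i < m ] ∑[ e < k ] ∑[ j < n ] G e i j)  ≡⟨ ∑-swap m k (λ i e → ∑[ j < n ] G e i j) ⟩
    (∑[ e < k ] ∑[ i < m ] ∑[ j < n ] G e i j)  ≤⟨ ∑-mono k h ⟩
    ∑ k B                                       ∎
    where open ≤-Reasoning

  module _ (R S c : ℕ) .{{_ : NonZero R}} .{{_ : NonZero S}} (S≤3R : S ≤ 3 * R)
           (approx : ∀ i j → i ≤ R → j ≤ R → ∃ λ (A : Approximation (R + i) (R + j) S) → Approximation.σ A ≤ c)
    where

    private
      G : (F : ℕ → ℕ) → ℕ → ℕ → ℕ → ℕ → ℕ → ℕ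
      G F e t r i j = 𝟙 ((gcd (suc e) t ≟ 1) ×-dec (suc e * (R + i) + c ≟ t * (R + j) + r)) * F (suc e)

      fibre : ∀ F e t r → (∑[ i < suc R ] ∑[ j < suc R ] G F e t r i j) ≤ suc (R / suc e) * F (suc e)
      fibre F e t r = begin
        (∑[ i < suc R ] ∑[ j < suc R ] G F e t r i j)
          ≡⟨ ∑-cong (suc R) (λ i _ → ∑-*ʳ (suc R) (F (suc e)) _) ⟩
        (∑[ i < suc R ] (∑[ j < suc R ] 𝟙 (P? i j)) * F (suc e))
          ≡⟨ ∑-*ʳ (suc R) (F (suc e)) _ ⟩
        (∑[ i < suc R ] ∑[ j < suc R ] 𝟙 (P? i j)) * F (suc e)
          ≤⟨ *-monoˡ-≤ (F (suc e)) count ⟩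
        suc (R / suc e) * F (suc e) ∎
        where
        open ≤-Reasoning
        P? : ∀ i j → Dec (gcd (suc e) t ≡ 1 × suc e * (R + i) + c ≡ t * (R + j) + r)
        P? i j = (gcd (suc e) t ≟ 1) ×-dec (suc e * (R + i) + c ≟ t * (R + j) + r)
        count : (∑[ i < suc R ] ∑[ j < suc R ] 𝟙 (P? i j)) ≤ suc (R / suc e)
        count with gcd (suc e) t ≟ 1
        ... | yes cop = ≤-trans
          (∑-mono (suc R) (λ i _ → ∑-mono (suc R) (λ j _ →
            𝟙-mono (yes cop ×-dec (suc e * (R + i) + c ≟ t * (R + j) + r)) (suc e * (R + i) + c ≟ t * (R + j) + r) proj₂)))
          (lattice-count R (suc e) t c r (gcd≡1⇒coprime cop))
        ... | no _ = ≤-trans (≤-reflexive (trans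
          (∑-cong (suc R) (λ _ _ → trans (∑-const (suc R) 0) (*-zeroʳ (suc R))))
          (trans (∑-const (suc R) 0) (*-zeroʳ (suc R))))) z≤n

      -- Adding `c` turns the signed error into a natural number `r ≤ 2 * c`, so that both signs
      -- become one linear equation to which `lattice-count` applies.
      residue : ∀ {x y σ} → σ ≤ c → x ≡ y + σ ⊎ x + σ ≡ y → ∃ λ r → r < suc (2 * c) × x + c ≡ y + r
      residue {x} {y} {σ} σ≤c (inj₁ e) = σ + c , s≤s (+-mono-≤ σ≤c (m≤m+n c 0)) ,
        trans (cong (_+ c) e) (+-assoc y σ c)
      residue {x} {y} {σ} σ≤c (inj₂ e) = c ∸ σ , s≤s (≤-trans (m∸n≤m c σ) (m≤m+n c (c + 0))) ,
        trans (cong (x +_) (sym (m+[n∸m]≡n σ≤c))) (trans (sym (+-assoc x σ (c ∸ σ))) (cong (_+ (c ∸ σ)) e))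

      module _ {i j} (i≤R : i ≤ R) (j≤R : j ≤ R) where
        open Approximation (proj₁ (approx i j i≤R j≤R))

        σ≤n : σ ≤ R + j
        σ≤n = ≤-trans (m≤n*m σ S) Sσ≤n

        tn≤ : t * (R + j) ≤ s * (R + i) + σ
        tn≤ with error
        ... | inj₁ e = ≤-trans (≤-trans (m≤m+n _ σ) (≤-reflexive (sym e))) (m≤m+n _ σ)
        ... | inj₂ e = ≤-reflexive (sym e)

        -- Both moduli lie in [R , 2R], so their ratio is at most 2, and σ ≤ n ≤ s n costs at most
        -- one more `s`.
        t≤3s : t ≤ 3 * s
        t≤3s = *-cancelʳ-≤ t (3 * s) (R + j) {{>-nonZero (≤-trans (>-nonZero⁻¹ R) (m≤m+n R j))}} (begin
          t * (R + j)                          ≤⟨ tn≤ ⟩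
          s * (R + i) + σ                      ≤⟨ +-mono-≤ (*-monoʳ-≤ s (+-mono-≤ (m≤m+n R j) (≤-trans i≤R (m≤m+n R j)))) σ≤n ⟩
          s * ((R + j) + (R + j)) + (R + j)    ≤⟨ +-monoʳ-≤ _ (m≤n*m (R + j) s {{>-nonZero s>0}}) ⟩
          s * ((R + j) + (R + j)) + s * (R + j) ≡⟨ collect s (R + j) ⟩
          3 * s * (R + j)                      ∎)
          where
          open ≤-Reasoning
          collect : ∀ s n → s * (n + n) + s * n ≡ 3 * s * n
          collect = solve-∀

        single : ∀ F → F s ≤ (∑[ e < S ] ∑[ t < suc (3 * suc e) ] ∑[ r < suc (2 * c) ] G F e t r i j)
        single F with s | s>0 | s≤S | coprime | t≤3s | error
        ... | suc e | _ | e<S | cop | t≤ | err with r , r< , eq ← residue (proj₂ (approx i j i≤R j≤R)) err = begin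
          F (suc e)
            ≡⟨ *-identityˡ (F (suc e)) ⟨
          1 * F (suc e)
            ≡⟨ cong (_* F (suc e)) (𝟙-true ((gcd (suc e) t ≟ 1) ×-dec (suc e * (R + i) + c ≟ t * (R + j) + r)) (coprime⇒gcd≡1 cop , eq)) ⟨
          G F e t r i j
            ≤⟨ term≤∑ (suc (2 * c)) (λ r → G F e t r i j) r< ⟩
          (∑[ r < suc (2 * c) ] G F e t r i j)
            ≤⟨ term≤∑ (suc (3 * suc e)) (λ t → ∑[ r < suc (2 * c) ] G F e t r i j) (s≤s t≤) ⟩
          (∑[ t < suc (3 * suc e) ] ∑[ r < suc (2 * c) ] G F e t r i j)
            ≤⟨ term≤∑ S (λ e → ∑[ t < suc (3 * suc e) ] ∑[ r < suc (2 * c) ] G F e t r i j) e<S ⟩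
          (∑[ e < S ] ∑[ t < suc (3 * suc e) ] ∑[ r < suc (2 * c) ] G F e t r i j) ∎
          where open ≤-Reasoning

      fraction-count : ∀ e → e < S → suc (3 * suc e) * suc (R / suc e) ≤ 16 * R
      fraction-count e e<S = begin
        suc (3 * s) * suc (R / s)      ≤⟨ *-monoˡ-≤ (suc (R / s)) (+-monoˡ-≤ (3 * s) (s≤s (z≤n {e}))) ⟩
        (s + 3 * s) * suc (R / s) ≡⟨ expand s (R / s) ⟩
        4 * (R / s * s + s)            ≤⟨ *-monoʳ-≤ 4 (+-mono-≤ (m/n*n≤m R s) (≤-trans e<S S≤3R)) ⟩
        4 * (R + 3 * R)                ≡⟨ collect R ⟩
        16 * R                         ∎
        where
        open ≤-Reasoning
        s : ℕ
        s = suc e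
        expand : ∀ s q → (s + 3 * s) * (1 + q) ≡ 4 * (q * s + s)
        expand = solve-∀
        collect : ∀ R → 4 * (R + 3 * R) ≡ 16 * R
        collect = solve-∀

    -- For a given s there are at most 3 s + 1 numerators and 2 c + 1 shifted errors, and each such
    -- equation has at most R / s + 1 solutions. As s ≤ 3 R, the product is at most 16 R (2 c + 1),
    -- independently of s. The lemma serves the energy with exact fractions (error 0) and the
    -- variance with Dirichlet approximations (error at most 2 D).
    approximation-sum : ∀ F (f : ℕ → ℕ → ℕ) →
      (∀ i j (i≤R : i ≤ R) (j≤R : j ≤ R) → f i j ≤ F (Approximation.s (proj₁ (approx i j i≤R j≤R)))) →
      (∑[ i < suc R ] ∑[ j < suc R ] f i j) ≤ 16 * R * suc (2 * c) * (∑[ e < S ] F (suc e))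
    approximation-sum F f f≤F = begin
      (∑[ i < suc R ] ∑[ j < suc R ] f i j)
        ≤⟨ ∑-mono (suc R) (λ i i≤R → ∑-mono (suc R) (λ j j≤R →
             ≤-trans (f≤F i j (≤-pred i≤R) (≤-pred j≤R)) (single (≤-pred i≤R) (≤-pred j≤R) F))) ⟩
      (∑[ i < suc R ] ∑[ j < suc R ] ∑[ e < S ] ∑[ t < suc (3 * suc e) ] ∑[ r < suc (2 * c) ] G F e t r i j)
        ≤⟨ ∑₂-slice (suc R) (suc R) S _ _ (λ e e<S →
             ∑₂-slice (suc R) (suc R) (suc (3 * suc e)) _ _ (λ t _ →
               ∑₂-slice (suc R) (suc R) (suc (2 * c)) _ _ (λ r _ → fibre F e t r))) ⟩
      (∑[ e < S ] ∑[ t < suc (3 * suc e) ] ∑[ r < suc (2 * c) ] suc (R / suc e) * F (suc e))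
        ≤⟨ ∑-mono S (λ e e<S → count e e<S) ⟩
      (∑[ e < S ] 16 * R * suc (2 * c) * F (suc e))
        ≡⟨ ∑-*ˡ S (16 * R * suc (2 * c)) (λ e → F (suc e)) ⟩
      16 * R * suc (2 * c) * (∑[ e < S ] F (suc e)) ∎
      where
      open ≤-Reasoning
      regroup : ∀ x y z u → x * (y * (z * u)) ≡ (x * z) * y * u
      regroup = solve-∀
      count : ∀ e → e < S → (∑[ t < suc (3 * suc e) ] ∑[ r < suc (2 * c) ] suc (R / suc e) * F (suc e)) ≤
        16 * R * suc (2 * c) * F (suc e)
      count e e<S = begin
        (∑[ t < suc (3 * suc e) ] ∑[ r < suc (2 * c) ] suc (R / suc e) * F (suc e))
          ≡⟨ ∑-cong (suc (3 * suc e)) (λ _ _ → ∑-const (suc (2 * c)) _) ⟩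
        (∑[ t < suc (3 * suc e) ] suc (2 * c) * (suc (R / suc e) * F (suc e)))
          ≡⟨ ∑-const (suc (3 * suc e)) _ ⟩
        suc (3 * suc e) * (suc (2 * c) * (suc (R / suc e) * F (suc e)))
          ≡⟨ regroup (suc (3 * suc e)) (suc (2 * c)) (suc (R / suc e)) (F (suc e)) ⟩
        (suc (3 * suc e) * suc (R / suc e)) * suc (2 * c) * F (suc e)
          ≤⟨ *-monoˡ-≤ (F (suc e)) (*-monoˡ-≤ (suc (2 * c)) (fraction-count e e<S)) ⟩
        16 * R * suc (2 * c) * F (suc e) ∎

  -- Division made total; only its values at positive divisors matter.
  _÷_ : ℕ → ℕ → ℕ
  Z ÷ zero  = 0
  Z ÷ suc e = Z / suc e

  ÷≡/ : ∀ Z s .{{_ : NonZero s}} → Z ÷ s ≡ Z / s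
  ÷≡/ Z (suc e) = refl

  -- If (R + b) / (R + b′) is t / s in lowest terms, equality of the products forces s (R + c′) = t
  -- (R + c), which has at most R / s + 1 solutions. Summing over the pairs (b , b′) leaves a
  -- harmonic sum.
  product-energy : ∀ R τ k .{{_ : NonZero R}} .{{_ : NonZero τ}} → 3 * R ≤ τ ^ k →
    (∑[ b < suc R ] ∑[ b′ < suc R ] ∑[ c < suc R ] ∑[ c′ < suc R ] 𝟙 ((R + b) * (R + c) ≟ (R + b′) * (R + c′)))
      ≤ 16 * R * (3 * R + suc (k * τ) * R)
  product-energy R τ k 3R≤ = begin
    (∑[ b < suc R ] ∑[ b′ < suc R ] ∑[ c < suc R ] ∑[ c′ < suc R ] 𝟙 ((R + b) * (R + c) ≟ (R + b′) * (R + c′)))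
      ≤⟨ approximation-sum R (3 * R) 0 ≤-refl approx (λ s → suc (R ÷ s)) _ ratio-count ⟩
    16 * R * 1 * (∑[ e < 3 * R ] suc (R / suc e))
      ≡⟨ cong₂ _*_ (*-identityʳ (16 * R)) (∑-+ (3 * R) (λ _ → 1) (λ e → R / suc e)) ⟩
    16 * R * ((∑[ e < 3 * R ] 1) + (∑[ e < 3 * R ] R / suc e))
      ≤⟨ *-monoʳ-≤ (16 * R) (+-mono-≤ (≤-reflexive (trans (∑-const (3 * R) 1) (*-identityʳ (3 * R)))) harmonic) ⟩
    16 * R * (3 * R + suc (k * τ) * R) ∎
    where
    open ≤-Reasoning
    instance
      3R≢0 : NonZero (3 * R)
      3R≢0 = m*n≢0 3 R
    harmonic : (∑[ e < 3 * R ] R / suc e) ≤ suc (k * τ) * R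
    harmonic = ≤-trans (≤-trans (m≤m+n _ _) (≤-reflexive (trans (sym (∑-split (3 * R) (τ ^ k ∸ 3 * R) (λ e → R / suc e)))
      (cong (λ n → ∑[ e < n ] R / suc e) (m∸n+n≡m 3R≤))))) (harmonic-sum τ k R)
    R+≤2R : ∀ {i} → i ≤ R → R + i ≤ 2 * R
    R+≤2R i≤R = +-monoʳ-≤ R (≤-trans i≤R (m≤m+n R 0))
    -- The exact fraction is viewed as an approximation of level `3 * R`. The level exceeds every
    -- modulus, so S σ ≤ n leaves only σ = 0.
    approx : ∀ i j → i ≤ R → j ≤ R → ∃ λ (A : Approximation (R + i) (R + j) (3 * R)) → Approximation.σ A ≤ 0
    approx i j i≤R j≤R = A , ≮⇒≥ λ σ>0 → <⇒≱ (begin-strict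
        R + j    ≤⟨ R+≤2R j≤R ⟩
        2 * R    <⟨ *-monoˡ-< R (n<1+n 2) ⟩
        3 * R    ≤⟨ m≤m*n (3 * R) (Approximation.σ A) {{>-nonZero σ>0}} ⟩
        3 * R * Approximation.σ A ∎) (Approximation.Sσ≤n A)
      where
      A : Approximation (R + i) (R + j) (3 * R)
      A = approximation-reduce (R + j) (R + i) 0 (≤-trans (>-nonZero⁻¹ R) (m≤m+n R j))
        (≤-trans (R+≤2R j≤R) (*-monoˡ-≤ R (n≤1+n 2))) (≤-trans (≤-reflexive (*-zeroʳ (3 * R))) z≤n)
        (inj₁ (trans (*-comm (R + j) (R + i)) (sym (+-identityʳ _))))
    ratio-count : ∀ i j (i≤R : i ≤ R) (j≤R : j ≤ R) →
      (∑[ c < suc R ] ∑[ c′ < suc R ] 𝟙 ((R + i) * (R + c) ≟ (R + j) * (R + c′))) ≤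
        suc (R ÷ Approximation.s (proj₁ (approx i j i≤R j≤R)))
    ratio-count i j i≤R j≤R = begin
      (∑[ c < suc R ] ∑[ c′ < suc R ] 𝟙 ((R + i) * (R + c) ≟ (R + j) * (R + c′)))
        ≡⟨ ∑-swap (suc R) (suc R) (λ c c′ → 𝟙 ((R + i) * (R + c) ≟ (R + j) * (R + c′))) ⟩
      (∑[ c′ < suc R ] ∑[ c < suc R ] 𝟙 ((R + i) * (R + c) ≟ (R + j) * (R + c′)))
        ≤⟨ ∑-mono (suc R) (λ c′ _ → ∑-mono (suc R) (λ c _ → 𝟙-mono (_ ≟ _) (s * (R + c′) + 0 ≟ t * (R + c) + 0) (transfer c c′))) ⟩
      (∑[ c′ < suc R ] ∑[ c < suc R ] 𝟙 (s * (R + c′) + 0 ≟ t * (R + c) + 0))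
        ≤⟨ lattice-count R s t 0 0 coprime ⟩
      suc (R / s)
        ≡⟨ cong suc (÷≡/ R s) ⟨
      suc (R ÷ s) ∎
      where
      open Approximation (proj₁ (approx i j i≤R j≤R))
      instance
        s≢0 : NonZero s
        s≢0 = >-nonZero s>0
        R+j≢0 : NonZero (R + j)
        R+j≢0 = >-nonZero (≤-trans (>-nonZero⁻¹ R) (m≤m+n R j))
      σ≡0 : σ ≡ 0
      σ≡0 = n≤0⇒n≡0 (proj₂ (approx i j i≤R j≤R))
      exact : s * (R + i) ≡ t * (R + j)
      exact with error
      ... | inj₁ e = trans e (trans (cong (t * (R + j) +_) σ≡0) (+-identityʳ _))
      ... | inj₂ e = trans (sym (trans (cong (s * (R + i) +_) σ≡0) (+-identityʳ _))) e
      transfer : ∀ c c′ → (R + i) * (R + c) ≡ (R + j) * (R + c′) → s * (R + c′) + 0 ≡ t * (R + c) + 0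
      transfer c c′ e = cong (_+ 0) (*-cancelˡ-≡ (s * (R + c′)) (t * (R + c)) (R + j) (begin-equality
        (R + j) * (s * (R + c′))   ≡⟨ e₁ (R + j) s (R + c′) ⟩
        s * ((R + j) * (R + c′))   ≡⟨ cong (s *_) e ⟨
        s * ((R + i) * (R + c))    ≡⟨ *-assoc s (R + i) (R + c) ⟨
        (s * (R + i)) * (R + c)    ≡⟨ cong (_* (R + c)) exact ⟩
        (t * (R + j)) * (R + c)    ≡⟨ e₂ t (R + j) (R + c) ⟩
        (R + j) * (t * (R + c))    ∎))
        where
        e₁ : ∀ x y z → x * (y * z) ≡ y * (x * z)
        e₁ = solve-∀
        e₂ : ∀ x y z → (x * y) * z ≡ y * (x * z)
        e₂ = solve-∀

  -- Multiples of a single modulus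

  next-multiple : ∀ a m .{{_ : NonZero a}} → ∃ λ d → d < a × a ∣ d + m
  next-multiple a m with m % a in eq
  ... | zero  = 0 , >-nonZero⁻¹ a , m%n≡0⇒n∣m m a eq
  ... | suc r = a ∸ suc r , ∸-monoʳ-< z<s r≤a , divides (suc (m / a)) (begin
    (a ∸ suc r) + m                         ≡⟨ cong ((a ∸ suc r) +_) (m≡m%n+[m/n]*n m a) ⟩
    (a ∸ suc r) + (m % a + m / a * a)       ≡⟨ cong (λ z → (a ∸ suc r) + (z + m / a * a)) eq ⟩
    (a ∸ suc r) + (suc r + m / a * a)       ≡⟨ +-assoc (a ∸ suc r) (suc r) _ ⟨
    ((a ∸ suc r) + suc r) + m / a * a       ≡⟨ cong (_+ m / a * a) (m∸n+n≡m r≤a) ⟩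
    a + m / a * a                           ∎)
    where
    open ≡-Reasoning
    r≤a : suc r ≤ a
    r≤a = subst (_≤ a) eq (m%n≤n m a)

  multiples-count : ∀ a P j .{{_ : NonZero a}} → P ≤ a * (∑[ y < P ] 𝟙 (a ∣? y + j)) + a
  multiples-count a P j = begin
    P                              ≡⟨ m≡m%n+[m/n]*n P a ⟩
    P % a + P / a * a              ≤⟨ +-mono-≤ (m%n≤n P a) (*-monoˡ-≤ a (≤-trans (blocks (P / a)) shorter)) ⟩
    a + ∑ P f * a                  ≡⟨ trans (+-comm a _) (cong (_+ a) (*-comm (∑ P f) a)) ⟩
    a * ∑ P f + a                  ∎
    where
    open ≤-Reasoning
    f : ℕ → ℕ
    f y = 𝟙 (a ∣? y + j)
    blocks : ∀ q → q ≤ ∑ (q * a) f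
    blocks zero    = z≤n
    blocks (suc q) with d , d<a , a∣ ← next-multiple a (q * a + j) = begin
      suc q                                    ≡⟨ +-comm 1 q ⟩
      q + 1                                    ≡⟨ cong (q +_) (𝟙-true (a ∣? d + q * a + j) (subst (a ∣_) (sym (+-assoc d (q * a) j)) a∣)) ⟨
      q + f (d + q * a)                        ≤⟨ +-mono-≤ (blocks q) (term≤∑ a (λ i → f (i + q * a)) d<a) ⟩
      ∑ (q * a) f + (∑[ i < a ] f (i + q * a)) ≡⟨ ∑-split (q * a) a f ⟨
      ∑ (a + q * a) f                          ∎
    shorter : ∑ (P / a * a) f ≤ ∑ P f
    shorter = begin
      ∑ (P / a * a) f                                             ≤⟨ m≤m+n _ _ ⟩
      ∑ (P / a * a) f + (∑[ i < P % a ] f (i + P / a * a))        ≡⟨ ∑-split (P / a * a) (P % a) f ⟨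
      ∑ (P % a + P / a * a) f                                     ≡⟨ cong (λ n → ∑ n f) (m≡m%n+[m/n]*n P a) ⟨
      ∑ P f                                                       ∎

  -- Moments of the weighted count of multiples

  module Moments (R S D P w : ℕ) .{{_ : NonZero R}} .{{_ : NonZero S}} (R≡SD : R ≡ S * D)
                 (α : ℕ → ℕ) (α≤1 : ∀ i → α i ≤ 1)
    where

    private
      instance
        R+i≢0 : ∀ {i} → NonZero (R + i)
        R+i≢0 {i} = >-nonZero (≤-trans (>-nonZero⁻¹ R) (m≤m+n R i))

    ∣α∣ μ c : ℕ
    ∣α∣ = ∑ (suc R) α
    μ   = w * ∣α∣
    c   = 2 * D

    hits : ℕ → ℕ → ℕ
    hits i y = ∑[ j < w ] 𝟙 (R + i ∣? y + j)

    -- The weight R + i makes every modulus contribute the same mean w to B.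
    B : ℕ → ℕ
    B y = ∑[ i < suc R ] α i * ((R + i) * hits i y)

    private
      2R : ∀ {i} → i ≤ R → R + i ≤ 2 * R
      2R i≤R = +-monoʳ-≤ R (≤-trans i≤R (m≤m+n R 0))

    -- For each shift `j`, a modulus a ≤ 2 R has at least P / a - 1 multiples among the `y + j`; the
    -- weight a turns this into P - 2 R. The Chebyshev step uses the first moment only through this
    -- lower bound.
    first-moment : P * μ ≤ ∑ P B + 2 * R * μ
    first-moment = begin
      P * μ
        ≡⟨ e₁ P w ∣α∣ ⟩
      ∣α∣ * (w * P)
        ≡⟨ ∑-*ʳ (suc R) (w * P) α ⟨
      (∑[ i < suc R ] α i * (w * P))
        ≤⟨ ∑-mono (suc R) (λ i i≤R → *-monoʳ-≤ (α i) (modulus i (≤-pred i≤R))) ⟩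
      (∑[ i < suc R ] α i * ((R + i) * (∑[ y < P ] hits i y) + w * (2 * R)))
        ≡⟨ ∑-cong (suc R) (λ i _ → *-distribˡ-+ (α i) _ _) ⟩
      (∑[ i < suc R ] α i * ((R + i) * (∑[ y < P ] hits i y)) + α i * (w * (2 * R)))
        ≡⟨ ∑-+ (suc R) _ _ ⟩
      (∑[ i < suc R ] α i * ((R + i) * (∑[ y < P ] hits i y))) + (∑[ i < suc R ] α i * (w * (2 * R)))
        ≡⟨ cong₂ _+_ (∑-cong (suc R) (λ i _ → sym (collect i))) (∑-*ʳ (suc R) (w * (2 * R)) α) ⟩
      (∑[ i < suc R ] ∑[ y < P ] α i * ((R + i) * hits i y)) + ∣α∣ * (w * (2 * R))
        ≡⟨ cong₂ _+_ (∑-swap (suc R) P (λ i y → α i * ((R + i) * hits i y))) (e₂ ∣α∣ w (2 * R)) ⟩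
      ∑ P B + 2 * R * μ ∎
      where
      open ≤-Reasoning
      e₁ : ∀ P w x → P * (w * x) ≡ x * (w * P)
      e₁ = solve-∀
      e₂ : ∀ x w r → x * (w * r) ≡ r * (w * x)
      e₂ = solve-∀
      collect : ∀ i → (∑[ y < P ] α i * ((R + i) * hits i y)) ≡ α i * ((R + i) * (∑[ y < P ] hits i y))
      collect i = trans (∑-*ˡ P (α i) _) (cong (α i *_) (∑-*ˡ P (R + i) _))
      modulus : ∀ i → i ≤ R → w * P ≤ (R + i) * (∑[ y < P ] hits i y) + w * (2 * R)
      modulus i i≤R = begin
        w * P
          ≡⟨ ∑-const w P ⟨
        (∑[ j < w ] P)
          ≤⟨ ∑-mono w (λ j _ → ≤-trans (multiples-count (R + i) P j) (+-monoʳ-≤ ((R + i) * (∑[ y < P ] 𝟙 (R + i ∣? y + j))) (2R i≤R))) ⟩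
        (∑[ j < w ] (R + i) * (∑[ y < P ] 𝟙 (R + i ∣? y + j)) + 2 * R)
          ≡⟨ trans (∑-+ w _ _) (cong₂ _+_ (∑-*ˡ w (R + i) _) (∑-const w (2 * R))) ⟩
        (R + i) * (∑[ j < w ] ∑[ y < P ] 𝟙 (R + i ∣? y + j)) + w * (2 * R)
          ≡⟨ cong (λ z → (R + i) * z + w * (2 * R)) (∑-swap w P (λ j y → 𝟙 (R + i ∣? y + j))) ⟩
        (R + i) * (∑[ y < P ] hits i y) + w * (2 * R) ∎

    private
      approx : ∀ i j → Approximation (R + i) (R + j) S
      approx i j = dirichlet (R + i) (R + j) S

      s : ℕ → ℕ → ℕ
      s i j = Approximation.s (approx i j)

      σ≤c : ∀ i j → j ≤ R → Approximation.σ (approx i j) ≤ c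
      σ≤c i j j≤R = *-cancelˡ-≤ S (begin
        S * Approximation.σ (approx i j)   ≤⟨ Approximation.Sσ≤n (approx i j) ⟩
        R + j                              ≤⟨ 2R j≤R ⟩
        2 * R                              ≡⟨ cong (2 *_) R≡SD ⟩
        2 * (S * D)                        ≡⟨ e S D ⟩
        S * (2 * D)                        ∎)
        where
        open ≤-Reasoning
        e : ∀ S D → 2 * (S * D) ≡ S * (2 * D)
        e = solve-∀

    -- Collects the error terms bounded uniformly over all pairs of moduli; the one term that varies
    -- with the denominator s is 4 R (P + w) / s.
    uniform-error : ℕ
    uniform-error = w * w + (P + w) * c + 2 * R * S * (w + c) + 8 * R * R

    private
      pair-error : ℕ → ℕ → ℕ
      pair-error i j = uniform-error + 4 * R * ((P + w) ÷ s i j)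

      -- There are about (P + w) / (a s) blocks, each with about s (w + σ) / n values of the
      -- coordinate `V`. The factor s cancels, and multiplication by a n leaves the main term
      -- `P * w`, the value for independent moduli.
      block-product : ∀ i j → i ≤ R → j ≤ R →
        let open Approximation (approx i j) renaming (s to sᵢⱼ); instance s≢0 = >-nonZero s>0 in
        (R + i) * (R + j) * (suc ((P + w) / (R + i) / sᵢⱼ) * (2 + (sᵢⱼ * w + sᵢⱼ * σ) / (R + j))) ≤
          P * w + pair-error i j
      block-product i j i≤R j≤R = begin
        a * n * (suc ((P + w) / a / s₁) * (2 + (s₁ * w + s₁ * σ) / n))
          ≡⟨ e₁ a n ((P + w) / a / s₁) ((s₁ * w + s₁ * σ) / n) ⟩
        (((P + w) / a / s₁) * a + a) * (2 * n + (s₁ * w + s₁ * σ) / n * n)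
          ≤⟨ *-mono-≤ (+-monoˡ-≤ a quot) (+-monoʳ-≤ (2 * n) (m/n*n≤m (s₁ * w + s₁ * σ) n)) ⟩
        (Z + a) * (2 * n + (s₁ * w + s₁ * σ))
          ≡⟨ e₂ Z a n s₁ w σ ⟩
        Z * s₁ * (w + σ) + 2 * n * Z + a * s₁ * (w + σ) + 2 * a * n
          ≤⟨ +-mono-≤ (+-mono-≤ (+-mono-≤ (*-mono-≤ (m/n*n≤m (P + w) s₁) w+σ≤) (*-monoˡ-≤ Z (*-monoʳ-≤ 2 (2R j≤R))))
               (*-mono-≤ (*-mono-≤ (2R i≤R) s≤S) w+σ≤)) (*-mono-≤ (*-monoʳ-≤ 2 (2R i≤R)) (2R j≤R)) ⟩
        (P + w) * (w + c) + 2 * (2 * R) * Z + 2 * R * S * (w + c) + 2 * (2 * R) * (2 * R)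
          ≡⟨ e₃ P w c R S Z ⟩
        P * w + (uniform-error + 4 * R * Z)
          ≡⟨ cong (λ z → P * w + (uniform-error + 4 * R * z)) (÷≡/ (P + w) s₁) ⟨
        P * w + pair-error i j ∎
        where
        open ≤-Reasoning
        open Approximation (approx i j) renaming (s to s₁)
        instance
          s≢0 : NonZero s₁
          s≢0 = >-nonZero s>0
        a n Z : ℕ
        a = R + i
        n = R + j
        Z = (P + w) / s₁
        w+σ≤ : w + σ ≤ w + c
        w+σ≤ = +-monoʳ-≤ w (σ≤c i j j≤R)
        instance
          as≢0 : NonZero (a * s₁)
          as≢0 = m*n≢0 a s₁
          sa≢0 : NonZero (s₁ * a)
          sa≢0 = m*n≢0 s₁ a
        quot : ((P + w) / a / s₁) * a ≤ Z
        quot = begin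
          (P + w) / a / s₁ * a       ≡⟨ cong (_* a) (m/n/o≡m/[n*o] (P + w) a s₁) ⟩
          (P + w) / (a * s₁) * a     ≡⟨ cong (_* a) (/-congʳ {m = P + w} (*-comm a s₁)) ⟩
          (P + w) / (s₁ * a) * a     ≡⟨ cong (_* a) (m/n/o≡m/[n*o] (P + w) s₁ a) ⟨
          Z / a * a                  ≤⟨ m/n*n≤m Z a ⟩
          Z                          ∎
        e₁ : ∀ a n x y → a * n * ((1 + x) * (2 + y)) ≡ (x * a + a) * (2 * n + y * n)
        e₁ = solve-∀
        e₂ : ∀ Z a n s w σ → (Z + a) * (2 * n + (s * w + s * σ)) ≡ Z * s * (w + σ) + 2 * n * Z + a * s * (w + σ) + 2 * a * n
        e₂ = solve-∀
        e₃ : ∀ P w c R S Z → (P + w) * (w + c) + 2 * (2 * R) * Z + 2 * R * S * (w + c) + 2 * (2 * R) * (2 * R) ≡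
          P * w + ((w * w + (P + w) * c + 2 * R * S * (w + c) + 8 * R * R) + 4 * R * Z)
        e₃ = solve-∀

      correlation : ∀ i j → i ≤ R → j ≤ R →
        (R + i) * (R + j) * (∑[ y < P ] hits i y * hits j y) ≤ w * (P * w + pair-error i j)
      correlation i j i≤R j≤R = begin
        a * n * (∑[ y < P ] hits i y * hits j y)
          ≡⟨ cong (a * n *_) (∑-cong P (λ y _ → trans (∑-*-∑ w w _ _)
               (∑-cong w (λ k _ → ∑-cong w (λ l _ → 𝟙-× (a ∣? y + k) (n ∣? y + l)))))) ⟩
        a * n * (∑[ y < P ] ∑[ k < w ] ∑[ l < w ] 𝟙 ((a ∣? y + k) ×-dec (n ∣? y + l)))
          ≡⟨ cong (a * n *_) (∑-swap P w _) ⟩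
        a * n * (∑[ k < w ] ∑[ y < P ] ∑[ l < w ] 𝟙 ((a ∣? y + k) ×-dec (n ∣? y + l)))
          ≤⟨ *-monoʳ-≤ (a * n) (∑-bound w bound (λ k k<w → pair-count (approx i j) P w k k<w)) ⟩
        a * n * (w * bound)
          ≡⟨ e (a * n) w bound ⟩
        w * (a * n * bound)
          ≤⟨ *-monoʳ-≤ w (block-product i j i≤R j≤R) ⟩
        w * (P * w + pair-error i j) ∎
        where
        open ≤-Reasoning
        open Approximation (approx i j) using (σ; s>0) renaming (s to s₁)
        instance
          s≢0 : NonZero s₁
          s≢0 = >-nonZero s>0
        a n bound : ℕ
        a = R + i
        n = R + j
        bound = suc ((P + w) / a / s₁) * (2 + (s₁ * w + s₁ * σ) / n)
        e : ∀ x w b → x * (w * b) ≡ w * (x * b)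
        e = solve-∀

      error-sum : (∑[ i < suc R ] ∑[ j < suc R ] pair-error i j) ≤
        suc R * (suc R * uniform-error) + 4 * R * (16 * R * suc (2 * c) * (∑[ e < S ] (P + w) / suc e))
      error-sum = begin
        (∑[ i < suc R ] ∑[ j < suc R ] pair-error i j)
          ≡⟨ ∑-cong (suc R) (λ i _ → trans (∑-+ (suc R) _ _) (cong₂ _+_ (∑-const (suc R) _) (∑-*ˡ (suc R) (4 * R) _))) ⟩
        (∑[ i < suc R ] suc R * uniform-error + 4 * R * (∑[ j < suc R ] (P + w) ÷ s i j))
          ≡⟨ trans (∑-+ (suc R) _ _) (cong₂ _+_ (∑-const (suc R) _) (∑-*ˡ (suc R) (4 * R) _)) ⟩
        suc R * (suc R * uniform-error) + 4 * R * (∑[ i < suc R ] ∑[ j < suc R ] (P + w) ÷ s i j)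
          ≤⟨ +-monoʳ-≤ _ (*-monoʳ-≤ (4 * R) (approximation-sum R S c S≤3R
               (λ i j _ j≤R → approx i j , σ≤c i j j≤R) ((P + w) ÷_) (λ i j → (P + w) ÷ s i j) (λ _ _ _ _ → ≤-refl))) ⟩
        suc R * (suc R * uniform-error) + 4 * R * (16 * R * suc (2 * c) * (∑[ e < S ] (P + w) / suc e)) ∎
        where
        open ≤-Reasoning
        D>0 : 0 < D
        D>0 = n≢0⇒n>0 λ { refl → <⇒≢ (>-nonZero⁻¹ R) (sym (trans R≡SD (*-zeroʳ S))) }
        S≤3R : S ≤ 3 * R
        S≤3R = ≤-trans (m≤m*n S D {{>-nonZero D>0}}) (≤-trans (≤-reflexive (sym R≡SD)) (m≤n*m R 3))

    -- The weights `α` stay in the main term, which becomes P μ². In the error they are replaced by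
    -- 1, so that it can be summed over all pairs from [R , 2R] with `approximation-sum`.
    second-moment : (∑[ y < P ] B y * B y) ≤ P * (μ * μ) +
      w * (suc R * (suc R * uniform-error) + 4 * R * (16 * R * suc (2 * c) * (∑[ e < S ] (P + w) / suc e)))
    second-moment = begin
      (∑[ y < P ] B y * B y)
        ≡⟨ ∑-cong P (λ y _ → ∑-*-∑ (suc R) (suc R) (summand y) (summand y)) ⟩
      (∑[ y < P ] ∑[ i < suc R ] ∑[ j < suc R ] summand y i * summand y j)
        ≡⟨ ∑-swap P (suc R) _ ⟩
      (∑[ i < suc R ] ∑[ y < P ] ∑[ j < suc R ] summand y i * summand y j)
        ≡⟨ ∑-cong (suc R) (λ i _ → ∑-swap P (suc R) (λ y j → summand y i * summand y j)) ⟩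
      (∑[ i < suc R ] ∑[ j < suc R ] ∑[ y < P ] summand y i * summand y j)
        ≤⟨ ∑-mono (suc R) (λ i i≤R → ∑-mono (suc R) (λ j j≤R → pair i j (≤-pred i≤R) (≤-pred j≤R))) ⟩
      (∑[ i < suc R ] ∑[ j < suc R ] α i * α j * (w * (P * w)) + w * pair-error i j)
        ≡⟨ ∑-cong (suc R) (λ i _ → trans (∑-+ (suc R) _ _)
             (cong₂ _+_ (∑-*ʳ (suc R) (w * (P * w)) _) (∑-*ˡ (suc R) w _))) ⟩
      (∑[ i < suc R ] (∑[ j < suc R ] α i * α j) * (w * (P * w)) + w * (∑[ j < suc R ] pair-error i j))
        ≡⟨ trans (∑-+ (suc R) _ _) (cong₂ _+_ (∑-*ʳ (suc R) (w * (P * w)) _) (∑-*ˡ (suc R) w _)) ⟩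
      (∑[ i < suc R ] ∑[ j < suc R ] α i * α j) * (w * (P * w)) + w * (∑[ i < suc R ] ∑[ j < suc R ] pair-error i j)
        ≡⟨ cong (λ z → z * (w * (P * w)) + w * (∑[ i < suc R ] ∑[ j < suc R ] pair-error i j)) (∑-*-∑ (suc R) (suc R) α α) ⟨
      ∣α∣ * ∣α∣ * (w * (P * w)) + w * (∑[ i < suc R ] ∑[ j < suc R ] pair-error i j)
        ≤⟨ +-mono-≤ (≤-reflexive (e ∣α∣ w P)) (*-monoʳ-≤ w error-sum) ⟩
      P * (μ * μ) + w * (suc R * (suc R * uniform-error) + 4 * R * (16 * R * suc (2 * c) * (∑[ e < S ] (P + w) / suc e))) ∎
      where
      open ≤-Reasoning
      summand : ℕ → ℕ → ℕ
      summand y i = α i * ((R + i) * hits i y)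
      e : ∀ x w P → x * x * (w * (P * w)) ≡ P * ((w * x) * (w * x))
      e = solve-∀
      e₁ : ∀ x a h y n k → (x * (a * h)) * (y * (n * k)) ≡ x * y * (a * n) * (h * k)
      e₁ = solve-∀
      e₂ : ∀ x w p r → x * (w * (p + r)) ≡ x * (w * p) + x * (w * r)
      e₂ = solve-∀
      pair : ∀ i j → i ≤ R → j ≤ R →
        (∑[ y < P ] summand y i * summand y j) ≤ α i * α j * (w * (P * w)) + w * pair-error i j
      pair i j i≤R j≤R = begin
        (∑[ y < P ] summand y i * summand y j)
          ≡⟨ ∑-cong P (λ y _ → e₁ (α i) (R + i) (hits i y) (α j) (R + j) (hits j y)) ⟩
        (∑[ y < P ] α i * α j * ((R + i) * (R + j)) * (hits i y * hits j y))
          ≡⟨ trans (∑-*ˡ P (α i * α j * ((R + i) * (R + j))) _) (*-assoc (α i * α j) ((R + i) * (R + j)) _) ⟩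
        α i * α j * ((R + i) * (R + j) * (∑[ y < P ] hits i y * hits j y))
          ≤⟨ *-monoʳ-≤ (α i * α j) (correlation i j i≤R j≤R) ⟩
        α i * α j * (w * (P * w + pair-error i j))
          ≡⟨ e₂ (α i * α j) w (P * w) (pair-error i j) ⟩
        α i * α j * (w * (P * w)) + α i * α j * (w * pair-error i j)
          ≤⟨ +-monoʳ-≤ _ (≤-trans (*-monoˡ-≤ (w * pair-error i j) (*-mono-≤ (α≤1 i) (α≤1 j))) (≤-reflexive (*-identityˡ _))) ⟩
        α i * α j * (w * (P * w)) + w * pair-error i j ∎

  -- Comparison of the moments

  square-+ : ∀ x d → 2 * x * (x + d) ≤ x * x + (x + d) * (x + d)
  square-+ x d = ≤-trans (m≤m+n _ (d * d)) (≤-reflexive (e x d))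
    where
    e : ∀ x d → 2 * x * (x + d) + d * d ≡ x * x + (x + d) * (x + d)
    e = solve-∀

  2xy≤x²+y² : ∀ x y → 2 * x * y ≤ x * x + y * y
  2xy≤x²+y² x y with ≤-total x y
  ... | inj₁ x≤y = subst (λ z → 2 * x * z ≤ x * x + z * z) (m+[n∸m]≡n x≤y) (square-+ x (y ∸ x))
  ... | inj₂ y≤x = subst₂ _≤_ (e y x) (+-comm (y * y) (x * x))
    (subst (λ z → 2 * y * z ≤ y * y + z * z) (m+[n∸m]≡n y≤x) (square-+ y (x ∸ y)))
    where
    e : ∀ y x → 2 * y * x ≡ 2 * x * y
    e = solve-∀

  -- The error falls short of the trivial size w² R⁴ by a factor `D`. In the harmonic part, the
  -- wanted saving D, the count 2 c + 1 ≤ 5 D of errors and the factor τ of the harmonic sum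
  -- multiply to D² τ, which is exactly `w`. The constant is 1044 = 4 * 21 + 960, from the uniform
  -- and the harmonic part.
  error-bound : ∀ R S D w τ k Γ Σ → .{{_ : NonZero R}} .{{_ : NonZero D}} .{{_ : NonZero τ}} .{{_ : NonZero Γ}} →
    R ≡ S * D → w ≡ D * D * τ → w ≤ R →
    let P = 2 * (Γ * (R * R)); c = 2 * D in
    Σ ≤ suc (k * τ) * (P + w) →
    D * (w * (suc R * (suc R * (w * w + (P + w) * c + 2 * R * S * (w + c) + 8 * R * R)) + 4 * R * (16 * R * suc (2 * c) * Σ)))
      ≤ 1044 * suc k * Γ * (w * w * (R * R * (R * R)))
  error-bound R S D w τ k Γ Σ R≡SD w≡ w≤R Σ≤ = begin
    D * (w * (suc R * (suc R * U) + 4 * R * (16 * R * suc (2 * c) * Σ)))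
      ≤⟨ *-monoʳ-≤ D (*-monoʳ-≤ w (+-mono-≤ (*-mono-≤ sucR (*-monoˡ-≤ U sucR))
           (*-monoʳ-≤ (4 * R) (*-mono-≤ (*-monoʳ-≤ (16 * R) 2c) (≤-trans Σ≤ (*-mono-≤ sucKτ P+w)))))) ⟩
    D * (w * (2 * R * (2 * R * U) + 4 * R * (16 * R * (5 * D) * (suc k * τ * (3 * Q)))))
      ≡⟨ e₁ D w R U k τ Q ⟩
    w * (4 * (R * R) * (D * U) + 960 * (suc k * (R * R) * Q * (D * D * τ)))
      ≤⟨ *-monoʳ-≤ w (+-mono-≤ (*-monoʳ-≤ (4 * (R * R)) DU) (≤-reflexive (cong (λ z → 960 * (suc k * (R * R) * Q * z)) (sym w≡)))) ⟩
    w * (4 * (R * R) * (21 * (Q * w)) + 960 * (suc k * (R * R) * Q * w))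
      ≤⟨ *-monoʳ-≤ w (+-monoˡ-≤ _ (m≤n*m (4 * (R * R) * (21 * (Q * w))) (suc k))) ⟩
    w * (suc k * (4 * (R * R) * (21 * (Q * w))) + 960 * (suc k * (R * R) * Q * w))
      ≡⟨ e₂ w k R Γ ⟩
    1044 * suc k * Γ * (w * w * (R * R * (R * R))) ∎
    where
    open ≤-Reasoning
    P c Q U : ℕ
    P = 2 * (Γ * (R * R))
    c = 2 * D
    Q = Γ * (R * R)
    U = w * w + (P + w) * c + 2 * R * S * (w + c) + 8 * R * R
    sucR : suc R ≤ 2 * R
    sucR = subst (_≤ 2 * R) refl (+-mono-≤ (>-nonZero⁻¹ R) (m≤m+n R 0))
    2c : suc (2 * c) ≤ 5 * D
    2c = +-mono-≤ (>-nonZero⁻¹ D) (≤-reflexive (e D))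
      where
      e : ∀ D → 2 * (2 * D) ≡ 4 * D
      e = solve-∀
    sucKτ : suc (k * τ) ≤ suc k * τ
    sucKτ = +-monoˡ-≤ (k * τ) (>-nonZero⁻¹ τ)
    RR≤Q : R * R ≤ Q
    RR≤Q = m≤n*m (R * R) Γ
    w≤Q : w ≤ Q
    w≤Q = ≤-trans w≤R (≤-trans (m≤m*n R R) RR≤Q)
    P+w : P + w ≤ 3 * Q
    P+w = ≤-trans (+-monoʳ-≤ P w≤Q) (≤-reflexive (e Q))
      where
      e : ∀ Q → 2 * Q + Q ≡ 3 * Q
      e = solve-∀
    DD≤w : D * D ≤ w
    DD≤w = subst (D * D ≤_) (sym w≡) (m≤m*n (D * D) τ)
    D≤w : D ≤ w
    D≤w = ≤-trans (m≤m*n D D) DD≤w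
    DU : D * U ≤ 21 * (Q * w)
    DU = begin
      D * U
        ≡⟨ d₁ D w (P + w) R S ⟩
      D * w * w + 2 * (P + w) * (D * D) + 2 * (R * (S * D)) * (w + c) + 8 * (R * R) * D
        ≡⟨ cong (λ z → D * w * w + 2 * (P + w) * (D * D) + 2 * (R * z) * (w + c) + 8 * (R * R) * D) R≡SD ⟨
      D * w * w + 2 * (P + w) * (D * D) + 2 * (R * R) * (w + c) + 8 * (R * R) * D
        ≤⟨ +-mono-≤ (+-mono-≤ (+-mono-≤
             (*-monoˡ-≤ w (≤-trans (*-mono-≤ (≤-trans D≤w w≤R) w≤R) RR≤Q))
             (*-mono-≤ (*-monoʳ-≤ 2 P+w) DD≤w))
             (*-mono-≤ (*-monoʳ-≤ 2 RR≤Q) (+-monoʳ-≤ w (*-monoʳ-≤ 2 D≤w))))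
             (*-mono-≤ (*-monoʳ-≤ 8 RR≤Q) D≤w) ⟩
      Q * w + 2 * (3 * Q) * w + 2 * Q * (w + 2 * w) + 8 * Q * w
        ≡⟨ d₂ Q w ⟩
      21 * (Q * w) ∎
      where
      d₁ : ∀ D w p R S → D * (w * w + p * (2 * D) + 2 * R * S * (w + 2 * D) + 8 * R * R) ≡
        D * w * w + 2 * p * (D * D) + 2 * (R * (S * D)) * (w + 2 * D) + 8 * (R * R) * D
      d₁ = solve-∀
      d₂ : ∀ Q w → Q * w + 2 * (3 * Q) * w + 2 * Q * (w + 2 * w) + 8 * Q * w ≡ 21 * (Q * w)
      d₂ = solve-∀
    e₁ : ∀ D w R U k τ Q → D * (w * (2 * R * (2 * R * U) + 4 * R * (16 * R * (5 * D) * ((1 + k) * τ * (3 * Q))))) ≡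
      w * (4 * (R * R) * (D * U) + 960 * ((1 + k) * (R * R) * Q * (D * D * τ)))
    e₁ = solve-∀
    e₂ : ∀ w k R Γ → w * ((1 + k) * (4 * (R * R) * (21 * (Γ * (R * R) * w))) + 960 * ((1 + k) * (R * R) * (Γ * (R * R)) * w)) ≡
      1044 * (1 + k) * Γ * (w * w * (R * R * (R * R)))
    e₂ = solve-∀

  -- Chebyshev's inequality. The third premise is the sum of (B - μ)² ≥ μ² over the `H` points where
  -- B vanishes, expanded with the cross term moved to the left; there a lower bound for the first
  -- moment suffices.
  exceptions-bound : ∀ P R μ sB sBB H Err →
    P * μ ≤ sB + 2 * R * μ → sBB ≤ P * (μ * μ) + Err →
    μ * μ * H + 2 * μ * sB ≤ sBB + P * (μ * μ) → μ * μ * H ≤ Err + 4 * R * (μ * μ)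
  exceptions-bound P R μ sB sBB H Err first second third = +-cancelʳ-≤ (2 * P * (μ * μ)) _ _ (begin
    μ * μ * H + 2 * P * (μ * μ)                        ≡⟨ e₁ μ H P ⟩
    μ * μ * H + 2 * μ * (P * μ)                        ≤⟨ +-monoʳ-≤ (μ * μ * H) (*-monoʳ-≤ (2 * μ) first) ⟩
    μ * μ * H + 2 * μ * (sB + 2 * R * μ)               ≡⟨ e₂ μ H sB R ⟩
    (μ * μ * H + 2 * μ * sB) + 4 * R * (μ * μ)         ≤⟨ +-monoˡ-≤ (4 * R * (μ * μ)) third ⟩
    (sBB + P * (μ * μ)) + 4 * R * (μ * μ)              ≤⟨ +-monoˡ-≤ (4 * R * (μ * μ)) (+-monoˡ-≤ (P * (μ * μ)) second) ⟩
    ((P * (μ * μ) + Err) + P * (μ * μ)) + 4 * R * (μ * μ) ≡⟨ e₃ P (μ * μ) Err R ⟩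
    (Err + 4 * R * (μ * μ)) + 2 * P * (μ * μ)          ∎)
    where
    open ≤-Reasoning
    e₁ : ∀ μ H P → μ * μ * H + 2 * P * (μ * μ) ≡ μ * μ * H + 2 * μ * (P * μ)
    e₁ = solve-∀
    e₂ : ∀ μ H sB R → μ * μ * H + 2 * μ * (sB + 2 * R * μ) ≡ (μ * μ * H + 2 * μ * sB) + 4 * R * (μ * μ)
    e₂ = solve-∀
    e₃ : ∀ P M Err R → ((P * M + Err) + P * M) + 4 * R * M ≡ (Err + 4 * R * M) + 2 * P * M
    e₃ = solve-∀

  -- λ = τ⁴ balances the energy against the number H of exceptional y.
  exponents-clash : ∀ τ R D w C a F E H Err .{{_ : NonZero τ}} .{{_ : NonZero R}} .{{_ : NonZero w}} →
    let μ = w * a; τ² = τ * τ; τ⁴ = τ² * τ²; τ⁸ = τ⁴ * τ⁴ in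
    R ≤ τ * a → R * R ≤ τ² * F → E ≤ τ² * (R * R) →
    2 * τ⁴ * F ≤ E + τ⁴ * τ⁴ * H → μ * μ * H ≤ Err + 4 * R * (μ * μ) →
    8 * τ⁸ ≤ τ² * R → D * Err ≤ C * (w * w * (R * R * (R * R))) → D ≤ 2 * τ⁸ * C
  exponents-clash τ R D w C a F E H Err R≤ RR≤ E≤ balance exceptions R-large Err≤ =
    *-cancelʳ-≤ D (2 * τ⁸ * C) (w * w * (R * R * (R * R)))
      {{m*n≢0 (w * w) (R * R * (R * R)) {{m*n≢0 w w}} {{m*n≢0 (R * R) (R * R) {{m*n≢0 R R}} {{m*n≢0 R R}}}}}} (begin
    D * (w * w * (R * R * (R * R)))        ≤⟨ *-monoʳ-≤ D step₃ ⟩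
    D * (2 * τ⁸ * Err)                     ≡⟨ e₀ D τ⁸ Err ⟩
    2 * τ⁸ * (D * Err)                     ≤⟨ *-monoʳ-≤ (2 * τ⁸) Err≤ ⟩
    2 * τ⁸ * (C * (w * w * (R * R * (R * R)))) ≡⟨ *-assoc (2 * τ⁸) C _ ⟨
    2 * τ⁸ * C * (w * w * (R * R * (R * R))) ∎)
    where
    open ≤-Reasoning
    μ τ² τ⁴ τ⁸ X : ℕ
    μ  = w * a
    τ² = τ * τ
    τ⁴ = τ² * τ²
    τ⁸ = τ⁴ * τ⁴
    X  = μ * μ * (τ² * (R * R))
    e₀ : ∀ D t e → D * (2 * t * e) ≡ 2 * t * (D * e)
    e₀ = solve-∀
    step₁ : X ≤ τ⁸ * Err + μ * μ * (4 * R * τ⁸)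
    step₁ = +-cancelʳ-≤ X _ _ (begin
      X + X                                                ≡⟨ e₁ (μ * μ) τ² (R * R) ⟩
      μ * μ * (2 * τ² * (R * R))                           ≤⟨ *-monoʳ-≤ (μ * μ) (*-monoʳ-≤ (2 * τ²) RR≤) ⟩
      μ * μ * (2 * τ² * (τ² * F))                          ≡⟨ e₂ (μ * μ) τ² F ⟩
      μ * μ * (2 * τ⁴ * F)                                 ≤⟨ *-monoʳ-≤ (μ * μ) balance ⟩
      μ * μ * (E + τ⁸ * H)                                 ≡⟨ e₃ (μ * μ) E τ⁸ H ⟩
      μ * μ * E + τ⁸ * (μ * μ * H)                         ≤⟨ +-mono-≤ (*-monoʳ-≤ (μ * μ) E≤) (*-monoʳ-≤ τ⁸ exceptions) ⟩
      X + τ⁸ * (Err + 4 * R * (μ * μ))                     ≡⟨ e₄ X τ⁸ Err R (μ * μ) ⟩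
      (τ⁸ * Err + μ * μ * (4 * R * τ⁸)) + X                ∎)
      where
      e₁ : ∀ m t r → m * (t * r) + m * (t * r) ≡ m * (2 * t * r)
      e₁ = solve-∀
      e₂ : ∀ m t f → m * (2 * t * (t * f)) ≡ m * (2 * (t * t) * f)
      e₂ = solve-∀
      e₃ : ∀ m e t h → m * (e + t * h) ≡ m * e + t * (m * h)
      e₃ = solve-∀
      e₄ : ∀ x t e r m → x + t * (e + 4 * r * m) ≡ (t * e + m * (4 * r * t)) + x
      e₄ = solve-∀
    -- By `R-large`, the boundary term 4 R τ⁸ μ² left over from the first moment is at most half of
    -- `X`.
    step₂ : X ≤ 2 * τ⁸ * Err
    step₂ = +-cancelʳ-≤ X _ _ (begin
      X + X                                                            ≤⟨ +-mono-≤ step₁ step₁ ⟩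
      (τ⁸ * Err + μ * μ * (4 * R * τ⁸)) + (τ⁸ * Err + μ * μ * (4 * R * τ⁸)) ≡⟨ e₁ τ⁸ Err (μ * μ) R ⟩
      2 * τ⁸ * Err + μ * μ * (8 * τ⁸ * R)                              ≤⟨ +-monoʳ-≤ _ (*-monoʳ-≤ (μ * μ) (*-monoˡ-≤ R R-large)) ⟩
      2 * τ⁸ * Err + μ * μ * (τ² * R * R)                              ≡⟨ cong (λ z → 2 * τ⁸ * Err + μ * μ * z) (*-assoc τ² R R) ⟩
      2 * τ⁸ * Err + X                                                 ∎)
      where
      e₁ : ∀ t e m r → (t * e + m * (4 * r * t)) + (t * e + m * (4 * r * t)) ≡ 2 * t * e + m * (8 * t * r)
      e₁ = solve-∀
    step₃ : w * w * (R * R * (R * R)) ≤ 2 * τ⁸ * Err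
    step₃ = begin
      w * w * (R * R * (R * R))                  ≤⟨ *-monoʳ-≤ (w * w) (*-monoˡ-≤ (R * R) (*-mono-≤ R≤ R≤)) ⟩
      w * w * ((τ * a) * (τ * a) * (R * R))      ≡⟨ e₁ w τ a (R * R) ⟩
      X                                          ≤⟨ step₂ ⟩
      2 * τ⁸ * Err                               ∎
      where
      e₁ : ∀ w t a r → w * w * ((t * a) * (t * a) * r) ≡ (w * a) * (w * a) * ((t * t) * r)
      e₁ = solve-∀

  *-positive : ∀ x y → 0 < x * y → 0 < x × 0 < y
  *-positive (suc x) (suc y) _ = z<s , z<s
  *-positive (suc x) zero    p = ⊥-elim (<⇒≢ p (sym (*-zeroʳ x)))

  -- This is (B - μ)² ≥ μ² when B = 0, and (B - μ)² ≥ 0 otherwise, written with natural numbers.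
  deviation : ∀ {Q : Set} μ B (Q? : Dec Q) → (Q → B ≡ 0) → μ * μ * 𝟙 Q? + 2 * μ * B ≤ B * B + μ * μ
  deviation μ B (no  _) _ = ≤-trans (≤-reflexive (cong (_+ 2 * μ * B) (*-zeroʳ (μ * μ))))
    (≤-trans (2xy≤x²+y² μ B) (≤-reflexive (+-comm (μ * μ) (B * B))))
  deviation μ B (yes z) B≡0 with refl ← B≡0 z = ≤-reflexive
    (trans (cong₂ _+_ (*-identityʳ (μ * μ)) (*-zeroʳ (2 * μ))) (+-identityʳ (μ * μ)))

  -- A common quotient e ≥ q would give N < e q + q ≤ e (q + 1) ≤ e q′ ≤ N.
  quotient-injective-< : ∀ N q q′ .{{_ : NonZero q}} .{{_ : NonZero q′}} →
    q ≤ N / q′ → q < q′ → N / q ≢ N / q′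
  quotient-injective-< N q q′ q≤e q<q′ e≡ = <-irrefl refl (begin-strict
    N                      ≡⟨ m≡m%n+[m/n]*n N q ⟩
    N % q + N / q * q      <⟨ +-monoˡ-< (N / q * q) (m%n<n N q) ⟩
    q + N / q * q          ≡⟨ cong (λ e → q + e * q) e≡ ⟩
    q + N / q′ * q         ≤⟨ +-monoˡ-≤ (N / q′ * q) q≤e ⟩
    N / q′ + N / q′ * q    ≡⟨ *-suc (N / q′) q ⟨
    N / q′ * suc q         ≤⟨ *-monoʳ-≤ (N / q′) q<q′ ⟩
    N / q′ * q′            ≤⟨ m/n*n≤m N q′ ⟩
    N                      ∎)
    where open ≤-Reasoning

  quotient-large : ∀ N M q .{{_ : NonZero q}} → M * M ≤ N → q ≤ M → M ≤ N / q
  quotient-large N M q MM≤N q≤M =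
    subst (_≤ N / q) (m*n/n≡m M q) (/-monoˡ-≤ q (≤-trans (*-monoʳ-≤ M q≤M) MM≤N))

  quotient-injective : ∀ N M q q′ .{{_ : NonZero q}} .{{_ : NonZero q′}} →
    M * M ≤ N → q ≤ M → q′ ≤ M → N / q ≡ N / q′ → q ≡ q′
  quotient-injective N M q q′ MM≤N q≤M q′≤M e with <-cmp q q′
  ... | tri≈ _ q≡q′ _ = q≡q′
  ... | tri< q<q′ _ _ = ⊥-elim (quotient-injective-< N q q′ (≤-trans q≤M (quotient-large N M q′ MM≤N q′≤M)) q<q′ e)
  ... | tri> _ _ q′<q = ⊥-elim (quotient-injective-< N q′ q (≤-trans q′≤M (quotient-large N M q MM≤N q≤M)) q′<q (sym e))

  -- The points `y` and their multiplicities

  module Products (R N : ℕ) .{{_ : NonZero R}} (β γ : ℕ → ℕ) (β≤1 : ∀ i → β i ≤ 1) (γ≤1 : ∀ i → γ i ≤ 1) where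

    instance
      R+i≢0 : ∀ {i} → NonZero (R + i)
      R+i≢0 {i} = >-nonZero (≤-trans (>-nonZero⁻¹ R) (m≤m+n R i))

    q : ℕ → ℕ → ℕ
    q b c = (R + b) * (R + c)

    instance
      q≢0 : ∀ {b c} → NonZero (q b c)
      q≢0 {b} {c} = m*n≢0 (R + b) (R + c)

    y : ℕ → ℕ → ℕ
    y b c = suc (N / q b c)

    q≤ : ∀ {b c} → b ≤ R → c ≤ R → q b c ≤ 4 * (R * R)
    q≤ b≤R c≤R = ≤-trans (*-mono-≤ (+-monoʳ-≤ R b≤R) (+-monoʳ-≤ R c≤R)) (≤-reflexive (e R))
      where
      e : ∀ R → (R + R) * (R + R) ≡ 4 * (R * R)
      e = solve-∀

    f : ℕ → ℕ
    f z = ∑[ b < suc R ] ∑[ c < suc R ] β b * γ c * 𝟙 (y b c ≟ z)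

    f-total : ∀ P → (∀ b c → b ≤ R → c ≤ R → y b c < P) → ∑ (suc R) β * ∑ (suc R) γ ≤ ∑ P f
    f-total P y<P = begin
      ∑ (suc R) β * ∑ (suc R) γ
        ≡⟨ ∑-*-∑ (suc R) (suc R) β γ ⟩
      (∑[ b < suc R ] ∑[ c < suc R ] β b * γ c)
        ≤⟨ ∑-mono (suc R) (λ b b≤R → ∑-mono (suc R) (λ c c≤R → present b c (≤-pred b≤R) (≤-pred c≤R))) ⟩
      (∑[ b < suc R ] ∑[ c < suc R ] ∑[ z < P ] β b * γ c * 𝟙 (y b c ≟ z))
        ≤⟨ ∑₂-slice (suc R) (suc R) P (λ z b c → β b * γ c * 𝟙 (y b c ≟ z)) f (λ _ _ → ≤-refl) ⟩
      ∑ P f ∎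
      where
      open ≤-Reasoning
      present : ∀ b c → b ≤ R → c ≤ R → β b * γ c ≤ (∑[ z < P ] β b * γ c * 𝟙 (y b c ≟ z))
      present b c b≤R c≤R = begin
        β b * γ c                                ≡⟨ *-identityʳ _ ⟨
        β b * γ c * 1                            ≡⟨ cong (β b * γ c *_) (𝟙-true (y b c ≟ y b c) refl) ⟨
        β b * γ c * 𝟙 (y b c ≟ y b c)            ≤⟨ term≤∑ P (λ z → β b * γ c * 𝟙 (y b c ≟ z)) (y<P b c b≤R c≤R) ⟩
        (∑[ z < P ] β b * γ c * 𝟙 (y b c ≟ z))   ∎

    -- Products are at most 4 R², and (4 R²)² ≤ N makes the quotients of distinct products distinct.
    -- So two pairs share a point only if their products agree. This is the origin of the factor 16
    -- in the choice of scale.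
    f-energy : ∀ P → 16 * (R * R * (R * R)) ≤ N → (∑[ z < P ] f z * f z) ≤
      (∑[ b < suc R ] ∑[ b′ < suc R ] ∑[ c < suc R ] ∑[ c′ < suc R ] 𝟙 ((R + b) * (R + c) ≟ (R + b′) * (R + c′)))
    f-energy P R⁴≤N = begin
      (∑[ z < P ] f z * f z)
        ≡⟨ ∑-cong P (λ z _ → trans (∑-*-∑ (suc R) (suc R) (λ b → ∑[ c < suc R ] g z b c) (λ b → ∑[ c < suc R ] g z b c))
             (∑-cong (suc R) (λ b _ → ∑-cong (suc R) (λ b′ _ → ∑-*-∑ (suc R) (suc R) (g z b) (g z b′))))) ⟩
      (∑[ z < P ] ∑[ b < suc R ] ∑[ b′ < suc R ] ∑[ c < suc R ] ∑[ c′ < suc R ] g z b c * g z b′ c′)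
        ≡⟨ trans (∑-swap P (suc R) _) (∑-cong (suc R) (λ b _ → ∑-swap P (suc R) _)) ⟩
      (∑[ b < suc R ] ∑[ b′ < suc R ] ∑[ z < P ] ∑[ c < suc R ] ∑[ c′ < suc R ] g z b c * g z b′ c′)
        ≡⟨ ∑-cong (suc R) (λ b _ → ∑-cong (suc R) (λ b′ _ →
             trans (∑-swap P (suc R) _) (∑-cong (suc R) (λ c _ → ∑-swap P (suc R) _)))) ⟩
      (∑[ b < suc R ] ∑[ b′ < suc R ] ∑[ c < suc R ] ∑[ c′ < suc R ] ∑[ z < P ] g z b c * g z b′ c′)
        ≤⟨ ∑-mono (suc R) (λ b b≤R → ∑-mono (suc R) (λ b′ b′≤R → ∑-mono (suc R) (λ c c≤R → ∑-mono (suc R) (λ c′ c′≤R →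
             coincide b b′ c c′ (≤-pred b≤R) (≤-pred b′≤R) (≤-pred c≤R) (≤-pred c′≤R))))) ⟩
      (∑[ b < suc R ] ∑[ b′ < suc R ] ∑[ c < suc R ] ∑[ c′ < suc R ] 𝟙 ((R + b) * (R + c) ≟ (R + b′) * (R + c′))) ∎
      where
      open ≤-Reasoning
      g : ℕ → ℕ → ℕ → ℕ
      g z b c = β b * γ c * 𝟙 (y b c ≟ z)
      g≤ : ∀ z b c → g z b c ≤ 𝟙 (y b c ≟ z)
      g≤ z b c = ≤-trans (*-monoˡ-≤ _ (*-mono-≤ (β≤1 b) (γ≤1 c))) (≤-reflexive (*-identityˡ _))
      square : ∀ R → 4 * (R * R) * (4 * (R * R)) ≡ 16 * (R * R * (R * R))
      square = solve-∀
      module _ (b b′ c c′ : ℕ) (b≤R : b ≤ R) (b′≤R : b′ ≤ R) (c≤R : c ≤ R) (c′≤R : c′ ≤ R) where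
        same : ∀ z → y b c ≡ z × y b′ c′ ≡ z → y b c ≡ z × q b c ≡ q b′ c′
        same z (e , e′) = e , quotient-injective N (4 * (R * R)) (q b c) (q b′ c′)
          (≤-trans (≤-reflexive (square R)) R⁴≤N) (q≤ b≤R c≤R) (q≤ b′≤R c′≤R) (suc-injective (trans e (sym e′)))
        coincide : (∑[ z < P ] g z b c * g z b′ c′) ≤ 𝟙 (q b c ≟ q b′ c′)
        coincide = begin
          (∑[ z < P ] g z b c * g z b′ c′)
            ≤⟨ ∑-mono P (λ z _ → ≤-trans (*-mono-≤ (g≤ z b c) (g≤ z b′ c′)) (≤-trans
                 (≤-reflexive (𝟙-× (y b c ≟ z) (y b′ c′ ≟ z)))
                 (≤-trans (𝟙-mono ((y b c ≟ z) ×-dec (y b′ c′ ≟ z)) ((y b c ≟ z) ×-dec (q b c ≟ q b′ c′)) (same z))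
                   (≤-reflexive (sym (𝟙-× (y b c ≟ z) (q b c ≟ q b′ c′))))))) ⟩
          (∑[ z < P ] 𝟙 (y b c ≟ z) * 𝟙 (q b c ≟ q b′ c′))
            ≡⟨ ∑-*ʳ P (𝟙 (q b c ≟ q b′ c′)) _ ⟩
          (∑[ z < P ] 𝟙 (y b c ≟ z)) * 𝟙 (q b c ≟ q b′ c′)
            ≤⟨ *-monoˡ-≤ _ (∑-at-most-one P _ (λ z _ → 𝟙≤1 (y b c ≟ z))
                 (λ z z′ _ _ p p′ → trans (sym (𝟙-positive (y b c ≟ z) p)) (𝟙-positive (y b c ≟ z′) p′))) ⟩
          1 * 𝟙 (q b c ≟ q b′ c′)
            ≡⟨ *-identityˡ _ ⟩
          𝟙 (q b c ≟ q b′ c′) ∎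

  -- The contradiction between energy and variance

  module Core
    (τ k₁ k₂ R S D w Γ N : ℕ) .{{_ : NonZero τ}} .{{_ : NonZero R}} .{{_ : NonZero S}} .{{_ : NonZero D}}
    (α β γ : ℕ → ℕ) (α≤1 : ∀ i → α i ≤ 1) (β≤1 : ∀ i → β i ≤ 1) (γ≤1 : ∀ i → γ i ≤ 1)
    (R≤α : R ≤ τ * ∑ (suc R) α) (R≤β : R ≤ τ * ∑ (suc R) β) (R≤γ : R ≤ τ * ∑ (suc R) γ)
    (R≡SD : R ≡ S * D) (S≡ : S ≡ τ ^ k₁) (w≡ : w ≡ D * D * τ) (w≤R : w ≤ R) (3R≤ : 3 * R ≤ τ ^ k₂)
    (Γ≥2 : 2 ≤ Γ) (N≥ : 16 * (R * R * (R * R)) ≤ N) (N≤ : N ≤ Γ * (R * R * (R * R)))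
    (τ-large : 16 * (4 + k₂) ≤ τ)
    (R-large : 8 * (τ * τ * (τ * τ) * (τ * τ * (τ * τ))) ≤ τ * τ * R)
    (D-large : 2 * (τ * τ * (τ * τ) * (τ * τ * (τ * τ))) * (1044 * suc k₁ * Γ) < D)
    where

    private
      -- Every quotient `N / q b c` is at most Γ R²; doubling makes room for the successor in `y`.
      P : ℕ
      P = 2 * (Γ * (R * R))

      instance
        Γ≢0 : NonZero Γ
        Γ≢0 = >-nonZero (≤-trans (s≤s z≤n) Γ≥2)
        w≢0 : NonZero w
        w≢0 = subst NonZero (sym w≡) (m*n≢0 (D * D) τ {{m*n≢0 D D}})

      open Products R N β γ β≤1 γ≤1
      open Moments R S D P w R≡SD α α≤1

      y<P : ∀ b c → b ≤ R → c ≤ R → y b c < P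
      y<P b c _ _ = begin-strict
        suc (N / q b c)              ≤⟨ s≤s (begin
          N / q b c                     ≤⟨ /-mono-≤ N≤ (*-mono-≤ (m≤m+n R b) (m≤m+n R c)) ⟩
          Γ * (R * R * (R * R)) / (R * R) ≡⟨ cong (_/ (R * R)) (*-assoc Γ (R * R) (R * R)) ⟨
          Γ * (R * R) * (R * R) / (R * R) ≡⟨ m*n/n≡m (Γ * (R * R)) (R * R) ⟩
          Γ * (R * R)                   ∎) ⟩
        suc (Γ * (R * R))            <⟨ +-monoˡ-< (Γ * (R * R)) (≤-trans Γ≥2 (m≤m*n Γ (R * R))) ⟩
        Γ * (R * R) + Γ * (R * R)    ≡⟨ cong (Γ * (R * R) +_) (+-identityʳ (Γ * (R * R))) ⟨
        P                            ∎
        where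
        open ≤-Reasoning
        instance
          RR≢0 : NonZero (R * R)
          RR≢0 = m*n≢0 R R

      harmonic : (∑[ e < S ] (P + w) / suc e) ≤ suc (k₁ * τ) * (P + w)
      harmonic = subst (λ n → (∑[ e < n ] (P + w) / suc e) ≤ suc (k₁ * τ) * (P + w)) (sym S≡) (harmonic-sum τ k₁ (P + w))

      energy≤ : (∑[ z < P ] f z * f z) ≤ τ * τ * (R * R)
      energy≤ = begin
        (∑[ z < P ] f z * f z)                ≤⟨ f-energy P N≥ ⟩
        _                                     ≤⟨ product-energy R τ k₂ 3R≤ ⟩
        16 * R * (3 * R + suc (k₂ * τ) * R)   ≡⟨ e₁ R k₂ τ ⟩
        16 * (4 + k₂ * τ) * (R * R)           ≤⟨ *-monoˡ-≤ (R * R) (*-monoʳ-≤ 16 (+-monoˡ-≤ (k₂ * τ) (m≤m*n 4 τ))) ⟩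
        16 * (4 * τ + k₂ * τ) * (R * R)       ≡⟨ e₂ k₂ τ R ⟩
        16 * (4 + k₂) * τ * (R * R)           ≤⟨ *-monoˡ-≤ (R * R) (*-monoˡ-≤ τ τ-large) ⟩
        τ * τ * (R * R)                       ∎
        where
        open ≤-Reasoning
        e₁ : ∀ R k τ → 16 * R * (3 * R + (1 + k * τ) * R) ≡ 16 * (4 + k * τ) * (R * R)
        e₁ = solve-∀
        e₂ : ∀ k τ R → 16 * (4 * τ + k * τ) * (R * R) ≡ 16 * (4 + k) * τ * (R * R)
        e₂ = solve-∀

      -- Vanishes exactly when every `y b c` of positive weight is exceptional, so that the
      -- contradiction can start from the decidable equation `hit ≡ 0`.
      hit : ℕ
      hit = ∑[ b < suc R ] ∑[ c < suc R ] β b * γ c * B (y b c)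

      module _ (hit≡0 : hit ≡ 0) where

        missed : ∀ z → 0 < f z → B z ≡ 0
        missed z fz>0 with b , b≤R , p ← ∑-positive (suc R) (λ b → ∑[ c < suc R ] β b * γ c * 𝟙 (y b c ≟ z)) fz>0
                      with c , c≤R , p′ ← ∑-positive (suc R) (λ c → β b * γ c * 𝟙 (y b c ≟ z)) p
                      with βγ>0 , e>0 ← *-positive (β b * γ c) (𝟙 (y b c ≟ z)) p′
          = n≤0⇒n≡0 (begin
            B z                                           ≡⟨ cong B (𝟙-positive (y b c ≟ z) e>0) ⟨
            B (y b c)                                     ≤⟨ m≤n*m (B (y b c)) (β b * γ c) {{>-nonZero βγ>0}} ⟩
            β b * γ c * B (y b c)                         ≤⟨ term≤∑ (suc R) (λ c → β b * γ c * B (y b c)) c≤R ⟩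
            (∑[ c < suc R ] β b * γ c * B (y b c))        ≤⟨ term≤∑ (suc R) (λ b → ∑[ c < suc R ] β b * γ c * B (y b c)) b≤R ⟩
            hit                                           ≡⟨ hit≡0 ⟩
            0                                             ∎)
          where open ≤-Reasoning

        h : ℕ → ℕ
        h z = 𝟙 (0 <? f z)

        -- Summed over `z`, this is Cauchy-Schwarz for the support of `f` in linear form, with `ν`
        -- still free.
        f≤ : ∀ ν z → 2 * ν * f z ≤ f z * f z + ν * ν * h z
        f≤ ν z with f z
        ... | zero  = ≤-trans (≤-reflexive (*-zeroʳ (2 * ν))) z≤n
        ... | suc x = ≤-trans (2xy≤x²+y² ν (suc x)) (≤-reflexive
          (trans (+-comm (ν * ν) (suc x * suc x)) (cong (suc x * suc x +_) (sym (*-identityʳ (ν * ν))))))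

        variance : ∀ z → μ * μ * h z + 2 * μ * B z ≤ B z * B z + μ * μ
        variance z = deviation μ (B z) (0 <? f z) (missed z)

        balance : ∀ ν → 2 * ν * (∑ (suc R) β * ∑ (suc R) γ) ≤ (∑[ z < P ] f z * f z) + ν * ν * ∑ P h
        balance ν = begin
          2 * ν * (∑ (suc R) β * ∑ (suc R) γ)            ≤⟨ *-monoʳ-≤ (2 * ν) (f-total P y<P) ⟩
          2 * ν * ∑ P f                                  ≡⟨ ∑-*ˡ P (2 * ν) f ⟨
          (∑[ z < P ] 2 * ν * f z)                       ≤⟨ ∑-mono P (λ z _ → f≤ ν z) ⟩
          (∑[ z < P ] f z * f z + ν * ν * h z)           ≡⟨ trans (∑-+ P _ _) (cong ((∑[ z < P ] f z * f z) +_) (∑-*ˡ P (ν * ν) h)) ⟩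
          (∑[ z < P ] f z * f z) + ν * ν * ∑ P h         ∎
          where open ≤-Reasoning

        variance-sum : μ * μ * ∑ P h + 2 * μ * ∑ P B ≤ (∑[ z < P ] B z * B z) + P * (μ * μ)
        variance-sum = begin
          μ * μ * ∑ P h + 2 * μ * ∑ P B             ≡⟨ cong₂ _+_ (∑-*ˡ P (μ * μ) h) (∑-*ˡ P (2 * μ) B) ⟨
          (∑[ z < P ] μ * μ * h z) + (∑[ z < P ] 2 * μ * B z) ≡⟨ ∑-+ P _ _ ⟨
          (∑[ z < P ] μ * μ * h z + 2 * μ * B z)    ≤⟨ ∑-mono P (λ z _ → variance z) ⟩
          (∑[ z < P ] B z * B z + μ * μ)            ≡⟨ trans (∑-+ P _ _) (cong ((∑[ z < P ] B z * B z) +_) (∑-const P (μ * μ))) ⟩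
          (∑[ z < P ] B z * B z) + P * (μ * μ)      ∎
          where open ≤-Reasoning

        absurd : ⊥
        absurd = <⇒≱ D-large (exponents-clash τ R D w (1044 * suc k₁ * Γ) ∣α∣ _ _ (∑ P h) _
          R≤α RR≤ energy≤ (balance (τ * τ * (τ * τ)))
          (exceptions-bound P R μ (∑ P B) _ (∑ P h) _ first-moment second-moment variance-sum)
          R-large (error-bound R S D w τ k₁ Γ _ R≡SD w≡ w≤R harmonic))
          where
          e : ∀ τ x y → (τ * x) * (τ * y) ≡ τ * τ * (x * y)
          e = solve-∀
          RR≤ : R * R ≤ τ * τ * (∑ (suc R) β * ∑ (suc R) γ)
          RR≤ = ≤-trans (*-mono-≤ R≤β R≤γ) (≤-reflexive (e τ (∑ (suc R) β) (∑ (suc R) γ)))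

    product-in-interval : ∃ λ i → ∃ λ b → ∃ λ c → ∃ λ m →
      (i ≤ R × b ≤ R × c ≤ R) × (0 < α i × 0 < β b × 0 < γ c) ×
      N ≤ m * (R + i) * (R + b) * (R + c) × m * (R + i) * (R + b) * (R + c) ≤ N + 4 * (R * R) * w
    product-in-interval with hit ≟ 0
    ... | yes hit≡0 = ⊥-elim (absurd hit≡0)
    ... | no  hit≢0
      with b , b≤R , p ← ∑-positive (suc R) (λ b → ∑[ c < suc R ] β b * γ c * B (y b c)) (n≢0⇒n>0 hit≢0)
      with c , c≤R , p′ ← ∑-positive (suc R) (λ c → β b * γ c * B (y b c)) p
      with βγ>0 , B>0 ← *-positive (β b * γ c) (B (y b c)) p′
      with β>0 , γ>0 ← *-positive (β b) (γ c) βγ>0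
      with i , i≤R , p″ ← ∑-positive (suc R) (λ i → α i * ((R + i) * hits i (y b c))) B>0
      with α>0 , ah>0 ← *-positive (α i) ((R + i) * hits i (y b c)) p″
      with _ , h>0 ← *-positive (R + i) (hits i (y b c)) ah>0
      with j , j<w , d>0 ← ∑-positive w (λ j → 𝟙 (R + i ∣? y b c + j)) h>0
      with divides m y+j≡ ← 𝟙-positive (R + i ∣? y b c + j) d>0
      = i , b , c , m , (≤-pred i≤R , ≤-pred b≤R , ≤-pred c≤R) , (α>0 , β>0 , γ>0) ,
        subst (N ≤_) (sym product) lower , subst (_≤ N + 4 * (R * R) * w) (sym product) upper
      where
      open ≤-Reasoning
      Q : ℕ
      Q = q b c
      product : m * (R + i) * (R + b) * (R + c) ≡ (y b c + j) * Q
      product = trans (*-assoc (m * (R + i)) (R + b) (R + c)) (cong (_* Q) (sym y+j≡))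
      lower : N ≤ (y b c + j) * Q
      lower = begin
        N                     ≡⟨ m≡m%n+[m/n]*n N Q ⟩
        N % Q + N / Q * Q     ≤⟨ +-monoˡ-≤ (N / Q * Q) (m%n≤n N Q) ⟩
        y b c * Q             ≤⟨ *-monoˡ-≤ Q (m≤m+n (y b c) j) ⟩
        (y b c + j) * Q       ∎
      upper : (y b c + j) * Q ≤ N + 4 * (R * R) * w
      upper = begin
        -- The unit by which `y b c` exceeds `N / Q` joins `j < w` to form `suc j ≤ w`, so rounding
        -- up stays within `Q * w`.
        (suc (N / Q) + j) * Q        ≡⟨ e (N / Q) j Q ⟩
        N / Q * Q + Q * suc j        ≤⟨ +-mono-≤ (m/n*n≤m N Q) (*-mono-≤ (q≤ (≤-pred b≤R) (≤-pred c≤R)) j<w) ⟩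
        N + 4 * (R * R) * w          ∎
        where
        e : ∀ x j Q → ((1 + x) + j) * Q ≡ x * Q + Q * (1 + j)
        e = solve-∀

  -- Choice of parameters

  -- The sequences are arbitrary predicates, without a decision procedure for membership. The
  -- weights handed to the arithmetic are therefore the indicators of the finite lists that witness
  -- density.
  multiplicity : List ℕ → ℕ → ℕ
  multiplicity []      a = 0
  multiplicity (x ∷ L) a = 𝟙 (x ≟ a) + multiplicity L a

  multiplicity-positive : ∀ {Q : ℕ → Set} L {a} → All Q L → 0 < multiplicity L a → Q a
  multiplicity-positive (x ∷ L) {a} (qx ∷ qL) pos with x ≟ a
  ... | yes refl = qx
  ... | no  _    = multiplicity-positive L qL pos

  multiplicity≤1 : ∀ L → Unique L → ∀ a → multiplicity L a ≤ 1
  multiplicity≤1 []      _          a = z≤n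
  multiplicity≤1 (x ∷ L) (x∉L ∷ uL) a with x ≟ a
  ... | no  _    = multiplicity≤1 L uL a
  ... | yes refl = s≤s (≮⇒≥ λ pos → multiplicity-positive L x∉L pos refl)

  length≤multiplicities : ∀ R L → All (λ n → R ≤ n × n ≤ 2 * R) L →
    length L ≤ (∑[ i < suc R ] multiplicity L (R + i))
  length≤multiplicities R []      _ = z≤n
  length≤multiplicities R (x ∷ L) ((R≤x , x≤2R) ∷ rest) = begin
    1 + length L
      ≤⟨ +-mono-≤ present (length≤multiplicities R L rest) ⟩
    (∑[ i < suc R ] 𝟙 (x ≟ R + i)) + (∑[ i < suc R ] multiplicity L (R + i))
      ≡⟨ ∑-+ (suc R) _ _ ⟨
    (∑[ i < suc R ] multiplicity (x ∷ L) (R + i)) ∎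
    where
    open ≤-Reasoning
    x∸R≤R : x ∸ R ≤ R
    x∸R≤R = ≤-trans (∸-monoˡ-≤ R x≤2R) (≤-reflexive (trans (m+n∸m≡n R (R + 0)) (+-identityʳ R)))
    present : 1 ≤ (∑[ i < suc R ] 𝟙 (x ≟ R + i))
    present = ≤-trans (≤-reflexive (sym (𝟙-true (x ≟ R + (x ∸ R)) (sym (m+[n∸m]≡n R≤x)))))
      (term≤∑ (suc R) (λ i → 𝟙 (x ≟ R + i)) (s≤s x∸R≤R))

  -- Search upwards from `τ₀` for the first crossing of `N`; growth of `g` at least as fast as the
  -- identity bounds the search.
  bracket : ∀ (g : ℕ → ℕ) → (∀ t → t ≤ g t) → ∀ τ₀ N → g τ₀ ≤ N → ∃ λ τ → τ₀ ≤ τ × g τ ≤ N × N < g (suc τ)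
  bracket g t≤g τ₀ N = search (suc N) τ₀ (≤-trans (m≤m+n (suc N) τ₀) (t≤g (suc N + τ₀)))
    where
    search : ∀ d t → N < g (d + t) → g t ≤ N → ∃ λ τ → t ≤ τ × g τ ≤ N × N < g (suc τ)
    search zero    t N<g g≤N = ⊥-elim (<⇒≱ N<g g≤N)
    search (suc d) t N<g g≤N with N <? g (suc t)
    ... | yes N<g′ = t , ≤-refl , g≤N , N<g′
    ... | no  N≮g′ with τ , t<τ , r ← search d (suc t) (subst (λ z → N < g z) (sym (+-suc d t)) N<g) (≮⇒≥ N≮g′)
      = τ , <⇒≤ t<τ , r

  *-^ : ∀ x y k → (x * y) ^ k ≡ x ^ k * y ^ k
  *-^ x y zero    = refl
  *-^ x y (suc k) = trans (cong (x * y *_) (*-^ x y k)) (e x y (x ^ k) (y ^ k))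
    where
    e : ∀ x y u v → x * y * (u * v) ≡ x * u * (y * v)
    e = solve-∀

  n≤n^k : ∀ n k .{{_ : NonZero k}} → n ≤ n ^ k
  n≤n^k zero      (suc k) = z≤n
  n≤n^k n@(suc _) (suc k) = m≤m*n n (n ^ k) {{m^n≢0 n k}}

  -- With R = τᵃ, taking 2a-th roots in the hypothesis gives k ≥ R / (e τ^(1/2)). Half a power of τ
  -- is lost to the density exponent, and the other half absorbs `e`.
  density-exponent : ∀ a e k τ .{{_ : NonZero a}} → e * e < τ →
    (τ ^ a) ^ (a + a) ≤ e ^ (a + a) * (k ^ (a + a) * τ ^ a) → τ ^ a ≤ τ * k
  density-exponent a e k τ ee<τ dense = ≮⇒≥ λ τk<R → <⇒≱ (^-monoˡ-< a ee<τ) (*-cancelʳ-≤ (τ ^ a) ((e * e) ^ a) R (begin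
    τ ^ a * R                 ≡⟨ ^-distribˡ-+-* τ a a ⟨
    τ ^ n                     ≤⟨ *-cancelʳ-≤ (τ ^ n) (e ^ n * R) (R ^ n) {{m^n≢0 R n}} (begin
      τ ^ n * R ^ n                   ≤⟨ *-monoʳ-≤ (τ ^ n) dense ⟩
      τ ^ n * (e ^ n * (k ^ n * R))   ≡⟨ e₁ (τ ^ n) (e ^ n) (k ^ n) R ⟩
      e ^ n * R * (τ ^ n * k ^ n)     ≡⟨ cong (e ^ n * R *_) (*-^ τ k n) ⟨
      e ^ n * R * (τ * k) ^ n         ≤⟨ *-monoʳ-≤ (e ^ n * R) (^-monoˡ-≤ n (<⇒≤ τk<R)) ⟩
      e ^ n * R * R ^ n               ∎) ⟩
    e ^ n * R                 ≡⟨ cong (_* R) (trans (^-distribˡ-+-* e a a) (sym (*-^ e e a))) ⟩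
    (e * e) ^ a * R           ∎))
    where
    open ≤-Reasoning
    R n : ℕ
    R = τ ^ a
    n = a + a
    instance
      τ≢0 : NonZero τ
      τ≢0 = >-nonZero (≤-trans (s≤s z≤n) ee<τ)
      R≢0 : NonZero R
      R≢0 = m^n≢0 τ a
    e₁ : ∀ t e k R → t * (e * (k * R)) ≡ e * R * (t * k)
    e₁ = solve-∀

  fourth : ℕ → ℕ
  fourth R = R * R * (R * R)

  -- The bounds come from the exponents in `S ≡ τ ^ 40` and `3 * R ≤ τ ^ 51`: 880 = 16 * (4 + 51)
  -- serves the energy, and 41 = 40 + 1 enters the error of the second moment.
  module Parameters (τ Γ : ℕ) (880≤τ : 880 ≤ τ) (Γ<τ : 2 * (1044 * 41 * Γ) < τ) (Γ≥2 : 2 ≤ Γ) where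

    instance
      τ≢0 : NonZero τ
      τ≢0 = >-nonZero (≤-trans (s≤s z≤n) 880≤τ)

    R S D w : ℕ
    R = τ ^ 50
    S = τ ^ 40
    D = τ ^ 10
    w = D * D * τ

    instance
      R≢0 : NonZero R
      R≢0 = m^n≢0 τ 50
      S≢0 : NonZero S
      S≢0 = m^n≢0 τ 40
      D≢0 : NonZero D
      D≢0 = m^n≢0 τ 10

    w≡τ²¹ : w ≡ τ ^ 21
    w≡τ²¹ = trans (cong₂ _*_ (sym (^-distribˡ-+-* τ 10 10)) (sym (*-identityʳ τ))) (sym (^-distribˡ-+-* τ 20 1))

    w≤R : w ≤ R
    w≤R = subst (_≤ R) (sym w≡τ²¹) (^-monoʳ-≤ τ {21} {50} (m≤m+n 21 29))

    small≤τ : ∀ {n} → n ≤ 880 → n ≤ τ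
    small≤τ n≤ = ≤-trans n≤ 880≤τ

    τ⁸≡ : τ * τ * (τ * τ) * (τ * τ * (τ * τ)) ≡ τ ^ 8
    τ⁸≡ = trans (cong₂ _*_ q q) (sym (^-distribˡ-+-* τ 4 4))
      where
      sq : τ * τ ≡ τ ^ 2
      sq = cong (τ *_) (sym (*-identityʳ τ))
      q : τ * τ * (τ * τ) ≡ τ ^ 4
      q = trans (cong₂ _*_ sq sq) (sym (^-distribˡ-+-* τ 2 2))

    R-large : 8 * (τ * τ * (τ * τ) * (τ * τ * (τ * τ))) ≤ τ * τ * R
    R-large = begin
      8 * (τ * τ * (τ * τ) * (τ * τ * (τ * τ)))  ≡⟨ cong (8 *_) τ⁸≡ ⟩
      8 * τ ^ 8                                  ≤⟨ *-mono-≤ (≤-trans (small≤τ (m≤m+n 8 872)) (m≤m*n τ τ)) (^-monoʳ-≤ τ {8} {50} (m≤m+n 8 42)) ⟩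
      τ * τ * R                                  ∎
      where open ≤-Reasoning

    D-large : 2 * (τ * τ * (τ * τ) * (τ * τ * (τ * τ))) * (1044 * 41 * Γ) < D
    D-large = begin-strict
      2 * (τ * τ * (τ * τ) * (τ * τ * (τ * τ))) * (1044 * 41 * Γ) ≡⟨ cong (λ z → 2 * z * (1044 * 41 * Γ)) τ⁸≡ ⟩
      2 * τ ^ 8 * (1044 * 41 * Γ)  ≡⟨ e (τ ^ 8) (1044 * 41 * Γ) ⟩
      2 * (1044 * 41 * Γ) * τ ^ 8  <⟨ *-monoˡ-< (τ ^ 8) {{m^n≢0 τ 8}} Γ<τ ⟩
      τ * τ ^ 8                    ≤⟨ ^-monoʳ-≤ τ {9} {10} (m≤m+n 9 1) ⟩
      D                            ∎
      where
      open ≤-Reasoning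
      e : ∀ t c → 2 * t * c ≡ 2 * c * t
      e = solve-∀

    3R≤ : 3 * R ≤ τ ^ 51
    3R≤ = *-monoˡ-≤ R (small≤τ (m≤m+n 3 877))

    width : suc (4 * (R * R) * w) ≤ τ ^ 122
    width = begin
      suc (4 * (R * R) * w)          ≤⟨ +-monoˡ-≤ (4 * (R * R) * w) (>-nonZero⁻¹ (R * R * w)) ⟩
      R * R * w + 4 * (R * R) * w    ≡⟨ e (R * R) w ⟩
      5 * (R * R * w)                ≤⟨ *-monoˡ-≤ (R * R * w) (small≤τ (m≤m+n 5 875)) ⟩
      τ * (R * R * w)                ≡⟨ cong (τ *_) (cong₂ _*_ (sym (^-distribˡ-+-* τ 50 50)) w≡τ²¹) ⟩
      τ * (τ ^ 100 * τ ^ 21)         ≡⟨ cong (τ *_) (^-distribˡ-+-* τ 100 21) ⟨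
      τ ^ 122                        ∎
      where
      open ≤-Reasoning
      instance
        RRw≢0 : NonZero (R * R * w)
        RRw≢0 = m*n≢0 (R * R) w {{m*n≢0 R R}} {{m*n≢0 (D * D) τ {{m*n≢0 D D}}}}
      e : ∀ r w → r * w + 4 * r * w ≡ 5 * (r * w)
      e = solve-∀

    fourth≡ : fourth R ≡ τ ^ 200
    fourth≡ = trans (cong₂ _*_ sq sq) (sym (^-distribˡ-+-* τ 100 100))
      where
      sq : R * R ≡ τ ^ 100
      sq = sym (^-distribˡ-+-* τ 50 50)

    -- Raising to the power 55 q clears the denominators of 34 / 55 + p / q. In powers of `τ` the
    -- claim rests on 122 * 55 + 90 = 200 * 34.
    width-exponent : ∀ p q → suc (4 * (R * R) * w) ^ (55 * q) ≤ fourth R ^ (34 * q + 55 * p)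
    width-exponent p q = begin
      suc (4 * (R * R) * w) ^ (55 * q)   ≤⟨ ^-monoˡ-≤ (55 * q) width ⟩
      (τ ^ 122) ^ (55 * q)               ≡⟨ ^-*-assoc τ 122 (55 * q) ⟩
      τ ^ (122 * (55 * q))               ≤⟨ ^-monoʳ-≤ τ {122 * (55 * q)} {200 * (34 * q + 55 * p)} (≤-trans (m≤m+n (122 * (55 * q)) (90 * q + 11000 * p)) (≤-reflexive (e p q))) ⟩
      τ ^ (200 * (34 * q + 55 * p))      ≡⟨ ^-*-assoc τ 200 (34 * q + 55 * p) ⟨
      (τ ^ 200) ^ (34 * q + 55 * p)      ≡⟨ cong (_^ (34 * q + 55 * p)) fourth≡ ⟨
      fourth R ^ (34 * q + 55 * p)       ∎
      where
      open ≤-Reasoning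
      e : ∀ p q → 122 * (55 * q) + (90 * q + 11000 * p) ≡ 200 * (34 * q + 55 * p)
      e = solve-∀

    module _ (N : ℕ) (N≥ : 16 * fourth R ≤ N) (N≤ : N ≤ Γ * fourth R) where

      product-near : ∀ (α β γ : ℕ → ℕ) → (∀ i → α i ≤ 1) → (∀ i → β i ≤ 1) → (∀ i → γ i ≤ 1) →
        R ≤ τ * ∑ (suc R) α → R ≤ τ * ∑ (suc R) β → R ≤ τ * ∑ (suc R) γ →
        ∃ λ i → ∃ λ b → ∃ λ c → ∃ λ m →
          (i ≤ R × b ≤ R × c ≤ R) × (0 < α i × 0 < β b × 0 < γ c) ×
          N ≤ m * (R + i) * (R + b) * (R + c) × m * (R + i) * (R + b) * (R + c) ≤ N + 4 * (R * R) * w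
      product-near α β γ α≤1 β≤1 γ≤1 R≤α R≤β R≤γ = Core.product-in-interval
        τ 40 51 R S D w Γ N α β γ α≤1 β≤1 γ≤1 R≤α R≤β R≤γ
        (^-distribˡ-+-* τ 40 10) refl refl w≤R 3R≤ Γ≥2 N≥ N≤ 880≤τ R-large D-large

      -- The product has the order R⁴ and three factors in [R , 2R], so the fourth has order R. The
      -- 4 added to `Γ` absorbs the interval length, as w ≤ R².
      cofactor-bounds : ∀ m i b c → i ≤ R → b ≤ R → c ≤ R →
        N ≤ m * (R + i) * (R + b) * (R + c) → m * (R + i) * (R + b) * (R + c) ≤ N + 4 * (R * R) * w →
        R ≤ m × m ≤ (Γ + 4) * R
      cofactor-bounds m i b c i≤R b≤R c≤R lower upper = *-cancelʳ-≤ R m (8 * (R * R * R)) (begin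
          R * (8 * (R * R * R))                  ≡⟨ e₁ R ⟩
          8 * fourth R                           ≤⟨ *-monoˡ-≤ (fourth R) (m≤m+n 8 8) ⟩
          16 * fourth R                          ≤⟨ N≥ ⟩
          N                                      ≤⟨ lower ⟩
          m * (R + i) * (R + b) * (R + c)        ≤⟨ *-mono-≤ (*-mono-≤ (*-monoʳ-≤ m (+-monoʳ-≤ R i≤R)) (+-monoʳ-≤ R b≤R)) (+-monoʳ-≤ R c≤R) ⟩
          m * (R + R) * (R + R) * (R + R)        ≡⟨ e₂ m R ⟩
          m * (8 * (R * R * R))                  ∎) ,
        *-cancelʳ-≤ m ((Γ + 4) * R) (R * R * R) (begin
          m * (R * R * R)                        ≡⟨ e₃ m R ⟩
          m * R * R * R                          ≤⟨ *-mono-≤ (*-mono-≤ (*-monoʳ-≤ m (m≤m+n R i)) (m≤m+n R b)) (m≤m+n R c) ⟩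
          m * (R + i) * (R + b) * (R + c)        ≤⟨ upper ⟩
          N + 4 * (R * R) * w                    ≤⟨ +-mono-≤ N≤ (*-monoʳ-≤ (4 * (R * R)) (≤-trans w≤R (m≤m*n R R))) ⟩
          Γ * fourth R + 4 * (R * R) * (R * R)   ≡⟨ e₄ Γ R ⟩
          (Γ + 4) * R * (R * R * R)              ∎)
        where
        open ≤-Reasoning
        instance
          R³≢0 : NonZero (R * R * R)
          R³≢0 = m*n≢0 (R * R) R {{m*n≢0 R R}}
          8R³≢0 : NonZero (8 * (R * R * R))
          8R³≢0 = m*n≢0 8 (R * R * R)
        e₁ : ∀ R → R * (8 * (R * R * R)) ≡ 8 * (R * R * (R * R))
        e₁ = solve-∀
        e₂ : ∀ m R → m * (R + R) * (R + R) * (R + R) ≡ m * (8 * (R * R * R))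
        e₂ = solve-∀
        e₃ : ∀ m R → m * (R * R * R) ≡ m * R * R * R
        e₃ = solve-∀
        e₄ : ∀ g R → g * (R * R * (R * R)) + 4 * (R * R) * (R * R) ≡ (g + 4) * R * (R * R * R)
        e₄ = solve-∀

  fourth-mono : ∀ {x y} → x ≤ y → fourth x ≤ fourth y
  fourth-mono x≤y = *-mono-≤ (*-mono-≤ x≤y x≤y) (*-mono-≤ x≤y x≤y)

  n≤fourth : ∀ n → n ≤ fourth n
  n≤fourth zero    = z≤n
  n≤fourth n@(suc _) = ≤-trans (m≤m*n n n) (m≤m*n (n * n) (n * n))

  -- An integer substitute for taking the root N^(1/(4k)), accurate up to the constant `Γ`.
  Scaling : ℕ → ℕ → Set
  Scaling k Γ = ∀ τ₀ → 0 < τ₀ → ∃ λ N₀ → ∀ N → N₀ ≤ N →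
    ∃ λ τ → τ₀ ≤ τ × 16 * fourth (τ ^ k) ≤ N × N ≤ Γ * fourth (τ ^ k)

  -- Since suc τ ≤ 2 τ, consecutive scales differ at most by the factor (2ᵏ)⁴, whatever `τ` is.
  scaling : ∀ k .{{_ : NonZero k}} → ∃ λ Γ → 2 ≤ Γ × Scaling k Γ
  scaling k = Γ , *-mono-≤ {2} {16} (m≤m+n 2 14) (≤-trans (m^n>0 2 k) (n≤fourth (2 ^ k))) , λ τ₀ τ₀>0 →
    scale τ₀ , λ N N₀≤N →
      let τ , τ₀≤τ , lower , upper = bracket scale t≤scale τ₀ N N₀≤N
      in τ , τ₀≤τ , lower , <⇒≤ (<-≤-trans upper (ratio τ (≤-trans τ₀>0 τ₀≤τ)))
    where
    open ≤-Reasoning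
    Γ : ℕ
    Γ = 16 * fourth (2 ^ k)
    scale : ℕ → ℕ
    scale τ = 16 * fourth (τ ^ k)
    t≤scale : ∀ τ → τ ≤ scale τ
    t≤scale τ = ≤-trans (n≤n^k τ k) (≤-trans (n≤fourth (τ ^ k)) (m≤n*m (fourth (τ ^ k)) 16))
    e : ∀ x y → 16 * ((x * y) * (x * y) * ((x * y) * (x * y))) ≡ 16 * (x * x * (x * x)) * (y * y * (y * y))
    e = solve-∀
    ratio : ∀ τ → 0 < τ → scale (suc τ) ≤ Γ * fourth (τ ^ k)
    ratio τ τ>0 = begin
      16 * fourth (suc τ ^ k)                ≤⟨ *-monoʳ-≤ 16 (fourth-mono (^-monoˡ-≤ k (+-mono-≤ τ>0 (m≤m+n τ 0)))) ⟩
      16 * fourth ((2 * τ) ^ k)              ≡⟨ cong (λ z → 16 * fourth z) (*-^ 2 τ k) ⟩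
      16 * fourth (2 ^ k * τ ^ k)            ≡⟨ e (2 ^ k) (τ ^ k) ⟩
      16 * fourth (2 ^ k) * fourth (τ ^ k)   ∎

open Arithmetic
open import Data.Rational using (_*_; _-_; _≤_; _<_)
open import Data.Integer using (+_; -[1+_])

-- Rational numbers

toℚᵘ-⟦⟧ : ∀ n → toℚᵘ ⟦ n ⟧ ℚᵘ.≃ mkℚᵘ (+ n) 0
toℚᵘ-⟦⟧ n = ℚ.toℚᵘ-fromℚᵘ (mkℚᵘ (+ n) 0)

⟦⟧-mono-≤ : ∀ {m n} → m ℕ.≤ n → ⟦ m ⟧ ℚ.≤ ⟦ n ⟧
⟦⟧-mono-≤ {m} {n} m≤n = ℚ.toℚᵘ-cancel-≤ (ℚᵘ.≤-respˡ-≃ (ℚᵘ.≃-sym (toℚᵘ-⟦⟧ m)) (ℚᵘ.≤-respʳ-≃ (ℚᵘ.≃-sym (toℚᵘ-⟦⟧ n))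
  (*≤* (ℤ.*-monoʳ-≤-nonNeg (+ 1) (ℤ.+≤+ m≤n)))))

⟦⟧-cancel-≤ : ∀ {m n} → ⟦ m ⟧ ℚ.≤ ⟦ n ⟧ → m ℕ.≤ n
⟦⟧-cancel-≤ {m} {n} m≤n with ℚᵘ.≤-respˡ-≃ (toℚᵘ-⟦⟧ m) (ℚᵘ.≤-respʳ-≃ (toℚᵘ-⟦⟧ n) (ℚ.toℚᵘ-mono-≤ m≤n))
... | *≤* le = ℤ.drop‿+≤+ (subst₂ ℤ._≤_ (ℤ.*-identityʳ (+ m)) (ℤ.*-identityʳ (+ n)) le)

⟦⟧-* : ∀ m n → ⟦ m ℕ.* n ⟧ ≡ ⟦ m ⟧ ℚ.* ⟦ n ⟧
⟦⟧-* m n = ℚ.toℚᵘ-injective (begin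
  toℚᵘ ⟦ m ℕ.* n ⟧                      ≈⟨ toℚᵘ-⟦⟧ (m ℕ.* n) ⟩
  mkℚᵘ (+ (m ℕ.* n)) 0                  ≈⟨ *≡* (cong (ℤ._* + 1) (ℤ.pos-* m n)) ⟩
  mkℚᵘ (+ m) 0 ℚᵘ.* mkℚᵘ (+ n) 0        ≈⟨ ℚᵘ.*-cong (toℚᵘ-⟦⟧ m) (toℚᵘ-⟦⟧ n) ⟨
  toℚᵘ ⟦ m ⟧ ℚᵘ.* toℚᵘ ⟦ n ⟧            ≈⟨ ℚ.toℚᵘ-homo-* ⟦ m ⟧ ⟦ n ⟧ ⟨
  toℚᵘ (⟦ m ⟧ ℚ.* ⟦ n ⟧)                ∎)
  where open ℚᵘ.≃-Reasoning

⟦⟧-+ : ∀ m n → ⟦ m ℕ.+ n ⟧ ≡ ⟦ m ⟧ ℚ.+ ⟦ n ⟧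
⟦⟧-+ m n = ℚ.toℚᵘ-injective (begin
  toℚᵘ ⟦ m ℕ.+ n ⟧                      ≈⟨ toℚᵘ-⟦⟧ (m ℕ.+ n) ⟩
  mkℚᵘ (+ (m ℕ.+ n)) 0                  ≈⟨ *≡* (cong (ℤ._* + 1) (cong₂ ℤ._+_ (sym (ℤ.*-identityʳ (+ m))) (sym (ℤ.*-identityʳ (+ n))))) ⟩
  mkℚᵘ (+ m) 0 ℚᵘ.+ mkℚᵘ (+ n) 0        ≈⟨ ℚᵘ.+-cong (toℚᵘ-⟦⟧ m) (toℚᵘ-⟦⟧ n) ⟨
  toℚᵘ ⟦ m ⟧ ℚᵘ.+ toℚᵘ ⟦ n ⟧            ≈⟨ ℚ.toℚᵘ-homo-+ ⟦ m ⟧ ⟦ n ⟧ ⟨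
  toℚᵘ (⟦ m ⟧ ℚ.+ ⟦ n ⟧)                ∎)
  where open ℚᵘ.≃-Reasoning

⟦⟧-^ : ∀ m k → ⟦ m ℕ.^ k ⟧ ≡ ⟦ m ⟧ ^ℚ k
⟦⟧-^ m zero    = refl
⟦⟧-^ m (suc k) = trans (⟦⟧-* m (m ℕ.^ k)) (cong (⟦ m ⟧ ℚ.*_) (⟦⟧-^ m k))

⟦⟧-nonNegative : ∀ n → 0ℚ ℚ.≤ ⟦ n ⟧
⟦⟧-nonNegative n = ⟦⟧-mono-≤ {0} {n} ℕ.z≤n

*-mono-≤-nonNeg : ∀ {x x′ y y′} → 0ℚ ℚ.≤ x → 0ℚ ℚ.≤ y → x ℚ.≤ x′ → y ℚ.≤ y′ → x ℚ.* y ℚ.≤ x′ ℚ.* y′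
*-mono-≤-nonNeg {x} {x′} {y} {y′} 0≤x 0≤y x≤x′ y≤y′ = ℚ.≤-trans
  (ℚ.*-monoʳ-≤-nonNeg y {{ℚ.nonNegative 0≤y}} x≤x′)
  (ℚ.*-monoˡ-≤-nonNeg x′ {{ℚ.nonNegative (ℚ.≤-trans 0≤x x≤x′)}} y≤y′)

*-nonNegative : ∀ {x y} → 0ℚ ℚ.≤ x → 0ℚ ℚ.≤ y → 0ℚ ℚ.≤ x ℚ.* y
*-nonNegative {x} {y} 0≤x 0≤y = subst (ℚ._≤ x ℚ.* y) (ℚ.*-zeroˡ 0ℚ) (*-mono-≤-nonNeg ℚ.≤-refl ℚ.≤-refl 0≤x 0≤y)

^ℚ-nonNegative : ∀ {x} k → 0ℚ ℚ.≤ x → 0ℚ ℚ.≤ x ^ℚ k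
^ℚ-nonNegative zero    0≤x = ⟦⟧-nonNegative 1
^ℚ-nonNegative (suc k) 0≤x = *-nonNegative 0≤x (^ℚ-nonNegative k 0≤x)

^ℚ-mono-≤ : ∀ {x y} k → 0ℚ ℚ.≤ x → x ℚ.≤ y → x ^ℚ k ℚ.≤ y ^ℚ k
^ℚ-mono-≤ zero    0≤x x≤y = ℚ.≤-refl
^ℚ-mono-≤ (suc k) 0≤x x≤y = *-mono-≤-nonNeg 0≤x (^ℚ-nonNegative k 0≤x) x≤y (^ℚ-mono-≤ k 0≤x x≤y)

1^ℚ : ∀ k → 1ℚ ^ℚ k ≡ 1ℚ
1^ℚ zero    = refl
1^ℚ (suc k) = trans (ℚ.*-identityˡ (1ℚ ^ℚ k)) (1^ℚ k)

*-interchange : ∀ a b c d → (a ℚ.* b) ℚ.* (c ℚ.* d) ≡ (a ℚ.* c) ℚ.* (b ℚ.* d)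
*-interchange a b c d = begin
  (a ℚ.* b) ℚ.* (c ℚ.* d)   ≡⟨ ℚ.*-assoc a b (c ℚ.* d) ⟩
  a ℚ.* (b ℚ.* (c ℚ.* d))   ≡⟨ cong (a ℚ.*_) (ℚ.*-assoc b c d) ⟨
  a ℚ.* ((b ℚ.* c) ℚ.* d)   ≡⟨ cong (λ z → a ℚ.* (z ℚ.* d)) (ℚ.*-comm b c) ⟩
  a ℚ.* ((c ℚ.* b) ℚ.* d)   ≡⟨ cong (a ℚ.*_) (ℚ.*-assoc c b d) ⟩
  a ℚ.* (c ℚ.* (b ℚ.* d))   ≡⟨ ℚ.*-assoc a c (b ℚ.* d) ⟨
  (a ℚ.* c) ℚ.* (b ℚ.* d)   ∎
  where open ≡-Reasoning

^ℚ-distrib-* : ∀ x y k → (x ℚ.* y) ^ℚ k ≡ (x ^ℚ k) ℚ.* (y ^ℚ k)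
^ℚ-distrib-* x y zero    = sym (ℚ.*-identityˡ 1ℚ)
^ℚ-distrib-* x y (suc k) = trans (cong ((x ℚ.* y) ℚ.*_) (^ℚ-distrib-* x y k)) (*-interchange x y (x ^ℚ k) (y ^ℚ k))

≤-⟦⟧-numerator : ∀ x → ∃ λ n → x ℚ.≤ ⟦ n ⟧
≤-⟦⟧-numerator x@(mkℚ (+ a) d _) = a , ℚ.toℚᵘ-cancel-≤ (ℚᵘ.≤-respʳ-≃ (ℚᵘ.≃-sym (toℚᵘ-⟦⟧ a))
  (*≤* (ℤ.*-monoˡ-≤-nonNeg (+ a) (ℤ.+≤+ (ℕ.s≤s ℕ.z≤n)))))
≤-⟦⟧-numerator x@(mkℚ -[1+ a ] d _) = 0 , ℚ.toℚᵘ-cancel-≤ (*≤* ℤ.-≤+)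

1≤-multiple : ∀ c → 0ℚ ℚ.< c → ∃ λ e → 1ℚ ℚ.≤ ⟦ e ⟧ ℚ.* c
1≤-multiple c@(mkℚ (+ zero) d _) (ℚ.*<* (ℤ.+<+ ()))
1≤-multiple c@(mkℚ -[1+ a ] d _) (ℚ.*<* ())
1≤-multiple c@(mkℚ (+ suc a) d _) _ = suc d , subst (1ℚ ℚ.≤_) (ℚ.toℚᵘ-injective (begin
  toℚᵘ ⟦ suc a ⟧                              ≈⟨ toℚᵘ-⟦⟧ (suc a) ⟩
  mkℚᵘ (+ suc a) 0                            ≈⟨ *≡* (cancel (+ suc a) (+ suc d)) ⟩
  mkℚᵘ (+ suc d) 0 ℚᵘ.* mkℚᵘ (+ suc a) d      ≈⟨ ℚᵘ.*-congʳ (toℚᵘ-⟦⟧ (suc d)) ⟨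
  toℚᵘ ⟦ suc d ⟧ ℚᵘ.* toℚᵘ c                  ≈⟨ ℚ.toℚᵘ-homo-* ⟦ suc d ⟧ c ⟨
  toℚᵘ (⟦ suc d ⟧ ℚ.* c)                      ∎)) (⟦⟧-mono-≤ {1} {suc a} (ℕ.s≤s ℕ.z≤n))
  where
  open ℚᵘ.≃-Reasoning
  cancel : ∀ x y → x ℤ.* (+ 1 ℤ.* y) ≡ (y ℤ.* x) ℤ.* + 1
  cancel = ℤ-Solver.solve-∀

floor-bounds : ∀ x → 0ℚ ℚ.< x → ∃ λ k → ⟦ k ⟧ ℚ.≤ x × x ℚ.≤ ⟦ suc k ⟧
floor-bounds x@(mkℚ -[1+ a ] d _) (ℚ.*<* ())
floor-bounds x@(mkℚ (+ a) d _) _ = k ,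
  ℚ.toℚᵘ-cancel-≤ (ℚᵘ.≤-respˡ-≃ (ℚᵘ.≃-sym (toℚᵘ-⟦⟧ k)) (*≤* (subst₂ ℤ._≤_ (ℤ.pos-* k (suc d)) (sym (ℤ.*-identityʳ (+ a))) (ℤ.+≤+ (ℕ.m/n*n≤m a (suc d)))))) ,
  ℚ.toℚᵘ-cancel-≤ (ℚᵘ.≤-respʳ-≃ (ℚᵘ.≃-sym (toℚᵘ-⟦⟧ (suc k))) (*≤* (subst₂ ℤ._≤_ (sym (ℤ.*-identityʳ (+ a))) (ℤ.pos-* (suc k) (suc d)) (ℤ.+≤+ upper))))
  where
  k : ℕ
  k = a ℕ./ suc d
  upper : a ℕ.≤ suc k ℕ.* suc d
  upper = ℕ.≤-trans (ℕ.≤-reflexive (ℕ.m≡m%n+[m/n]*n a (suc d))) (ℕ.+-monoˡ-≤ (k ℕ.* suc d) (ℕ.m%n≤n a (suc d)))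

reciprocal : ∀ n .{{_ : NonZero n}} → ∃ λ c → 0ℚ ℚ.< c × c ℚ.≤ 1ℚ × c ℚ.* ⟦ n ⟧ ≡ 1ℚ
reciprocal n@(suc k) = c , positive , below , ℚ.toℚᵘ-injective (begin
  toℚᵘ (c ℚ.* ⟦ n ⟧)                    ≈⟨ ℚ.toℚᵘ-homo-* c ⟦ n ⟧ ⟩
  toℚᵘ c ℚᵘ.* toℚᵘ ⟦ n ⟧                ≈⟨ ℚᵘ.*-cong c≃ (toℚᵘ-⟦⟧ n) ⟩
  mkℚᵘ (+ 1) k ℚᵘ.* mkℚᵘ (+ n) 0        ≈⟨ *≡* (cancel (+ n)) ⟩
  toℚᵘ 1ℚ                               ∎)
  where
  open ℚᵘ.≃-Reasoning
  c : ℚ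
  c = fromℚᵘ (mkℚᵘ (+ 1) k)
  c≃ : toℚᵘ c ℚᵘ.≃ mkℚᵘ (+ 1) k
  c≃ = ℚ.toℚᵘ-fromℚᵘ (mkℚᵘ (+ 1) k)
  positive : 0ℚ ℚ.< c
  positive = ℚ.toℚᵘ-cancel-< (ℚᵘ.<-respʳ-≃ (ℚᵘ.≃-sym c≃) (ℚᵘ.*<* (ℤ.+<+ (ℕ.s≤s ℕ.z≤n))))
  below : c ℚ.≤ 1ℚ
  below = ℚ.toℚᵘ-cancel-≤ (ℚᵘ.≤-respˡ-≃ (ℚᵘ.≃-sym c≃) (*≤* (ℤ.*-monoˡ-≤-nonNeg (+ 1) (ℤ.+≤+ (ℕ.s≤s ℕ.z≤n)))))
  cancel : ∀ x → (+ 1 ℤ.* x) ℤ.* + 1 ≡ + 1 ℤ.* (x ℤ.* + 1)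
  cancel = ℤ-Solver.solve-∀

-- From almost density to finite lists of integers

density-ℕ : ∀ n c e R k → 0ℚ < c → 1ℚ ≤ ⟦ e ⟧ * c →
  (c ^ℚ n) * (⟦ R ⟧ ^ℚ n) ≤ (⟦ k ⟧ ^ℚ n) * (⟦ R ⟧ ^ℚ 1) → R ℕ.^ n ℕ.≤ e ℕ.^ n ℕ.* (k ℕ.^ n ℕ.* R)
density-ℕ n c e R k c>0 1≤ec dense = ⟦⟧-cancel-≤ {R ℕ.^ n} {e ℕ.^ n ℕ.* (k ℕ.^ n ℕ.* R)} (begin
  ⟦ R ℕ.^ n ⟧                                      ≡⟨ ⟦⟧-^ R n ⟩
  ⟦ R ⟧ ^ℚ n                                       ≡⟨ ℚ.*-identityˡ _ ⟨
  1ℚ * (⟦ R ⟧ ^ℚ n)                                ≡⟨ cong (_* (⟦ R ⟧ ^ℚ n)) (1^ℚ n) ⟨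
  (1ℚ ^ℚ n) * (⟦ R ⟧ ^ℚ n)                         ≤⟨ *-mono-≤-nonNeg (^ℚ-nonNegative n (⟦⟧-nonNegative 1)) (^ℚ-nonNegative n (⟦⟧-nonNegative R))
                                                        (^ℚ-mono-≤ n (⟦⟧-nonNegative 1) 1≤ec) ℚ.≤-refl ⟩
  ((⟦ e ⟧ * c) ^ℚ n) * (⟦ R ⟧ ^ℚ n)                ≡⟨ cong (_* (⟦ R ⟧ ^ℚ n)) (^ℚ-distrib-* ⟦ e ⟧ c n) ⟩
  ((⟦ e ⟧ ^ℚ n) * (c ^ℚ n)) * (⟦ R ⟧ ^ℚ n)         ≡⟨ ℚ.*-assoc (⟦ e ⟧ ^ℚ n) (c ^ℚ n) (⟦ R ⟧ ^ℚ n) ⟩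
  (⟦ e ⟧ ^ℚ n) * ((c ^ℚ n) * (⟦ R ⟧ ^ℚ n))         ≤⟨ *-mono-≤-nonNeg (^ℚ-nonNegative n (⟦⟧-nonNegative e))
                                                        (*-nonNegative (^ℚ-nonNegative n (ℚ.<⇒≤ c>0)) (^ℚ-nonNegative n (⟦⟧-nonNegative R))) ℚ.≤-refl dense ⟩
  (⟦ e ⟧ ^ℚ n) * ((⟦ k ⟧ ^ℚ n) * (⟦ R ⟧ ^ℚ 1))     ≡⟨ cong₂ (λ u v → u * (v * (⟦ R ⟧ ^ℚ 1))) (⟦⟧-^ e n) (⟦⟧-^ k n) ⟨
  ⟦ e ℕ.^ n ⟧ * (⟦ k ℕ.^ n ⟧ * (⟦ R ⟧ ^ℚ 1))       ≡⟨ cong (λ u → ⟦ e ℕ.^ n ⟧ * (⟦ k ℕ.^ n ⟧ * u)) (ℚ.*-identityʳ ⟦ R ⟧) ⟩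
  ⟦ e ℕ.^ n ⟧ * (⟦ k ℕ.^ n ⟧ * ⟦ R ⟧)              ≡⟨ cong (⟦ e ℕ.^ n ⟧ *_) (⟦⟧-* (k ℕ.^ n) R) ⟨
  ⟦ e ℕ.^ n ⟧ * ⟦ k ℕ.^ n ℕ.* R ⟧                  ≡⟨ ⟦⟧-* (e ℕ.^ n) (k ℕ.^ n ℕ.* R) ⟨
  ⟦ e ℕ.^ n ℕ.* (k ℕ.^ n ℕ.* R) ⟧                  ∎)
  where open ℚ.≤-Reasoning

window-ℕ : ∀ R n → ⟦ R ⟧ ≤ ⟦ n ⟧ × ⟦ n ⟧ ≤ ⟦ 2 ⟧ * ⟦ R ⟧ → R ℕ.≤ n × n ℕ.≤ 2 ℕ.* R
window-ℕ R n (R≤n , n≤2R) =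
  ⟦⟧-cancel-≤ {R} {n} R≤n , ⟦⟧-cancel-≤ {n} {2 ℕ.* R} (subst (⟦ n ⟧ ≤_) (sym (⟦⟧-* 2 R)) n≤2R)

Selection : Seq → ℕ → ℕ → Set
Selection A τ R = ∃ λ L → Unique L × All A L × All (λ n → R ℕ.≤ n × n ℕ.≤ 2 ℕ.* R) L × R ℕ.≤ τ ℕ.* length L

select : ∀ a q .{{_ : NonZero a}} → 4 ℕ.* q ≡ a ℕ.+ a → ∀ A c → 0ℚ < c → ∀ e → 1ℚ ≤ ⟦ e ⟧ * c → ∀ τ → e ℕ.* e ℕ.< τ →
  (Σ ℕ λ k → AtLeastInWindow A ⟦ τ ℕ.^ a ⟧ k ×
    (c ^ℚ (4 ℕ.* q)) * (⟦ τ ℕ.^ a ⟧ ^ℚ (4 ℕ.* q)) ≤ (⟦ k ⟧ ^ℚ (4 ℕ.* q)) * (⟦ τ ℕ.^ a ⟧ ^ℚ 1)) →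
  Selection A τ (τ ℕ.^ a)
select a q 4q≡2a A c c>0 e 1≤ec τ ee<τ (k , (L , unique , inside , k≤len) , count) =
  L , unique , All.map proj₁ inside , All.map (λ {n} t → window-ℕ R n (proj₂ t)) inside ,
  ℕ.≤-trans
    (density-exponent a e k τ ee<τ (subst (λ n → R ℕ.^ n ℕ.≤ e ℕ.^ n ℕ.* (k ℕ.^ n ℕ.* R)) 4q≡2a
      (density-ℕ (4 ℕ.* q) c e R k c>0 1≤ec count)))
    (ℕ.*-monoʳ-≤ τ k≤len)
  where
  R : ℕ
  R = τ ℕ.^ a

-- Density is used with ε = 1 / q in the window from X = τᵃ. As 4 q = 2 a, the loss X^(ε/4) is
-- τ^(1/2), and any `τ` beyond e² and the threshold of the sequence will do.
dense-selection : ∀ a q .{{_ : NonZero a}} → 0 ℕ.< q → 4 ℕ.* q ≡ a ℕ.+ a → ∀ A → AlmostDense A →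
  ∃ λ τ₀ → ∀ τ → τ₀ ℕ.≤ τ → Selection A τ (τ ℕ.^ a)
dense-selection a q q>0 4q≡2a A (_ , dense) =
  let c , c>0 , X₀ , window = dense 1 q (ℕ.s≤s ℕ.z≤n) q>0
      e , 1≤ec   = 1≤-multiple c c>0
      x₁ , X₀≤x₁ = ≤-⟦⟧-numerator X₀
  in suc (e ℕ.* e) ℕ.+ x₁ , λ τ τ₀≤τ →
    let R    = τ ℕ.^ a
        τ≤R  = n≤n^k τ a
        ee<τ = ℕ.≤-trans (ℕ.m≤m+n (suc (e ℕ.* e)) x₁) τ₀≤τ
        x₁≤τ = ℕ.≤-trans (ℕ.m≤n+m x₁ (suc (e ℕ.* e))) τ₀≤τ
    in select a q 4q≡2a A c c>0 e 1≤ec τ ee<τ (window ⟦ R ⟧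
         (ℚ.≤-trans X₀≤x₁ (⟦⟧-mono-≤ {x₁} {R} (ℕ.≤-trans x₁≤τ τ≤R)))
         (ℚ.<-≤-trans (ℚ.positive⁻¹ 1ℚ) (⟦⟧-mono-≤ {1} {R} (ℕ.≤-trans (ℕ.≤-trans (ℕ.s≤s ℕ.z≤n) ee<τ) τ≤R))))

fourth≡^4 : ∀ n → fourth n ≡ n ℕ.^ 4
fourth≡^4 n = trans (cong₂ ℕ._*_ sq sq) (sym (ℕ.^-distribˡ-+-* n 2 2))
  where
  sq : n ℕ.* n ≡ n ℕ.^ 2
  sq = cong (n ℕ.*_) (sym (ℕ.*-identityʳ n))

-- With c = 1 / Γ ≤ 1 one has c⁴ x ≤ c x ≤ R⁴, so the lower constant is rational without a fourth
-- root of `Γ`.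
size-bounds : ∀ Γ K c R v x → 0ℚ < c → c ≤ 1ℚ → c * ⟦ Γ ⟧ ≡ 1ℚ → 0ℚ ≤ x →
  ⟦ fourth R ⟧ ≤ x → x ≤ ⟦ Γ ℕ.* fourth R ⟧ → R ℕ.≤ v → v ℕ.≤ K ℕ.* R →
  (c ^ℚ 4) * x ≤ ⟦ v ⟧ ^ℚ 4 × ⟦ v ⟧ ^ℚ 4 ≤ (⟦ K ⟧ ^ℚ 4) * x
size-bounds Γ K c R v x c>0 c≤1 cΓ≡1 x≥0 R⁴≤x x≤ΓR⁴ R≤v v≤KR = lower , upper
  where
  open ℚ.≤-Reasoning
  c≥0 : 0ℚ ≤ c
  c≥0 = ℚ.<⇒≤ c>0
  c³≤1 : c ^ℚ 3 ≤ 1ℚ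
  c³≤1 = subst (c ^ℚ 3 ≤_) (1^ℚ 3) (^ℚ-mono-≤ 3 c≥0 c≤1)
  lower : (c ^ℚ 4) * x ≤ ⟦ v ⟧ ^ℚ 4
  lower = begin
    (c * (c ^ℚ 3)) * x            ≤⟨ *-mono-≤-nonNeg (^ℚ-nonNegative 4 c≥0) x≥0 (*-mono-≤-nonNeg c≥0 (^ℚ-nonNegative 3 c≥0) ℚ.≤-refl c³≤1) x≤ΓR⁴ ⟩
    (c * 1ℚ) * ⟦ Γ ℕ.* fourth R ⟧ ≡⟨ cong₂ _*_ (ℚ.*-identityʳ c) (⟦⟧-* Γ (fourth R)) ⟩
    c * (⟦ Γ ⟧ * ⟦ fourth R ⟧)    ≡⟨ ℚ.*-assoc c ⟦ Γ ⟧ ⟦ fourth R ⟧ ⟨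
    (c * ⟦ Γ ⟧) * ⟦ fourth R ⟧    ≡⟨ cong (_* ⟦ fourth R ⟧) cΓ≡1 ⟩
    1ℚ * ⟦ fourth R ⟧             ≡⟨ ℚ.*-identityˡ ⟦ fourth R ⟧ ⟩
    ⟦ fourth R ⟧                  ≤⟨ ⟦⟧-mono-≤ {fourth R} {fourth v} (fourth-mono R≤v) ⟩
    ⟦ fourth v ⟧                  ≡⟨ trans (cong ⟦_⟧ (fourth≡^4 v)) (⟦⟧-^ v 4) ⟩
    ⟦ v ⟧ ^ℚ 4                    ∎
  upper : ⟦ v ⟧ ^ℚ 4 ≤ (⟦ K ⟧ ^ℚ 4) * x
  upper = begin
    ⟦ v ⟧ ^ℚ 4                        ≤⟨ ^ℚ-mono-≤ 4 (⟦⟧-nonNegative v) (⟦⟧-mono-≤ {v} {K ℕ.* R} v≤KR) ⟩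
    ⟦ K ℕ.* R ⟧ ^ℚ 4                  ≡⟨ cong (_^ℚ 4) (⟦⟧-* K R) ⟩
    (⟦ K ⟧ * ⟦ R ⟧) ^ℚ 4              ≡⟨ ^ℚ-distrib-* ⟦ K ⟧ ⟦ R ⟧ 4 ⟩
    (⟦ K ⟧ ^ℚ 4) * (⟦ R ⟧ ^ℚ 4)       ≡⟨ cong ((⟦ K ⟧ ^ℚ 4) *_) (trans (cong ⟦_⟧ (fourth≡^4 R)) (⟦⟧-^ R 4)) ⟨
    (⟦ K ⟧ ^ℚ 4) * ⟦ fourth R ⟧       ≤⟨ *-mono-≤-nonNeg (^ℚ-nonNegative 4 (⟦⟧-nonNegative K)) (⟦⟧-nonNegative (fourth R)) ℚ.≤-refl R⁴≤x ⟩
    (⟦ K ⟧ ^ℚ 4) * x                  ∎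

difference-bound : ∀ a b n k H Y x → ⟦ k ⟧ ≤ x → x ≤ ⟦ n ⟧ → n ℕ.≤ k ℕ.+ H → ⟦ Y ⟧ ≤ x →
  H ℕ.^ a ℕ.≤ Y ℕ.^ b → (⟦ n ⟧ - x) ^ℚ a ≤ x ^ℚ b
difference-bound a b n k H Y x k≤x x≤n n≤k+H Y≤x Hᵃ≤Yᵇ = begin
  (⟦ n ⟧ - x) ^ℚ a   ≤⟨ ^ℚ-mono-≤ a 0≤n-x n-x≤H ⟩
  ⟦ H ⟧ ^ℚ a         ≡⟨ ⟦⟧-^ H a ⟨
  ⟦ H ℕ.^ a ⟧        ≤⟨ ⟦⟧-mono-≤ {H ℕ.^ a} {Y ℕ.^ b} Hᵃ≤Yᵇ ⟩
  ⟦ Y ℕ.^ b ⟧        ≡⟨ ⟦⟧-^ Y b ⟩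
  ⟦ Y ⟧ ^ℚ b         ≤⟨ ^ℚ-mono-≤ b (⟦⟧-nonNegative Y) Y≤x ⟩
  x ^ℚ b             ∎
  where
  open ℚ.≤-Reasoning
  0≤n-x : 0ℚ ≤ ⟦ n ⟧ - x
  0≤n-x = subst (_≤ ⟦ n ⟧ - x) (ℚ.+-inverseʳ x) (ℚ.+-monoˡ-≤ (ℚ.- x) x≤n)
  n-x≤H : ⟦ n ⟧ - x ≤ ⟦ H ⟧
  n-x≤H = begin
    ⟦ n ⟧ - x                  ≤⟨ ℚ.+-monoˡ-≤ (ℚ.- x) (⟦⟧-mono-≤ {n} {k ℕ.+ H} n≤k+H) ⟩
    ⟦ k ℕ.+ H ⟧ - x            ≡⟨ cong (_- x) (⟦⟧-+ k H) ⟩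
    (⟦ k ⟧ ℚ.+ ⟦ H ⟧) - x      ≤⟨ ℚ.+-monoˡ-≤ (ℚ.- x) (ℚ.+-monoˡ-≤ ⟦ H ⟧ k≤x) ⟩
    (x ℚ.+ ⟦ H ⟧) - x          ≡⟨ cong (_- x) (ℚ.+-comm x ⟦ H ⟧) ⟩
    (⟦ H ⟧ ℚ.+ x) - x          ≡⟨ ℚ.+-assoc ⟦ H ⟧ x (ℚ.- x) ⟩
    ⟦ H ⟧ ℚ.+ (x - x)          ≡⟨ cong (⟦ H ⟧ ℚ.+_) (ℚ.+-inverseʳ x) ⟩
    ⟦ H ⟧ ℚ.+ 0ℚ               ≡⟨ ℚ.+-identityʳ ⟦ H ⟧ ⟩
    ⟦ H ⟧                      ∎

-- Assembling the representation near x

Represented : (p q : ℕ) (A₁ A₂ A₃ : Seq) (c C x : ℚ) → Set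
Represented p q A₁ A₂ A₃ c C x =
  Σ ℕ λ n → Σ ℕ λ m → Σ ℕ λ a₁ → Σ ℕ λ a₂ → Σ ℕ λ a₃ →
    A₁ a₁ × A₂ a₂ × A₃ a₃ × 0 ℕ.< m ×
    n ≡ m ℕ.* a₁ ℕ.* a₂ ℕ.* a₃ ×
    x ≤ ⟦ n ⟧ ×
    (⟦ n ⟧ - x) ^ℚ (55 ℕ.* q) ≤ x ^ℚ (34 ℕ.* q ℕ.+ 55 ℕ.* p) ×
    (c ^ℚ 4) * x ≤ ⟦ a₁ ⟧ ^ℚ 4 × ⟦ a₁ ⟧ ^ℚ 4 ≤ (C ^ℚ 4) * x ×
    (c ^ℚ 4) * x ≤ ⟦ a₂ ⟧ ^ℚ 4 × ⟦ a₂ ⟧ ^ℚ 4 ≤ (C ^ℚ 4) * x ×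
    (c ^ℚ 4) * x ≤ ⟦ a₃ ⟧ ^ℚ 4 × ⟦ a₃ ⟧ ^ℚ 4 ≤ (C ^ℚ 4) * x ×
    (c ^ℚ 4) * x ≤ ⟦ m ⟧ ^ℚ 4 × ⟦ m ⟧ ^ℚ 4 ≤ (C ^ℚ 4) * x

module _ (p q : ℕ) (A₁ A₂ A₃ : Seq) (Γ : ℕ) (Γ≥2 : 2 ℕ.≤ Γ) (c : ℚ) (c>0 : 0ℚ < c) (c≤1 : c ≤ 1ℚ) (cΓ≡1 : c * ⟦ Γ ⟧ ≡ 1ℚ)
         (τ : ℕ) (880≤τ : 880 ℕ.≤ τ) (Γ<τ : 2 ℕ.* (1044 ℕ.* 41 ℕ.* Γ) ℕ.< τ)
  where

  open Parameters τ Γ 880≤τ Γ<τ Γ≥2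

  module _ (x : ℚ) (k : ℕ) (x>0 : 0ℚ < x) (k≤x : ⟦ k ⟧ ≤ x) (x≤N : x ≤ ⟦ suc k ⟧)
           (N≥ : 16 ℕ.* fourth R ℕ.≤ suc k) (N≤ : suc k ℕ.≤ Γ ℕ.* fourth R)
    where

    represent-at : ∀ m i b d → i ℕ.≤ R → b ℕ.≤ R → d ℕ.≤ R →
      A₁ (R ℕ.+ i) → A₂ (R ℕ.+ b) → A₃ (R ℕ.+ d) →
      suc k ℕ.≤ m ℕ.* (R ℕ.+ i) ℕ.* (R ℕ.+ b) ℕ.* (R ℕ.+ d) →
      m ℕ.* (R ℕ.+ i) ℕ.* (R ℕ.+ b) ℕ.* (R ℕ.+ d) ℕ.≤ suc k ℕ.+ 4 ℕ.* (R ℕ.* R) ℕ.* w →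
      Represented p q A₁ A₂ A₃ c ⟦ Γ ℕ.+ 4 ⟧ x
    represent-at m i b d i≤R b≤R d≤R in₁ in₂ in₃ lower upper =
      n , m , R ℕ.+ i , R ℕ.+ b , R ℕ.+ d , in₁ , in₂ , in₃ ,
      ℕ.≤-trans (ℕ.>-nonZero⁻¹ R) (proj₁ m-bounds) , refl , x≤n ,
      -- The product is bounded from N = k + 1, but only k is known to lie below x; the `suc` on the
      -- length makes up for this.
      difference-bound (55 ℕ.* q) (34 ℕ.* q ℕ.+ 55 ℕ.* p) n k (suc (4 ℕ.* (R ℕ.* R) ℕ.* w)) (fourth R) x k≤x x≤n
        (ℕ.≤-trans upper (ℕ.≤-reflexive (sym (ℕ.+-suc k (4 ℕ.* (R ℕ.* R) ℕ.* w))))) R⁴≤x (width-exponent p q) ,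
      proj₁ (near i i≤R) , proj₂ (near i i≤R) , proj₁ (near b b≤R) , proj₂ (near b b≤R) ,
      proj₁ (near d d≤R) , proj₂ (near d d≤R) , proj₁ m-size , proj₂ m-size
      where
      n : ℕ
      n = m ℕ.* (R ℕ.+ i) ℕ.* (R ℕ.+ b) ℕ.* (R ℕ.+ d)
      x≤n : x ≤ ⟦ n ⟧
      x≤n = ℚ.≤-trans x≤N (⟦⟧-mono-≤ {suc k} {n} lower)
      -- Of the 16 copies of `fourth R` below `suc k`, one pays for the `suc`.
      R⁴≤k : fourth R ℕ.≤ k
      R⁴≤k = ℕ.≤-pred (ℕ.≤-trans (ℕ.+-mono-≤ (ℕ.≤-trans (ℕ.>-nonZero⁻¹ R) (n≤fourth R)) (ℕ.m≤n*m (fourth R) 15)) N≥)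
      R⁴≤x : ⟦ fourth R ⟧ ≤ x
      R⁴≤x = ℚ.≤-trans (⟦⟧-mono-≤ {fourth R} {k} R⁴≤k) k≤x
      size : ∀ v → R ℕ.≤ v → v ℕ.≤ (Γ ℕ.+ 4) ℕ.* R → (c ^ℚ 4) * x ≤ ⟦ v ⟧ ^ℚ 4 × ⟦ v ⟧ ^ℚ 4 ≤ (⟦ Γ ℕ.+ 4 ⟧ ^ℚ 4) * x
      size v = size-bounds Γ (Γ ℕ.+ 4) c R v x c>0 c≤1 cΓ≡1 (ℚ.<⇒≤ x>0) R⁴≤x (ℚ.≤-trans x≤N (⟦⟧-mono-≤ {suc k} {Γ ℕ.* fourth R} N≤))
      near : ∀ i → i ℕ.≤ R → (c ^ℚ 4) * x ≤ ⟦ R ℕ.+ i ⟧ ^ℚ 4 × ⟦ R ℕ.+ i ⟧ ^ℚ 4 ≤ (⟦ Γ ℕ.+ 4 ⟧ ^ℚ 4) * x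
      near i i≤R = size (R ℕ.+ i) (ℕ.m≤m+n R i) (ℕ.≤-trans
        (ℕ.+-monoʳ-≤ R (ℕ.≤-trans i≤R (ℕ.m≤m+n R 0))) (ℕ.*-monoˡ-≤ R (ℕ.≤-trans Γ≥2 (ℕ.m≤m+n Γ 4))))
      m-bounds : R ℕ.≤ m × m ℕ.≤ (Γ ℕ.+ 4) ℕ.* R
      m-bounds = cofactor-bounds (suc k) N≥ N≤ m i b d i≤R b≤R d≤R lower upper
      m-size : (c ^ℚ 4) * x ≤ ⟦ m ⟧ ^ℚ 4 × ⟦ m ⟧ ^ℚ 4 ≤ (⟦ Γ ℕ.+ 4 ⟧ ^ℚ 4) * x
      m-size = size m (proj₁ m-bounds) (proj₂ m-bounds)

    represent : Selection A₁ τ R → Selection A₂ τ R → Selection A₃ τ R → Represented p q A₁ A₂ A₃ c ⟦ Γ ℕ.+ 4 ⟧ x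
    represent (L₁ , u₁ , in₁ , w₁ , d₁) (L₂ , u₂ , in₂ , w₂ , d₂) (L₃ , u₃ , in₃ , w₃ , d₃) =
      let i , b , d , m , (i≤R , b≤R , d≤R) , (α>0 , β>0 , γ>0) , lower , upper =
            product-near (suc k) N≥ N≤
              (λ i → multiplicity L₁ (R ℕ.+ i)) (λ i → multiplicity L₂ (R ℕ.+ i)) (λ i → multiplicity L₃ (R ℕ.+ i))
              (λ i → multiplicity≤1 L₁ u₁ (R ℕ.+ i)) (λ i → multiplicity≤1 L₂ u₂ (R ℕ.+ i)) (λ i → multiplicity≤1 L₃ u₃ (R ℕ.+ i))
              (ℕ.≤-trans d₁ (ℕ.*-monoʳ-≤ τ (length≤multiplicities R L₁ w₁)))
              (ℕ.≤-trans d₂ (ℕ.*-monoʳ-≤ τ (length≤multiplicities R L₂ w₂)))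
              (ℕ.≤-trans d₃ (ℕ.*-monoʳ-≤ τ (length≤multiplicities R L₃ w₃)))
      in represent-at m i b d i≤R b≤R d≤R
           (multiplicity-positive L₁ in₁ α>0) (multiplicity-positive L₂ in₂ β>0) (multiplicity-positive L₃ in₃ γ>0) lower upper

theorem2 : (p q : ℕ) → 0 ℕ.< p → 0 ℕ.< q →
    (A₁ A₂ A₃ : Seq) → AlmostDense A₁ → AlmostDense A₂ → AlmostDense A₃ →
    Σ ℚ λ c → Σ ℚ λ C → 0ℚ < c × c < C ×
    Σ ℚ λ x₀ → ∀ (x : ℚ) → x₀ ≤ x → 0ℚ < x →
    Σ ℕ λ n → Σ ℕ λ m → Σ ℕ λ a₁ → Σ ℕ λ a₂ → Σ ℕ λ a₃ →
    A₁ a₁ × A₂ a₂ × A₃ a₃ × 0 ℕ.< m ×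
    n ≡ m ℕ.* a₁ ℕ.* a₂ ℕ.* a₃ ×
    x ≤ ⟦ n ⟧ ×
    (⟦ n ⟧ - x) ^ℚ (55 ℕ.* q) ≤ x ^ℚ (34 ℕ.* q ℕ.+ 55 ℕ.* p) ×
    (c ^ℚ 4) * x ≤ ⟦ a₁ ⟧ ^ℚ 4 × ⟦ a₁ ⟧ ^ℚ 4 ≤ (C ^ℚ 4) * x ×
    (c ^ℚ 4) * x ≤ ⟦ a₂ ⟧ ^ℚ 4 × ⟦ a₂ ⟧ ^ℚ 4 ≤ (C ^ℚ 4) * x ×
    (c ^ℚ 4) * x ≤ ⟦ a₃ ⟧ ^ℚ 4 × ⟦ a₃ ⟧ ^ℚ 4 ≤ (C ^ℚ 4) * x ×
    (c ^ℚ 4) * x ≤ ⟦ m ⟧ ^ℚ 4 × ⟦ m ⟧ ^ℚ 4 ≤ (C ^ℚ 4) * x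
theorem2 p q _ _ A₁ A₂ A₃ dense₁ dense₂ dense₃ =
  conclude (scaling 50) (selections A₁ dense₁) (selections A₂ dense₂) (selections A₃ dense₃)
  where
  Selections : Seq → Set
  Selections A = ∃ λ τ₀ → ∀ τ → τ₀ ℕ.≤ τ → Selection A τ (τ ℕ.^ 50)
  selections : ∀ A → AlmostDense A → Selections A
  -- As 4 * 25 = 50 + 50, density enters with ε = 1 / 25, that is with the exponent 1 - 1 / 100.
  selections = dense-selection 50 25 (ℕ.s≤s ℕ.z≤n) refl
  conclude : (∃ λ Γ → 2 ℕ.≤ Γ × Scaling 50 Γ) → Selections A₁ → Selections A₂ → Selections A₃ →
    Σ ℚ λ c → Σ ℚ λ C → 0ℚ < c × c < C × Σ ℚ λ x₀ → ∀ x → x₀ ≤ x → 0ℚ < x → Represented p q A₁ A₂ A₃ c C x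
  conclude (Γ , Γ≥2 , scales) (τ₁ , select₁) (τ₂ , select₂) (τ₃ , select₃) =
    c , ⟦ Γ ℕ.+ 4 ⟧ , c>0 , c<C , ⟦ proj₁ located ⟧ , represented
    where
    inverse = reciprocal Γ {{ℕ.>-nonZero (ℕ.≤-trans (ℕ.s≤s ℕ.z≤n) Γ≥2)}}
    c    = proj₁ inverse
    c>0  = proj₁ (proj₂ inverse)
    c≤1  = proj₁ (proj₂ (proj₂ inverse))
    cΓ≡1 = proj₂ (proj₂ (proj₂ inverse))
    c<C : c < ⟦ Γ ℕ.+ 4 ⟧
    c<C = ℚ.≤-<-trans c≤1 (ℚ.≰⇒> λ C≤1 → ℕ.<⇒≱ (ℕ.≤-trans Γ≥2 (ℕ.m≤m+n Γ 4)) (⟦⟧-cancel-≤ {Γ ℕ.+ 4} {1} C≤1))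
    -- All thresholds for `τ` are added up, so that `τ₀` exceeds each of them.
    bound τ₀₁ τ₂₃ τ₀ : ℕ
    bound = suc (2 ℕ.* (1044 ℕ.* 41 ℕ.* Γ))
    τ₀₁   = 880 ℕ.+ bound ℕ.+ τ₁
    τ₂₃   = τ₂ ℕ.+ τ₃
    τ₀    = τ₀₁ ℕ.+ τ₂₃
    located = scales τ₀ (ℕ.s≤s ℕ.z≤n)
    represented : ∀ x → ⟦ proj₁ located ⟧ ≤ x → 0ℚ < x → Represented p q A₁ A₂ A₃ c ⟦ Γ ℕ.+ 4 ⟧ x
    represented x x₀≤x x>0 =
      let k , k≤x , x≤N = floor-bounds x x>0
          τ , τ₀≤τ , N≥ , N≤ = proj₂ located (suc k) (⟦⟧-cancel-≤ {proj₁ located} {suc k} (ℚ.≤-trans x₀≤x x≤N))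
          τ₀₁≤τ = ℕ.≤-trans (ℕ.m≤m+n τ₀₁ τ₂₃) τ₀≤τ
          τ₂₃≤τ = ℕ.≤-trans (ℕ.m≤n+m τ₂₃ τ₀₁) τ₀≤τ
          large = ℕ.≤-trans (ℕ.m≤m+n (880 ℕ.+ bound) τ₁) τ₀₁≤τ
      in represent p q A₁ A₂ A₃ Γ Γ≥2 c c>0 c≤1 cΓ≡1 τ
           (ℕ.≤-trans (ℕ.m≤m+n 880 bound) large) (ℕ.≤-trans (ℕ.m≤n+m bound 880) large)
           x k x>0 k≤x x≤N N≥ N≤
           (select₁ τ (ℕ.≤-trans (ℕ.m≤n+m τ₁ (880 ℕ.+ bound)) τ₀₁≤τ))
           (select₂ τ (ℕ.≤-trans (ℕ.m≤m+n τ₂ τ₃) τ₂₃≤τ))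
           (select₃ τ (ℕ.≤-trans (ℕ.m≤n+m τ₃ τ₂) τ₂₃≤τ))
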